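{- Let $n\ge 1$ be an integer. The poset $P^B_n$ of $(21,\overline{2}\,\overline{1})$-avoiding elements of the hyperoctahedral group $B_n$, ordered by containment of the descent set, is an extension of the refinement order on the type-B noncrossing partition lattice $NC^B_n$; that is, there is a bijection $\varphi\colon NC^B_n\to P^B_n$ such that $\pi<\pi'$ in $NC^B_n$ implies $\varphi(\pi)<\varphi(\pi')$ in $P^B_n$. The poset $P^B_n$ has the same rank generating function as $NC^B_n$, therefore it is rank-symmetric and rank-unimodal, and it is a self-dual and strongly Sperner poset.
   Context: Let $[n]=\{1,\dots,n\}$. Type-B noncrossing partitions. Consider the set $\{1,2,\dots,n,\overline{1},\overline{2},\dots,\overline{n}\}$ with the involution $a\mapsto\overline{a}$ (so $\overline{\overline{a}}=a$). A type-B partition of $[n]$ is a set partition of this set such that (i) if $\{a_1,\dots,a_k\}$ is a block then $\{\overline{a_1},\dots,\overline{a_k}\}$ is also a block, and (ii) there is at most one block invariant under the bar operation (the zero-block, if present). Place $1,2,\dots,n,\overline{1},\overline{2},\dots,\overline{n}$ clockwise in this order around a circle. A type-B partition is noncrossing if there are no four elements $a,b,c,d$ in clockwise order around the circle with $a,c$ in one block and $b,d$ in another block. $NC^B_n$ is the set of type-B noncrossing partitions of $[n]$ ordered by refinement ($\pi\le\pi'$ if each block of $\pi'$ is a union of blocks of $\pi$). It is ranked by $\mathrm{rk}(\pi)=n-\#\{\text{pairs } \{\beta,\overline{\beta}\} \text{ of non-zero blocks of } \pi\}$. Signed permutations. Elements of $B_n$ are words $b=b_1b_2\cdots b_n$ in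 which each of $1,\dots,n$ appears exactly once, barred or unbarred; $|b_i|\in[n]$ is the symbol $b_i$ with any bar removed. The signed permutation $b$ is $(21,\overline{2}\,\overline{1})$-avoiding if there are no indices $1\le i<j\le n$ such that $b_i,b_j$ are both barred or both unbarred and $|b_i|>|b_j|$. With respect to the total order $1<2<\cdots<n<\overline{n}<\cdots<\overline{2}<\overline{1}$, $b$ has a descent at $i$ (for $1\le i\le n-1$) if $b_i>b_{i+1}$, and it has a descent at $n$ if $b_n$ is barred; $\mathrm{Des}(b)\subseteq[n]$ is the set of descents. $P^B_n$ is the set of $(21,\overline{2}\,\overline{1})$-avoiding elements of $B_n$, with strict order $b<b'$ if and only if $\mathrm{Des}(b)\subsetneq\mathrm{Des}(b')$ (distinct elements with equal descent set are incomparable). It is ranked by $\mathrm{rk}(b)=\#\mathrm{Des}(b)$. For a finite ranked poset whose ranks run over $0,1,\dots,r$, with $w_k$ elements of rank $k$: the rank generating function is $\sum_{k=0}^r w_kx^k$; the poset is rank-symmetric if $w_k=w_{r-k}$ for all $k$; rank-unimodal if $w_0\le\cdots\le w_j\ge\cdots\ge w_r$ for some $j$; strongly Sperner if for every $k\ge1$ the maximum cardinality of a union of $k$ antichains equals the sum of the $k$ largest rank sizes. A poset is self-dual if it is isomorphic to its order dual. -}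

module Defs where

open import Data.Empty using (⊥)
open import Data.Unit using (⊤; tt)
import Data.Bool.Properties as Bool
open import Data.Nat.Base using (ℕ; suc; _+_; _∸_; _≤_; _<_)
open import Data.Nat.Properties using (m∸n≤m; ≤-decTotalOrder)
open import Data.Nat.ListAction using (sum)
open import Data.Fin.Base as Fin using (Fin; splitAt; join)
import Data.Fin.Properties as Fin
open import Data.Fin.Subset using (Subset; _∈_; _⊆_; _⊂_; _∪_; ⋃; ∣_∣)
open import Data.Fin.Subset.Properties
  using (∣p∣≤n; ⊆-antisym; ∪-identityʳ; ∪-identityˡ; ∪-assoc;
         x∈p∪q⁻; x∈p∪q⁺; ∉⊥; ⊂-strictPartialOrder)
open import Data.List.Base
  using (List; []; _∷_; _++_; length; filter; deduplicate; applyUpTo; take; reverse)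
open import Data.List.Relation.Unary.All using (All; []; _∷_)
open import Data.List.Relation.Unary.All.Properties using (++⁺)
import Data.List.Membership.Setoid as Membership
import Data.List.Relation.Unary.Unique.Setoid as Unique
open import Data.List.Sort ≤-decTotalOrder using (sort)
open import Data.Product using (Σ; ∃!; ∃-syntax; _×_; _,_)
open import Data.Sum.Base using (_⊎_; inj₁; inj₂; swap)
open import Data.Sum.Relation.Binary.LeftOrder using (_⊎-<_; ⊎-<-decidable)
open import Data.Vec.Base using (Vec; []; _∷_; lookup; tabulate; toList)
open import Data.Vec.Properties using (≡-dec; tabulate∘lookup; tabulate-cong)
open import Function.Base using (_∘_; flip)
open import Function.Bundles using (_⇔_; Bijection)
open import Level using (0ℓ)
open import Relation.Binary.Bundles using (Setoid; Poset; StrictPartialOrder)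
open import Relation.Binary.Core using (Rel)
open import Relation.Binary.Definitions using (Decidable; DecidableEquality)
open import Relation.Binary.Morphism.Structures using (IsOrderIsomorphism)
open import Relation.Binary.PropositionalEquality
  using (_≡_; refl; sym; trans; cong; subst; isEquivalence)
import Relation.Binary.Construct.On as On
import Relation.Binary.Properties.Poset as PosetProperties
import Relation.Binary.Properties.StrictPartialOrder as SPOProperties
open import Relation.Nullary.Decidable using (Dec; yes; no; does; ¬?; _⊎-dec_)
open import Relation.Nullary.Negation using (¬_)
open import Relation.Unary as Unary using (Pred)

-- Signed symbols: `plain i` is the number i + 1, `barred i` is the same
-- number with a bar.

Symbol : ℕ → Set
Symbol n = Fin n ⊎ Fin n

pattern plain  i = inj₁ i
pattern barred i = inj₂ i

Barred : ∀ {n} → Symbol n → Set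
Barred (plain  _) = ⊥
Barred (barred _) = ⊤

barred? : ∀ {n} (x : Symbol n) → Dec (Barred x)
barred? (plain  _) = no λ ()
barred? (barred _) = yes tt

abs : ∀ {n} → Symbol n → Fin n
abs (plain  i) = i
abs (barred i) = i

-- Set partitions of Fin m.  A partition is given by the map sending
-- each point to the block containing it, so that equal partitions have
-- propositionally equal data.

record SetPartition (m : ℕ) : Set where
  field
    blockOf       : Vec (Subset m) m
    a∈blockOf[a]  : ∀ a → a ∈ lookup blockOf a
    blocks-agree  : ∀ {a b} → b ∈ lookup blockOf a → lookup blockOf b ≡ lookup blockOf a

  IsBlock : Subset m → Set
  IsBlock β = ∃[ a ] lookup blockOf a ≡ β

  -- Each block is listed as many times as it has elements.
  blockList : List (Subset m)
  blockList = toList blockOf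

open SetPartition public

_≈ₚ_ : ∀ {m} → Rel (SetPartition m) 0ℓ
π ≈ₚ π′ = blockOf π ≡ blockOf π′

_≤ₚ_ : ∀ {m} → Rel (SetPartition m) 0ℓ
π ≤ₚ π′ = ∀ β′ → IsBlock π′ β′ → ∃[ βs ] All (IsBlock π) βs × β′ ≡ ⋃ βs

module _ {m : ℕ} where

  private
    ∈⋃⁻ : ∀ {a} (βs : List (Subset m)) {P : Subset m → Set} → All P βs →
          a ∈ ⋃ βs → ∃[ β ] P β × a ∈ β × β ⊆ ⋃ βs
    ∈⋃⁻ []       []         a∈ with () ← ∉⊥ a∈
    ∈⋃⁻ (β ∷ βs) (pβ ∷ pβs) a∈ with x∈p∪q⁻ β (⋃ βs) a∈
    ... | inj₁ a∈β  = β , pβ , a∈β , λ x∈ → x∈p∪q⁺ (inj₁ x∈)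
    ... | inj₂ a∈βs with γ , pγ , a∈γ , γ⊆ ← ∈⋃⁻ βs pβs a∈βs =
      γ , pγ , a∈γ , λ x∈ → x∈p∪q⁺ (inj₂ (γ⊆ x∈))

    ⋃-++ : ∀ (βs γs : List (Subset m)) → ⋃ (βs ++ γs) ≡ ⋃ βs ∪ ⋃ γs
    ⋃-++ []       γs = sym (∪-identityˡ (⋃ γs))
    ⋃-++ (β ∷ βs) γs =
      trans (cong (β ∪_) (⋃-++ βs γs)) (sym (∪-assoc β (⋃ βs) (⋃ γs)))

  ≤ₚ-reflexive : {π π′ : SetPartition m} → π ≈ₚ π′ → π ≤ₚ π′
  ≤ₚ-reflexive refl β isβ = (β ∷ []) , (isβ ∷ []) , sym (∪-identityʳ β)

  ≤ₚ-trans : {π π′ π″ : SetPartition m} → π ≤ₚ π′ → π′ ≤ₚ π″ → π ≤ₚ π″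
  ≤ₚ-trans {π} {π′} π≤π′ π′≤π″ β″ isβ″
    with βs′ , are , refl ← π′≤π″ β″ isβ″ = refine βs′ are
    where
    refine : ∀ βs′ → All (IsBlock π′) βs′ →
             ∃[ βs ] All (IsBlock π) βs × ⋃ βs′ ≡ ⋃ βs
    refine []         []           = [] , [] , refl
    refine (β′ ∷ βs′) (isβ′ ∷ are)
      with βs , areβ , refl ← π≤π′ β′ isβ′ | γs , areγ , eq ← refine βs′ are =
      βs ++ γs , ++⁺ areβ areγ , trans (cong (⋃ βs ∪_) eq) (sym (⋃-++ βs γs))

  ≤ₚ⇒blockOf-⊆ : {π π′ : SetPartition m} → π ≤ₚ π′ →
                 ∀ a → lookup (blockOf π) a ⊆ lookup (blockOf π′) a
  ≤ₚ⇒blockOf-⊆ {π} {π′} π≤π′ a x∈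
    with βs , are , eq ← π≤π′ _ (a , refl)
    with β , (b , refl) , a∈β , β⊆ ← ∈⋃⁻ βs are (subst (a ∈_) eq (a∈blockOf[a] π′ a)) =
    subst (_ ∈_) (sym eq) (β⊆ (subst (_ ∈_) (blocks-agree π a∈β) x∈))

  ≤ₚ-antisym : {π π′ : SetPartition m} → π ≤ₚ π′ → π′ ≤ₚ π → π ≈ₚ π′
  ≤ₚ-antisym {π} {π′} π≤π′ π′≤π =
    trans (sym (tabulate∘lookup (blockOf π)))
      (trans (tabulate-cong λ a → ⊆-antisym (≤ₚ⇒blockOf-⊆ {π} {π′} π≤π′ a)
                                            (≤ₚ⇒blockOf-⊆ {π′} {π} π′≤π a))
        (tabulate∘lookup (blockOf π′)))

refinementPoset : ℕ → Poset 0ℓ 0ℓ 0ℓ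
refinementPoset m = record
  { Carrier        = SetPartition m
  ; _≈_            = _≈ₚ_
  ; _≤_            = _≤ₚ_
  ; isPartialOrder = record
    { isPreorder = record
      { isEquivalence = On.isEquivalence blockOf isEquivalence
      ; reflexive     = λ {π} {π′} → ≤ₚ-reflexive {π = π} {π′}
      ; trans         = λ {π} {π′} {π″} → ≤ₚ-trans {π = π} {π′} {π″}
      }
    ; antisym = λ {π} {π′} → ≤ₚ-antisym {π = π} {π′}
    }
  }

-- Type-B noncrossing partitions.  The points 1, …, n, 1̄, …, n̄ are the
-- elements of Fin (n + n) in increasing order, read clockwise.

module _ (n : ℕ) where

  bar : Fin (n + n) → Fin (n + n)
  bar = join n n ∘ swap ∘ splitAt n

  -- As bar is an involution, this is the image of β under bar.
  barBlock : Subset (n + n) → Subset (n + n)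
  barBlock β = tabulate (lookup β ∘ bar)

  IsZeroBlock : Subset (n + n) → Set
  IsZeroBlock β = barBlock β ≡ β

  Clockwise : (a b c d : Fin (n + n)) → Set
  Clockwise a b c d = Increasing a b c d ⊎ Increasing b c d a
                    ⊎ Increasing c d a b ⊎ Increasing d a b c
    where
    Increasing : (a b c d : Fin (n + n)) → Set
    Increasing a b c d = a Fin.< b × b Fin.< c × c Fin.< d

  record IsTypeB (π : SetPartition (n + n)) : Set where
    field
      bar-closed       : ∀ β → IsBlock π β → IsBlock π (barBlock β)
      zeroBlock-unique : ∀ β γ → IsBlock π β → IsBlock π γ →
                         IsZeroBlock β → IsZeroBlock γ → β ≡ γ

  IsNoncrossing : SetPartition (n + n) → Set
  IsNoncrossing π = ∀ β γ → IsBlock π β → IsBlock π γ →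
    ∀ a b c d → Clockwise a b c d →
    a ∈ β → c ∈ β → b ∈ γ → d ∈ γ → β ≡ γ

  _≟ˢ_ : DecidableEquality (Subset (n + n))
  _≟ˢ_ = ≡-dec Bool._≟_

  SamePair : Rel (Subset (n + n)) 0ℓ
  SamePair β γ = γ ≡ β ⊎ γ ≡ barBlock β

  samePair? : Decidable SamePair
  samePair? β γ = (γ ≟ˢ β) ⊎-dec (γ ≟ˢ barBlock β)

  nonzeroPairs : List (Subset (n + n)) → ℕ
  nonzeroPairs βs = length (deduplicate samePair?
    (filter (λ β → ¬? (barBlock β ≟ˢ β)) βs))

record NCᴮ (n : ℕ) : Set where
  field
    partition   : SetPartition (n + n)
    typeB       : IsTypeB n partition
    noncrossing : IsNoncrossing n partition

NCᴮ-poset : ℕ → Poset 0ℓ 0ℓ 0ℓ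
NCᴮ-poset n = On.poset (refinementPoset (n + n)) (NCᴮ.partition {n})

NCᴮ-strictPartialOrder : ℕ → StrictPartialOrder 0ℓ 0ℓ 0ℓ
NCᴮ-strictPartialOrder n = PosetProperties.<-strictPartialOrder (NCᴮ-poset n)

record SignedPermutation (n : ℕ) : Set where
  field
    word       : Vec (Symbol n) n
    eachOnce   : ∀ i → ∃! _≡_ λ j → abs (lookup word j) ≡ i

open SignedPermutation public

SameSign : ∀ {n} → Rel (Symbol n) 0ℓ
SameSign x y = (Barred x × Barred y) ⊎ (¬ Barred x × ¬ Barred y)

Avoids : ∀ {n} → SignedPermutation n → Set
Avoids b = ¬ (∃[ i ] ∃[ j ] i Fin.< j
  × SameSign (lookup (word b) i) (lookup (word b) j)
  × abs (lookup (word b) i) Fin.> abs (lookup (word b) j))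

-- 1 < 2 < ⋯ < n < n̄ < ⋯ < 2̄ < 1̄
_<ˢ_ : ∀ {n} → Rel (Symbol n) 0ℓ
_<ˢ_ = Fin._<_ ⊎-< Fin._>_

_<ˢ?_ : ∀ {n} → Decidable (_<ˢ_ {n})
_<ˢ?_ = ⊎-<-decidable Fin._<?_ (flip Fin._<?_)

descents : ∀ {n m} → Vec (Symbol n) m → Subset m
descents []           = []
descents (x ∷ [])     = does (barred? x) ∷ []
descents (x ∷ y ∷ xs) = does (y <ˢ? x) ∷ descents (y ∷ xs)

Des : ∀ {n} → SignedPermutation n → Subset n
Des b = descents (word b)

record Pᴮ (n : ℕ) : Set where
  field
    perm   : SignedPermutation n
    avoids : Avoids perm

-- Equality is equality of words, which is finer than equality of descent
-- sets, so this is not simply pulled back along Des.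
Pᴮ-strictPartialOrder : ℕ → StrictPartialOrder 0ℓ 0ℓ 0ℓ
Pᴮ-strictPartialOrder n = record
  { Carrier              = Pᴮ n
  ; _≈_                  = λ b b′ → word (perm b) ≡ word (perm b′)
  ; _<_                  = λ b b′ → Des (perm b) ⊂ Des (perm b′)
  ; isStrictPartialOrder = record
    { isEquivalence = On.isEquivalence (word ∘ perm) isEquivalence
    ; irrefl        = λ eq → ⊂.irrefl (cong descents eq)
    ; trans         = ⊂.trans
    ; <-resp-≈      = (λ eq → subst (_ ⊂_) (cong descents eq))
                    , (λ eq → subst (_⊂ _) (cong descents eq))
    }
  }
  where
  open Pᴮ
  module ⊂ = StrictPartialOrder (⊂-strictPartialOrder n)

Pᴮ-poset : ℕ → Poset 0ℓ 0ℓ 0ℓ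
Pᴮ-poset n = SPOProperties.poset (Pᴮ-strictPartialOrder n)

record RankedPoset : Set₁ where
  field
    poset     : Poset 0ℓ 0ℓ 0ℓ
    rank      : Poset.Carrier poset → ℕ
    top       : ℕ
    rank-cong : ∀ {x y} → Poset._≈_ poset x y → rank x ≡ rank y
    rank≤top  : ∀ x → rank x ≤ top

  open Poset poset public using (Carrier; module Eq; _≈_) renaming (_≤_ to _≼_)
  open PosetProperties poset public using (≥-poset) renaming (_<_ to _≺_)

NCᴮ-ranked : ℕ → RankedPoset
NCᴮ-ranked n = record
  { poset     = NCᴮ-poset n
  ; rank      = λ π → n ∸ nonzeroPairs n (blockList (partition π))
  ; top       = n
  ; rank-cong = cong λ v → n ∸ nonzeroPairs n (toList v)
  ; rank≤top  = λ π → m∸n≤m n (nonzeroPairs n (blockList (partition π)))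
  }
  where open NCᴮ

Pᴮ-ranked : ℕ → RankedPoset
Pᴮ-ranked n = record
  { poset     = Pᴮ-poset n
  ; rank      = λ b → ∣ Des (perm b) ∣
  ; top       = n
  ; rank-cong = cong (∣_∣ ∘ descents)
  ; rank≤top  = λ b → ∣p∣≤n (Des (perm b))
  }
  where open Pᴮ

module _ (S : Setoid 0ℓ 0ℓ) where
  open Setoid S using (Carrier)
  open Membership S using () renaming (_∈_ to _∈ₗ_)
  open Unique S using () renaming (Unique to Distinct)

  HasCardinality : Pred Carrier 0ℓ → ℕ → Set
  HasCardinality P c =
    ∃[ xs ] Distinct xs × (∀ x → x ∈ₗ xs ⇔ P x) × length xs ≡ c

module _ (P : RankedPoset) where
  open RankedPoset P

  -- Since ranks are bounded by top, this also says that P is finite.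
  IsRankSizes : (ℕ → ℕ) → Set
  IsRankSizes w = ∀ k → HasCardinality Eq.setoid (λ x → rank x ≡ k) (w k)

  -- w₀, …, wᵣ
  rankSizeList : (ℕ → ℕ) → List ℕ
  rankSizeList w = applyUpTo w (suc top)

  -- A polynomial is its list of coefficients, constant term first.
  IsRankGeneratingFunction : List ℕ → Set
  IsRankGeneratingFunction f = ∃[ w ] IsRankSizes w × f ≡ rankSizeList w

  RankSymmetric : Set
  RankSymmetric = ∃[ w ] IsRankSizes w × (∀ k → k ≤ top → w k ≡ w (top ∸ k))

  RankUnimodal : Set
  RankUnimodal = ∃[ w ] IsRankSizes w × ∃[ j ] j ≤ top
    × (∀ k → k < j → w k ≤ w (suc k))
    × (∀ k → j ≤ k → k < top → w (suc k) ≤ w k)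

  SelfDual : Set
  SelfDual = ∃[ f ] IsOrderIsomorphism _≈_ (Poset._≈_ ≥-poset) _≼_ (Poset._≤_ ≥-poset) f

  IsAntichain : Pred Carrier 0ℓ → Set
  IsAntichain A = ∀ x y → A x → A y → ¬ (x ≺ y)

  UnionOfAntichainsOfSize : ℕ → ℕ → Set₁
  UnionOfAntichainsOfSize k c = Σ (Fin k → Pred Carrier 0ℓ) λ A →
    (∀ i → IsAntichain (A i)) × HasCardinality Eq.setoid (Unary.⋃ (Fin k) A) c

  IsMaxUnionOfAntichains : ℕ → ℕ → Set₁
  IsMaxUnionOfAntichains k c = UnionOfAntichainsOfSize k c
    × (∀ c′ → UnionOfAntichainsOfSize k c′ → c′ ≤ c)

  -- For k > r + 1 this is the sum of all rank sizes.
  sumOfLargest : ℕ → (ℕ → ℕ) → ℕ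
  sumOfLargest k w = sum (take k (reverse (sort (rankSizeList w))))

  StronglySperner : Set₁
  StronglySperner = ∃[ w ] IsRankSizes w
    × (∀ k → 1 ≤ k → IsMaxUnionOfAntichains k (sumOfLargest k w))

SameRankGeneratingFunction : Rel RankedPoset 0ℓ
SameRankGeneratingFunction P Q =
  ∃[ f ] IsRankGeneratingFunction P f × IsRankGeneratingFunction Q f

-- P `IsExtensionOf` Q: strict relations of Q are carried to strict relations
-- of P by some bijection from Q to P.
_IsExtensionOf_ : Rel (StrictPartialOrder 0ℓ 0ℓ 0ℓ) 0ℓ
P IsExtensionOf Q = Σ (Bijection Q.Eq.setoid P.Eq.setoid) λ φ →
  ∀ {x y} → x Q.< y → Bijection.to φ x P.< Bijection.to φ y
  where
  module P = StrictPartialOrder P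
  module Q = StrictPartialOrder Q

{-# OPTIONS --safe #-}

-- In a word avoiding 21 and 2̄1̄ the plain and the barred symbols each appear in
-- increasing order, so the word is determined by the set S of positions and the
-- set V of values of its barred symbols; any two subsets of equal size occur,
-- and S is the descent set.  Hence rank k has (n choose k)² elements, and
-- flipping all bars is an anti-automorphism.
--
-- A type-B noncrossing partition is unrolled to a relation on the line that is
-- invariant under x ↦ x + n.  Send it to the pair (S, V), where S consists of
-- the points that do not open a non-zero block and V of those that do not close
-- one.  Each pair {β, β̄} of non-zero blocks is opened and closed exactly once,
-- so |S| = |V| is the rank; coarsening enlarges both sets.  Nested arcs recover
-- the partition from (S, V), and conversely the complements of S and V, read as
-- opening and closing brackets with their nesting depths, give a partition.
--
-- For the Sperner property take a symmetric chain decomposition of the subsets of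
-- [n].  Over S there are at most (n choose |S|) elements, and a union of k
-- antichains meets the fibres of at most k members of a chain.  As binomial
-- coefficients decrease away from the middle, the k middle ranks are optimal
-- along every chain.

module Submission where

open import Defs
open import Data.Bool.Base using (Bool; true; false; not; _xor_; if_then_else_)
import Data.Bool.Properties as Bool
import Data.Bool.Solver as BoolSolver
open import Data.Empty using (⊥; ⊥-elim)
open import Data.Fin.Base as Fin using (Fin; zero; suc; toℕ; fromℕ<; splitAt; join)
import Data.Fin.Induction as FinInd
import Data.Fin.Properties as Fin
open import Data.Fin.Subset using (Subset; inside; outside; _∈_; _∉_; _⊆_; _⊂_; ∁; ∣_∣)
import Data.Fin.Subset.Properties as Sub
open import Data.Integer.Base as ℤ using (ℤ)
import Data.Integer.Properties as ℤ
open import Data.List.Base as List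
  using (List; []; _∷_; _++_; length; map; filter; take; reverse; applyUpTo; deduplicate; cartesianProductWith)
import Data.List.Membership.Setoid as Membership
import Data.List.Membership.Setoid.Properties as Mem
import Data.List.Properties as List
open import Data.List.Relation.Binary.Permutation.Propositional as Perm using (_↭_; ↭-sym; ↭-trans)
import Data.List.Relation.Binary.Permutation.Propositional.Properties as Perm
import Data.List.Relation.Binary.Pointwise as Pointwise
open import Data.List.Relation.Unary.All as All using (All; []; _∷_)
import Data.List.Relation.Unary.All.Properties as All
open import Data.List.Relation.Unary.AllPairs as AllPairs using (AllPairs; []; _∷_)
import Data.List.Relation.Unary.AllPairs.Properties as AllPairs
open import Data.List.Relation.Unary.Any as Any using (Any; here; there)
import Data.List.Relation.Unary.Any.Properties as Any
import Data.List.Relation.Unary.Sorted.TotalOrder.Properties as Sorted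
import Data.List.Relation.Unary.Unique.DecSetoid.Properties as UniqueDec
import Data.List.Relation.Unary.Unique.Setoid as Unique
import Data.List.Relation.Unary.Unique.Setoid.Properties as Unique
open import Data.Nat.Base
  using (ℕ; zero; suc; _+_; _*_; _∸_; _≤_; _<_; z≤n; s≤s; s≤s⁻¹; z<s; _%_; ⌊_/2⌋; ⌈_/2⌉)
open import Data.Nat.Combinatorics using (_C_; nCk≡nC[n∸k]; nCk+nC[k+1]≡[n+1]C[k+1])
open import Data.Nat.DivMod using (_mod_)
import Data.Nat.DivMod as ℕ
open import Data.Nat.Induction using (<-wellFounded)
open import Data.Nat.ListAction using (sum)
import Data.Nat.ListAction.Properties as ℕ
import Data.Nat.Properties as ℕ
open import Data.List.Sort ℕ.≤-decTotalOrder using (sort; sort-↭; sort-↗)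
open import Data.Product.Base using (Σ; ∃-syntax; _×_; _,_; proj₁; proj₂)
open import Data.Sum.Base using (_⊎_; inj₁; inj₂; [_,_]′; swap)
import Data.Sum.Properties as Sum
open import Data.Unit.Base using (tt)
open import Data.Vec.Base as Vec using (Vec; []; _∷_; lookup; tabulate; toList)
import Data.Vec.Membership.Propositional.Properties as VecMem
import Data.Vec.Properties as Vec
open import Function.Base using (_∘_; id; flip; case_of_)
open import Function.Bundles using (Bijection; _⇔_; mk⇔; Equivalence)
open import Induction.WellFounded using (Acc; acc)
open import Level using (0ℓ)
open import Relation.Binary.Bundles using (Setoid; DecSetoid; StrictPartialOrder)
import Relation.Binary.Construct.On as On
open import Relation.Binary.Definitions using (tri<; tri≈; tri>)
open import Relation.Binary.PropositionalEquality
  using (_≡_; _≢_; refl; sym; trans; cong; cong₂; subst; subst₂; module ≡-Reasoning; setoid)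
open import Relation.Nullary.Decidable using (Dec; yes; no; does; ¬?; _×-dec_; _→-dec_; dec-true; dec-false; map′)
open import Relation.Nullary.Negation using (¬_; contradiction)
open import Relation.Unary using (Pred)

-- Cardinalities and binomial coefficients

-- Half a turn decides which points open and close. By noncrossing, a block disjoint from its bar
-- occupies a window shorter than `n` on the line and then pauses for more than `n`, whereas an
-- invariant block contains `x + n` along with `x`. So a point closes a non-zero block exactly if no
-- point of its own block follows within distance `n`, and dually for opening.
--
-- For the inverse construction the obstacle is that a circle has no outside. Depths are integers
-- fixed only up to a constant, and two points of equal depth are told apart by two low gaps at
-- once, never by a single one. The zero-block then needs no separate treatment: it consists of the
-- points below which there is no gap at all.

module _ (S : Setoid 0ℓ 0ℓ) where
  open Setoid S using (Carrier; _≈_) renaming (sym to ≈-sym; trans to ≈-trans)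
  open Membership S using () renaming (_∈_ to _∈ₗ_)

  ∈-─ : ∀ {x y : Carrier} {ys} (p : x ∈ₗ ys) → y ∈ₗ ys → ¬ (x ≈ y) → y ∈ₗ (ys Any.─ p)
  ∈-─ (here x≈) (here y≈) x≉y = contradiction (≈-trans x≈ (≈-sym y≈)) x≉y
  ∈-─ (here _)  (there q) _   = q
  ∈-─ (there p) (here y≈) _   = here y≈
  ∈-─ (there p) (there q) x≉y = there (∈-─ p q x≉y)

  unique⊆⇒length≤ : ∀ {xs ys} → Unique.Unique S xs → (∀ {x} → x ∈ₗ xs → x ∈ₗ ys) →
                    length xs ≤ length ys
  unique⊆⇒length≤ {[]}              _             _     = z≤n
  unique⊆⇒length≤ {x ∷ xs} {ys} (x∉xs ∷ xs!) xs⊆ys =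
    subst (suc (length xs) ≤_) (sym (List.length-removeAt′ ys (Any.index x∈ys)))
      (s≤s (unique⊆⇒length≤ xs! λ y∈ →
        ∈-─ x∈ys (xs⊆ys (there y∈)) λ x≈y → Mem.All[≉]⇒∉ S x∉xs (Mem.∈-resp-≈ S (≈-sym x≈y) y∈)))
    where
    x∈ys : x ∈ₗ ys
    x∈ys = xs⊆ys (here (Setoid.refl S))

-- Noncrossing partitions are never enumerated directly; their rank sizes are those of `Pᴮ`, pulled
-- back along the bijection.
hasCardinality-preimage : ∀ {S T : Setoid 0ℓ 0ℓ} (φ : Bijection S T) {P : Pred (Setoid.Carrier S) 0ℓ}
  {Q : Pred (Setoid.Carrier T) 0ℓ} → (∀ x → P x ⇔ Q (Bijection.to φ x)) →
  ∀ {c} → HasCardinality T Q c → HasCardinality S P c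
hasCardinality-preimage {S} {T} φ {P} {Q} P⇔Q (ys , ys! , ∈ys⇔Q , refl) =
  map from ys
  , Unique.map⁺ T S (λ {y} {z} eq → T.trans (T.sym (to∘from y)) (T.trans (φ.cong eq) (to∘from z))) ys!
  , (λ x → mk⇔
      (λ x∈ → case Mem.∈-map⁻ T S x∈ of λ where
        (y , y∈ , x≈) → Equivalence.from (P⇔Q x)
          (Equivalence.to (∈ys⇔Q (φ.to x))
            (Mem.∈-resp-≈ T (T.trans (T.sym (to∘from y)) (T.sym (φ.cong x≈))) y∈)))
      (λ px → Mem.∈-resp-≈ S (φ.injective (to∘from (φ.to x)))
        (Mem.∈-map⁺ T S from-cong (Equivalence.from (∈ys⇔Q (φ.to x)) (Equivalence.to (P⇔Q x) px)))))
  , List.length-map from ys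
  where
  module S = Setoid S
  module T = Setoid T
  module φ = Bijection φ
  from : T.Carrier → S.Carrier
  from y = proj₁ (φ.surjective y)
  to∘from : ∀ y → φ.to (from y) T.≈ y
  to∘from y = proj₂ (φ.surjective y) S.refl
  from-cong : ∀ {y z} → y T.≈ z → from y S.≈ from z
  from-cong {y} {z} y≈z = φ.injective (T.trans (to∘from y) (T.trans y≈z (T.sym (to∘from z))))

module _ {S : Setoid 0ℓ 0ℓ} where
  open Setoid S using (Carrier)

  hasCardinality-⇔ : ∀ {P Q : Pred Carrier 0ℓ} → (∀ x → P x ⇔ Q x) →
                     ∀ {c} → HasCardinality S P c → HasCardinality S Q c
  hasCardinality-⇔ P⇔Q (xs , xs! , ∈⇔P , len) =
    xs , xs! , (λ x → mk⇔ (Equivalence.to (P⇔Q x) ∘ Equivalence.to (∈⇔P x))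
                          (Equivalence.from (∈⇔P x) ∘ Equivalence.from (P⇔Q x))) , len

  hasCardinality-⊎ : ∀ {P Q : Pred Carrier 0ℓ} → (∀ x → P x → ¬ Q x) → ∀ {c d} →
    HasCardinality S P c → HasCardinality S Q d → HasCardinality S (λ x → P x ⊎ Q x) (c + d)
  hasCardinality-⊎ disjoint (xs , xs! , ∈xs⇔P , refl) (ys , ys! , ∈ys⇔Q , refl) =
    xs ++ ys
    , Unique.++⁺ S xs! ys! (λ {x} (x∈xs , x∈ys) →
        disjoint x (Equivalence.to (∈xs⇔P x) x∈xs) (Equivalence.to (∈ys⇔Q x) x∈ys))
    , (λ x → mk⇔
        (λ x∈ → case Mem.∈-++⁻ S xs x∈ of λ where
          (inj₁ x∈xs) → inj₁ (Equivalence.to (∈xs⇔P x) x∈xs)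
          (inj₂ x∈ys) → inj₂ (Equivalence.to (∈ys⇔Q x) x∈ys))
        λ where (inj₁ px) → Mem.∈-++⁺ˡ S (Equivalence.from (∈xs⇔P x) px)
                (inj₂ qx) → Mem.∈-++⁺ʳ S xs (Equivalence.from (∈ys⇔Q x) qx))
    , List.length-++ xs

-- Induction through Pascal's rule: both summands grow, except in the boundary case `n = 2k + 2`,
-- where the two outer coefficients are mirror images and the sums agree.
nCk≤nC[k+1] : ∀ n k → suc (k + k) ≤ n → n C k ≤ n C suc k
nCk≤nC[k+1] (suc n) zero    _        = subst (1 ≤_) (nCk+nC[k+1]≡[n+1]C[k+1] n 0) (s≤s z≤n)
nCk≤nC[k+1] (suc n) (suc k) 2k+3≤1+n =
  subst₂ _≤_ (nCk+nC[k+1]≡[n+1]C[k+1] n k) (nCk+nC[k+1]≡[n+1]C[k+1] n (suc k)) step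
  where
  2k+2≤n : suc (suc (k + k)) ≤ n
  2k+2≤n = subst (_≤ n) (cong suc (ℕ.+-suc k k)) (s≤s⁻¹ 2k+3≤1+n)
  step : n C k + n C suc k ≤ n C suc k + n C suc (suc k)
  step with ℕ.m≤n⇒m<n∨m≡n 2k+2≤n
  ... | inj₁ 2k+3≤n = ℕ.+-mono-≤ (nCk≤nC[k+1] n k (ℕ.<⇒≤ 2k+2≤n))
    (nCk≤nC[k+1] n (suc k) (subst (_≤ n) (cong (2 +_) (sym (ℕ.+-suc k k))) 2k+3≤n))
  ... | inj₂ refl = ℕ.≤-reflexive (trans (ℕ.+-comm (n C k) _) (cong (n C suc k +_) mirror))
    where
    mirror : n C k ≡ n C suc (suc k)
    mirror = trans (nCk≡nC[n∸k] (ℕ.≤-trans (ℕ.m≤m+n k (suc (suc k))) (ℕ.≤-reflexive k+2+k)))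
      (cong (n C_) (trans (cong (_∸ k) (sym k+2+k)) (ℕ.m+n∸m≡n k (suc (suc k)))))
      where
      k+2+k : k + suc (suc k) ≡ n
      k+2+k = trans (ℕ.+-suc k (suc k)) (cong suc (ℕ.+-suc k k))

nC-antitone-step : ∀ n k → k < n → n ≤ suc (k + k) → n C suc k ≤ n C k
nC-antitone-step n k k<n n≤1+2k =
  subst₂ _≤_ (sym (nCk≡nC[n∸k] k<n)) (sym (trans (nCk≡nC[n∸k] (ℕ.<⇒≤ k<n)) (cong (n C_) (sym suc-n∸k))))
    (nCk≤nC[k+1] n (n ∸ suc k) bound)
  where
  j = n ∸ suc k
  suc-n∸k : suc (n ∸ suc k) ≡ n ∸ k
  suc-n∸k = sym (ℕ.+-∸-assoc 1 k<n)
  j≤k : j ≤ k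
  j≤k = ℕ.m≤n+o⇒m∸n≤o n (suc k) n≤1+2k
  bound : suc (j + j) ≤ n
  bound = ℕ.≤-trans (s≤s (ℕ.+-monoʳ-≤ j j≤k))
    (ℕ.≤-reflexive (trans (sym (ℕ.+-suc j k)) (ℕ.m∸n+n≡m k<n)))

nC-monotone : ∀ n {r x} → r ≤ x → x + x ≤ n → n C r ≤ n C x
nC-monotone n {r} {zero}  z≤n _ = ℕ.≤-refl
nC-monotone n {r} {suc x} r≤1+x 2x+2≤n with ℕ.m≤n⇒m<n∨m≡n r≤1+x
... | inj₂ refl = ℕ.≤-refl
... | inj₁ (s≤s r≤x) =
  ℕ.≤-trans (nC-monotone n r≤x (ℕ.≤-trans (ℕ.n≤1+n _) 2x+1≤n)) (nCk≤nC[k+1] n x 2x+1≤n)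
  where
  2x+1≤n : suc (x + x) ≤ n
  2x+1≤n = ℕ.≤-trans (s≤s (ℕ.+-monoʳ-≤ x (ℕ.n≤1+n x))) 2x+2≤n

-- The bounds place `x` between `r` and `n ∸ r`. Whichever of `x` and `n ∸ x` lies in the lower half
-- is still at least `r`, and symmetry does the rest.
nC-window : ∀ n {r x} → r ≤ x → r + x ≤ n → n C r ≤ n C x
nC-window n {r} {x} r≤x r+x≤n with ℕ.≤-total (x + x) n
... | inj₁ 2x≤n = nC-monotone n r≤x 2x≤n
... | inj₂ n≤2x = ℕ.≤-trans (nC-monotone n r≤n∸x 2[n∸x]≤n) (ℕ.≤-reflexive (sym (nCk≡nC[n∸k] x≤n)))
  where
  x≤n : x ≤ n
  x≤n = ℕ.≤-trans (ℕ.m≤n+m x r) r+x≤n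
  r≤n∸x : r ≤ n ∸ x
  r≤n∸x = ℕ.m+n≤o⇒m≤o∸n r r+x≤n
  2[n∸x]≤n : (n ∸ x) + (n ∸ x) ≤ n
  2[n∸x]≤n = ℕ.≤-trans (ℕ.+-monoʳ-≤ (n ∸ x) (ℕ.m≤n+o⇒m∸n≤o n x n≤2x)) (ℕ.≤-reflexive (ℕ.m∸n+n≡m x≤n))

-- Avoiding words and pairs of subsets

module _ {n : ℕ} {P : Pred (Fin n) 0ℓ} (P? : ∀ i → Dec (P i)) where

  setOf : Subset n
  setOf = tabulate (λ i → does (P? i))

  ∈-setOf⁺ : ∀ {i} → P i → i ∈ setOf
  ∈-setOf⁺ {i} pi = Vec.lookup⇒[]= i setOf (trans (Vec.lookup∘tabulate _ i) (dec-true (P? i) pi))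

  ∈-setOf⁻ : ∀ {i} → i ∈ setOf → P i
  ∈-setOf⁻ {i} i∈ with P? i | trans (sym (Vec.lookup∘tabulate (does ∘ P?) i)) (Vec.[]=⇒lookup i∈)
  ... | yes pi | _ = pi

elements : ∀ {n} → Subset n → List (Fin n)
elements []            = []
elements (inside  ∷ V) = zero ∷ map suc (elements V)
elements (outside ∷ V) = map suc (elements V)

length-elements : ∀ {n} (V : Subset n) → length (elements V) ≡ ∣ V ∣
length-elements []            = refl
length-elements (inside  ∷ V) = cong suc (trans (List.length-map Fin.suc (elements V)) (length-elements V))
length-elements (outside ∷ V) = trans (List.length-map Fin.suc (elements V)) (length-elements V)

elements-increasing : ∀ {n} (V : Subset n) → AllPairs Fin._<_ (elements V)
elements-increasing []            = []
elements-increasing (inside  ∷ V) =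
  All.map⁺ (All.universal (λ _ → z<s) _) ∷ AllPairs.map⁺ (AllPairs.map s≤s (elements-increasing V))
elements-increasing (outside ∷ V) = AllPairs.map⁺ (AllPairs.map s≤s (elements-increasing V))

module _ {n : ℕ} where
  open Membership (setoid (Fin n)) public using () renaming (_∈_ to _∈ˡ_)

∈-elements⁺ : ∀ {n} {V : Subset n} {i} → i ∈ V → i ∈ˡ elements V
∈-elements⁺ {V = inside  ∷ V} Vec.here       = here refl
∈-elements⁺ {V = inside  ∷ V} (Vec.there i∈) =
  there (Mem.∈-map⁺ (setoid _) (setoid _) (cong suc) (∈-elements⁺ i∈))
∈-elements⁺ {V = outside ∷ V} (Vec.there i∈) =
  Mem.∈-map⁺ (setoid _) (setoid _) (cong suc) (∈-elements⁺ i∈)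

elements-∈ : ∀ {n} (V : Subset n) → All (_∈ V) (elements V)
elements-∈ []            = []
elements-∈ (inside  ∷ V) = Vec.here ∷ All.map⁺ (All.map Vec.there (elements-∈ V))
elements-∈ (outside ∷ V) = All.map⁺ (All.map Vec.there (elements-∈ V))

elements-unique : ∀ {n} (V : Subset n) → Unique.Unique (setoid (Fin n)) (elements V)
elements-unique V = AllPairs.map Fin.<⇒≢ (elements-increasing V)

injection⇒∣∣≤ : ∀ {m n} {S : Subset m} {V : Subset n} (f : Fin m → Fin n) →
  (∀ {i j} → f i ≡ f j → i ≡ j) → (∀ {i} → i ∈ S → f i ∈ V) → ∣ S ∣ ≤ ∣ V ∣
injection⇒∣∣≤ {S = S} {V} f f-inj f∈ =
  subst₂ _≤_ (trans (List.length-map f (elements S)) (length-elements S)) (length-elements V)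
    (unique⊆⇒length≤ (setoid _) (Unique.map⁺ (setoid _) (setoid _) f-inj (elements-unique S))
      λ x∈ → case Mem.∈-map⁻ (setoid _) (setoid _) x∈ of λ where
        (i , i∈ , refl) → ∈-elements⁺ (f∈ (All.lookup (elements-∈ S) i∈)))

-- Distinct values and avoidance, joined in one condition on a pair of entries. Unlike being a
-- signed permutation, it passes to the tails of a word, which the recursion in `descents` requires.
InOrder : ∀ {n} → Symbol n → Symbol n → Set
InOrder x y = abs x ≢ abs y × (SameSign x y → abs x Fin.< abs y)

Ordered : ∀ {n m} → Vec (Symbol n) m → Set
Ordered w = ∀ {i j} → i Fin.< j → InOrder (lookup w i) (lookup w j)

Occurs : ∀ {n m} → Vec (Symbol n) m → Symbol n → Set
Occurs w s = ∃[ j ] lookup w j ≡ s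

module _ {n : ℕ} (b : SignedPermutation n) where

  position : Fin n → Fin n
  position i = proj₁ (eachOnce b i)

  abs-position : ∀ i → abs (lookup (word b) (position i)) ≡ i
  abs-position i = proj₁ (proj₂ (eachOnce b i))

  position-unique : ∀ {i j} → abs (lookup (word b) j) ≡ i → position i ≡ j
  position-unique {i} = proj₂ (proj₂ (eachOnce b i))

  abs-lookup-injective : ∀ {i j} → abs (lookup (word b) i) ≡ abs (lookup (word b) j) → i ≡ j
  abs-lookup-injective eq = trans (sym (position-unique eq)) (position-unique refl)

  barredPosition? : ∀ j → Dec (Barred (lookup (word b) j))
  barredPosition? j = barred? (lookup (word b) j)

  barredValue? : ∀ i → Dec (Barred (lookup (word b) (position i)))
  barredValue? i = barred? (lookup (word b) (position i))

  barredPositions barredValues : Subset n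
  barredPositions = setOf barredPosition?
  barredValues    = setOf barredValue?

  ∣barredPositions∣≡∣barredValues∣ : ∣ barredPositions ∣ ≡ ∣ barredValues ∣
  ∣barredPositions∣≡∣barredValues∣ = ℕ.≤-antisym
    (injection⇒∣∣≤ {S = barredPositions} {barredValues} (abs ∘ lookup (word b)) abs-lookup-injective λ j∈ →
      ∈-setOf⁺ barredValue?
        (subst (Barred ∘ lookup (word b)) (sym (position-unique refl)) (∈-setOf⁻ barredPosition? j∈)))
    (injection⇒∣∣≤ {S = barredValues} {barredPositions} position
      (λ {i} {j} eq → trans (sym (abs-position i)) (trans (cong (abs ∘ lookup (word b)) eq) (abs-position j)))
      λ i∈ → ∈-setOf⁺ barredPosition? (∈-setOf⁻ barredValue? i∈))

module _ {n : ℕ} (b : Pᴮ n) where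
  open Pᴮ b

  ordered : Ordered (word perm)
  ordered {i} {j} i<j = abs≢ , λ same → Fin.≤∧≢⇒< (ℕ.≮⇒≥ λ abs> → avoids (i , j , i<j , same , abs>)) abs≢
    where
    abs≢ : abs (lookup (word perm) i) ≢ abs (lookup (word perm) j)
    abs≢ eq = Fin.<⇒≢ i<j (abs-lookup-injective perm eq)

-- The order `<ˢ` puts every plain symbol below every barred one and reverses the barred ones. Hence
-- between neighbours in order the first symbol alone decides: after a barred symbol comes something
-- smaller, after a plain one something larger. In the last place the definition asks for a bar
-- anyway.
descents-barred : ∀ {n m} (w : Vec (Symbol n) m) → Ordered w →
                  descents w ≡ setOf (λ j → barred? (lookup w j))
descents-barred []           _   = refl
descents-barred (x ∷ [])     _   = refl
descents-barred (x ∷ y ∷ xs) ord =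
  cong₂ _∷_ (first x y (ord {zero} {suc zero} z<s)) (descents-barred (y ∷ xs) (λ i<j → ord (s≤s i<j)))
  where
  first : ∀ x y → InOrder x y → does (y <ˢ? x) ≡ does (barred? x)
  first (plain a)  (plain c)  (_ , lt) =
    dec-false (c Fin.<? a) (ℕ.<-asym (lt (inj₂ ((λ ()) , λ ()))))
  first (plain a)  (barred c) _        = refl
  first (barred a) (plain c)  _        = refl
  first (barred a) (barred c) (_ , lt) = dec-true (a Fin.<? c) (lt (inj₁ (tt , tt)))

Des-barred : ∀ {n} (b : Pᴮ n) → Des (Pᴮ.perm b) ≡ barredPositions (Pᴮ.perm b)
Des-barred b = descents-barred (word (Pᴮ.perm b)) (ordered b)

sameSign : ∀ {n} {x y : Symbol n} → does (barred? x) ≡ does (barred? y) → SameSign x y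
sameSign {x = plain  _} {plain  _} _ = inj₂ ((λ ()) , λ ())
sameSign {x = barred _} {barred _} _ = inj₁ (tt , tt)

abs-injective : ∀ {n} {x y : Symbol n} → SameSign x y → abs x ≡ abs y → x ≡ y
abs-injective {x = plain  _} {plain  _} _        refl = refl
abs-injective {x = plain  _} {barred _} (inj₁ ()) refl
abs-injective {x = plain  _} {barred _} (inj₂ (_ , ¬b)) refl = contradiction tt ¬b
abs-injective {x = barred _} {plain  _} (inj₁ ()) refl
abs-injective {x = barred _} {plain  _} (inj₂ (¬b , _)) refl = contradiction tt ¬b
abs-injective {x = barred _} {barred _} _        refl = refl

sameSign-sym : ∀ {n} {x y : Symbol n} → SameSign x y → SameSign y x
sameSign-sym (inj₁ (p , q)) = inj₁ (q , p)
sameSign-sym (inj₂ (p , q)) = inj₂ (q , p)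

module _ {n m : ℕ} where

  -- The smaller of two differing symbols would have to occur earlier in the
  -- other word, where the words already agree.
  first-difference : ∀ (w w′ : Vec (Symbol n) m) p → Ordered w → Ordered w′ →
    (∀ s → Occurs w s → Occurs w′ s) → (∀ q → q Fin.< p → lookup w q ≡ lookup w′ q) →
    SameSign (lookup w p) (lookup w′ p) → ¬ (abs (lookup w p) Fin.< abs (lookup w′ p))
  first-difference w w′ p ord ord′ occ agree same lt with occ (lookup w p) (p , refl)
  ... | q , w′q≡ with Fin.<-cmp q p
  ...   | tri< q<p _ _  = proj₁ (ord q<p) (cong abs (trans (agree q q<p) w′q≡))
  ...   | tri≈ _ refl _ = ℕ.<⇒≢ lt (cong (toℕ ∘ abs) (sym w′q≡))
  ...   | tri> _ _ p<q  = ℕ.<-asym lt (subst (abs (lookup w′ p) Fin.<_) (cong abs w′q≡)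
      (proj₂ (ord′ p<q) (subst (SameSign (lookup w′ p)) (sym w′q≡) (sameSign-sym same))))

  word-unique : ∀ (w w′ : Vec (Symbol n) m) → Ordered w → Ordered w′ →
    (∀ s → Occurs w s → Occurs w′ s) → (∀ s → Occurs w′ s → Occurs w s) →
    (∀ j → SameSign (lookup w j) (lookup w′ j)) → w ≡ w′
  word-unique w w′ ord ord′ occ occ′ same =
    trans (sym (Vec.tabulate∘lookup w))
      (trans (Vec.tabulate-cong (λ p → go p (FinInd.<-wellFounded p))) (Vec.tabulate∘lookup w′))
    where
    go : ∀ p → Acc Fin._<_ p → lookup w p ≡ lookup w′ p
    go p (acc rs) with Fin.<-cmp (abs (lookup w p)) (abs (lookup w′ p))
    ... | tri< lt _ _ = contradiction lt
      (first-difference w w′ p ord ord′ occ (λ q q<p → go q (rs q<p)) (same p))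
    ... | tri≈ _ eq _ = abs-injective (same p) eq
    ... | tri> _ _ gt = contradiction gt
      (first-difference w′ w p ord′ ord occ′ (λ q q<p → sym (go q (rs q<p))) (sameSign-sym (same p)))

module _ {n : ℕ} (b b′ : SignedPermutation n) where

  -- Each value occurs once in either word, and membership in the set of barred values fixes its
  -- sign.
  occurs-transfer : (∀ {i} → i ∈ barredValues b → i ∈ barredValues b′) →
    (∀ {i} → i ∈ barredValues b′ → i ∈ barredValues b) →
    ∀ s → Occurs (word b) s → Occurs (word b′) s
  occurs-transfer V⊆V′ V′⊆V s (j , refl) = position b′ i , abs-injective (same s′ s refl refl) (abs-position b′ i)
    where
    i = abs (lookup (word b) j)
    s′ = lookup (word b′) (position b′ i)
    at-j : lookup (word b) (position b i) ≡ s
    at-j = cong (lookup (word b)) (position-unique b refl)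
    same : ∀ x y → x ≡ s′ → y ≡ s → SameSign x y
    same (plain _)  (plain _)  _    _    = inj₂ ((λ ()) , λ ())
    same (barred _) (barred _) _    _    = inj₁ (tt , tt)
    same (barred _) (plain _)  x≡s′ y≡s  = contradiction
      (∈-setOf⁻ (barredValue? b) (V′⊆V (∈-setOf⁺ (barredValue? b′) (subst Barred x≡s′ tt))))
      λ barred-s → subst Barred (trans at-j (sym y≡s)) barred-s
    same (plain _)  (barred _) x≡s′ y≡s  = contradiction
      (∈-setOf⁻ (barredValue? b′) (V⊆V′ (∈-setOf⁺ (barredValue? b) (subst Barred (trans y≡s (sym at-j)) tt))))
      λ barred-s′ → subst Barred (sym x≡s′) barred-s′

lookup-≡ : ∀ {n} {A : Set} {f g : Fin n → A} → tabulate f ≡ tabulate g → ∀ i → f i ≡ g i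
lookup-≡ {f = f} {g} eq i =
  trans (sym (Vec.lookup∘tabulate f i)) (trans (cong (λ v → lookup v i) eq) (Vec.lookup∘tabulate g i))

Pᴮ-unique : ∀ {n} (b b′ : Pᴮ n) → Des (Pᴮ.perm b) ≡ Des (Pᴮ.perm b′) →
  barredValues (Pᴮ.perm b) ≡ barredValues (Pᴮ.perm b′) → word (Pᴮ.perm b) ≡ word (Pᴮ.perm b′)
Pᴮ-unique b b′ Des≡ V≡ = word-unique _ _ (ordered b) (ordered b′)
  (occurs-transfer p p′ (subst (_ ∈_) V≡) (subst (_ ∈_) (sym V≡)))
  (occurs-transfer p′ p (subst (_ ∈_) (sym V≡)) (subst (_ ∈_) V≡))
  (λ j → sameSign (lookup-≡ (trans (sym (Des-barred b)) (trans Des≡ (Des-barred b′))) j))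
  where
  p  = Pᴮ.perm b
  p′ = Pᴮ.perm b′

barredValues-cong : ∀ {n} (b b′ : Pᴮ n) → word (Pᴮ.perm b) ≡ word (Pᴮ.perm b′) →
                    barredValues (Pᴮ.perm b) ≡ barredValues (Pᴮ.perm b′)
barredValues-cong b b′ eq = Vec.tabulate-cong λ i → cong (does ∘ barred?)
  (trans (cong (lookup (word p)) (position-unique p
    (trans (cong (λ w → abs (lookup w (position p′ i))) eq) (abs-position p′ i))))
    (cong (λ w → lookup w (position p′ i)) eq))
  where
  p  = Pᴮ.perm b
  p′ = Pᴮ.perm b′

module _ {n : ℕ} where

  shuffle : ∀ {m} (S : Subset m) (vs us : List (Fin n)) →
            length vs ≡ ∣ S ∣ → length us ≡ ∣ ∁ S ∣ → Vec (Symbol n) m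
  shuffle []            _        _        _ _ = []
  shuffle (inside  ∷ S) (v ∷ vs) us       p q = barred v ∷ shuffle S vs us (ℕ.suc-injective p) q
  shuffle (outside ∷ S) vs       (u ∷ us) p q = plain u ∷ shuffle S vs us p (ℕ.suc-injective q)

  shuffle-barred : ∀ {m} (S : Subset m) vs us p q →
    setOf (λ j → barred? (lookup (shuffle S vs us p q) j)) ≡ S
  shuffle-barred []            _        _        _ _ = refl
  shuffle-barred (inside  ∷ S) (v ∷ vs) us       p q = cong (inside ∷_) (shuffle-barred S vs us _ _)
  shuffle-barred (outside ∷ S) vs       (u ∷ us) p q = cong (outside ∷_) (shuffle-barred S vs us _ _)

  module _ {P : Pred (Symbol n) 0ℓ} where

    shuffle-all : ∀ {m} (S : Subset m) vs us p q → All (P ∘ barred) vs → All (P ∘ plain) us →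
                  ∀ j → P (lookup (shuffle S vs us p q) j)
    shuffle-all (inside  ∷ S) (v ∷ vs) us       p q (pv ∷ _) _       zero    = pv
    shuffle-all (inside  ∷ S) (v ∷ vs) us       p q (_ ∷ pvs) pus    (suc j) = shuffle-all S vs us _ _ pvs pus j
    shuffle-all (outside ∷ S) vs       (u ∷ us) p q _ (pu ∷ _)       zero    = pu
    shuffle-all (outside ∷ S) vs       (u ∷ us) p q pvs (_ ∷ pus)    (suc j) = shuffle-all S vs us _ _ pvs pus j

  -- Within each list the order is given. `V` keeps the lists apart: a barred and a plain entry
  -- differ in value because one lies in `V` and the other does not.
  shuffle-ordered : ∀ {m} (V : Subset n) (S : Subset m) vs us p q →
    AllPairs Fin._<_ vs → AllPairs Fin._<_ us → All (_∈ V) vs → All (_∉ V) us →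
    Ordered (shuffle S vs us p q)
  shuffle-ordered V (inside ∷ S) (v ∷ vs) us p q (v< ∷ _) _ (v∈ ∷ _) us∉ {zero} {suc j} _ =
    shuffle-all {P = InOrder (barred v)} S vs us _ _
      (All.map (λ lt → Fin.<⇒≢ lt , λ _ → lt) v<)
      (All.map (λ u∉ → (λ v≡u → u∉ (subst (_∈ V) v≡u v∈)) , λ where
        (inj₁ ())
        (inj₂ (¬b , _)) → contradiction tt ¬b) us∉) j
  shuffle-ordered V (inside ∷ S) (v ∷ vs) us p q (_ ∷ vs<) us< (_ ∷ vs∈) us∉ {suc i} {suc j} (s≤s i<j) =
    shuffle-ordered V S vs us _ _ vs< us< vs∈ us∉ i<j
  shuffle-ordered V (outside ∷ S) vs (u ∷ us) p q _ (u< ∷ _) vs∈ (u∉ ∷ _) {zero} {suc j} _ =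
    shuffle-all {P = InOrder (plain u)} S vs us _ _
      (All.map (λ v∈ → (λ u≡v → u∉ (subst (_∈ V) (sym u≡v) v∈)) , λ where
        (inj₁ ())
        (inj₂ (_ , ¬b)) → contradiction tt ¬b) vs∈)
      (All.map (λ lt → Fin.<⇒≢ lt , λ _ → lt) u<) j
  shuffle-ordered V (outside ∷ S) vs (u ∷ us) p q vs< (_ ∷ us<) vs∈ (_ ∷ us∉) {suc i} {suc j} (s≤s i<j) =
    shuffle-ordered V S vs us _ _ vs< us< vs∈ us∉ i<j

  shuffle-occurs : ∀ {m} (S : Subset m) vs us p q {i} → i ∈ˡ vs ⊎ i ∈ˡ us →
                   ∃[ j ] abs (lookup (shuffle S vs us p q) j) ≡ i
  shuffle-occurs []            []       []       p q (inj₁ ())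
  shuffle-occurs []            []       []       p q (inj₂ ())
  shuffle-occurs (inside  ∷ S) (v ∷ vs) us       p q (inj₁ (here refl)) = zero , refl
  shuffle-occurs (inside  ∷ S) (v ∷ vs) us       p q (inj₁ (there i∈))  =
    let j , eq = shuffle-occurs S vs us _ _ (inj₁ i∈) in suc j , eq
  shuffle-occurs (inside  ∷ S) (v ∷ vs) us       p q (inj₂ i∈)          =
    let j , eq = shuffle-occurs S vs us _ _ (inj₂ i∈) in suc j , eq
  shuffle-occurs (outside ∷ S) vs       (u ∷ us) p q (inj₂ (here refl)) = zero , refl
  shuffle-occurs (outside ∷ S) vs       (u ∷ us) p q (inj₂ (there i∈))  =
    let j , eq = shuffle-occurs S vs us _ _ (inj₂ i∈) in suc j , eq
  shuffle-occurs (outside ∷ S) vs       (u ∷ us) p q (inj₁ i∈)          =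
    let j , eq = shuffle-occurs S vs us _ _ (inj₁ i∈) in suc j , eq

module _ {n : ℕ} (w : Vec (Symbol n) n) (ord : Ordered w)
         (occ : ∀ i → ∃[ j ] abs (lookup w j) ≡ i) where

  fromOrdered : Pᴮ n
  fromOrdered = record
    { perm   = record
      { word     = w
      ; eachOnce = λ i → proj₁ (occ i) , proj₂ (occ i) , λ eq → abs≡⇒≡ (trans (proj₂ (occ i)) (sym eq))
      }
    ; avoids = λ (i , j , i<j , same , abs>) → ℕ.<-asym abs> (proj₂ (ord i<j) same)
    }
    where
    abs≡⇒≡ : ∀ {i j} → abs (lookup w i) ≡ abs (lookup w j) → i ≡ j
    abs≡⇒≡ {i} {j} eq with Fin.<-cmp i j
    ... | tri< i<j _ _ = contradiction eq (proj₁ (ord i<j))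
    ... | tri≈ _ i≡j _ = i≡j
    ... | tri> _ _ j<i = contradiction (sym eq) (proj₁ (ord j<i))

module _ {n : ℕ} (S V : Subset n) (∣V∣≡∣S∣ : ∣ V ∣ ≡ ∣ S ∣) where

  private
    lengthᵇ : length (elements V) ≡ ∣ S ∣
    lengthᵇ = trans (length-elements V) ∣V∣≡∣S∣

    lengthᵖ : length (elements (∁ V)) ≡ ∣ ∁ S ∣
    lengthᵖ = trans (length-elements (∁ V))
      (trans (Sub.∣∁p∣≡n∸∣p∣ V) (trans (cong (n ∸_) ∣V∣≡∣S∣) (sym (Sub.∣∁p∣≡n∸∣p∣ S))))

    w : Vec (Symbol n) n
    w = shuffle S (elements V) (elements (∁ V)) lengthᵇ lengthᵖ

  fromSubsets : Pᴮ n
  fromSubsets = fromOrdered w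
    (shuffle-ordered V S _ _ lengthᵇ lengthᵖ (elements-increasing V) (elements-increasing (∁ V))
      (elements-∈ V) (All.map Sub.x∈∁p⇒x∉p (elements-∈ (∁ V))))
    λ i → shuffle-occurs S _ _ lengthᵇ lengthᵖ (either i)
    where
    either : ∀ i → i ∈ˡ elements V ⊎ i ∈ˡ elements (∁ V)
    either i with i Sub.∈? V
    ... | yes i∈V = inj₁ (∈-elements⁺ i∈V)
    ... | no  i∉V = inj₂ (∈-elements⁺ (Sub.x∉p⇒x∈∁p i∉V))

  Des-fromSubsets : Des (Pᴮ.perm fromSubsets) ≡ S
  Des-fromSubsets = trans (Des-barred fromSubsets) (shuffle-barred S _ _ lengthᵇ lengthᵖ)

  private
    barred⇔∈V : ∀ j → (Barred (lookup w j) → abs (lookup w j) ∈ V)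
                    × (abs (lookup w j) ∈ V → Barred (lookup w j))
    barred⇔∈V = shuffle-all {P = λ s → (Barred s → abs s ∈ V) × (abs s ∈ V → Barred s)} S _ _ lengthᵇ lengthᵖ
      (All.map (λ v∈ → (λ _ → v∈) , λ _ → tt) (elements-∈ V))
      (All.map (λ u∈ → (λ ()) , λ u∈V → contradiction u∈V (Sub.x∈∁p⇒x∉p u∈)) (elements-∈ (∁ V)))

  barredValues-fromSubsets : barredValues (Pᴮ.perm fromSubsets) ≡ V
  barredValues-fromSubsets = Sub.⊆-antisym
    (λ {i} i∈ → subst (_∈ V) (abs-position b i) (proj₁ (barred⇔∈V (position b i)) (∈-setOf⁻ (barredValue? b) i∈)))
    (λ {i} i∈ → ∈-setOf⁺ (barredValue? b) (proj₂ (barred⇔∈V (position b i)) (subst (_∈ V) (sym (abs-position b i)) i∈)))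
    where
    b = Pᴮ.perm fromSubsets

-- Flipping all bars and self-duality

complement : ∀ {n} → Pᴮ n → Pᴮ n
complement {n} b = fromOrdered (Vec.map swap w)
  (λ {i} {j} i<j → subst₂ InOrder (sym (Vec.lookup-map i swap w)) (sym (Vec.lookup-map j swap w))
    (swap-inOrder _ _ (ordered b i<j)))
  (λ i → position p i
       , trans (cong abs (Vec.lookup-map (position p i) swap w)) (trans (abs-swap (lookup w (position p i))) (abs-position p i)))
  where
  p = Pᴮ.perm b
  w = word p
  abs-swap : ∀ (x : Symbol n) → abs (swap x) ≡ abs x
  abs-swap (plain  _) = refl
  abs-swap (barred _) = refl
  swap-inOrder : ∀ x y → InOrder x y → InOrder {n} (swap x) (swap y)
  swap-inOrder (plain  _) (plain  _) (≢ , lt) = ≢ , λ _ → lt (inj₂ ((λ ()) , λ ()))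
  swap-inOrder (barred _) (barred _) (≢ , lt) = ≢ , λ _ → lt (inj₁ (tt , tt))
  swap-inOrder (plain  _) (barred _) (≢ , _)  = ≢ , λ where
    (inj₁ ())
    (inj₂ (¬b , _)) → contradiction tt ¬b
  swap-inOrder (barred _) (plain  _) (≢ , _)  = ≢ , λ where
    (inj₁ ())
    (inj₂ (_ , ¬b)) → contradiction tt ¬b

complement-involutive : ∀ {n} (b : Pᴮ n) →
  word (Pᴮ.perm (complement (complement b))) ≡ word (Pᴮ.perm b)
complement-involutive b = trans (sym (Vec.map-∘ swap swap w))
  (trans (Vec.map-cong (λ { (plain _) → refl ; (barred _) → refl }) w) (Vec.map-id w))
  where
  w = word (Pᴮ.perm b)

Des-complement : ∀ {n} (b : Pᴮ n) → Des (Pᴮ.perm (complement b)) ≡ ∁ (Des (Pᴮ.perm b))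
Des-complement b = trans (Des-barred (complement b))
  (trans (Vec.tabulate-cong λ j →
      trans (cong (does ∘ barred?) (Vec.lookup-map j swap w)) (flips (lookup w j)))
    (trans (Vec.tabulate-∘ not _) (cong ∁ (sym (Des-barred b)))))
  where
  w = word (Pᴮ.perm b)
  flips : ∀ {n} (x : Symbol n) → does (barred? (swap x)) ≡ not (does (barred? x))
  flips (plain  _) = refl
  flips (barred _) = refl

Pᴮ-selfDual : ∀ n → SelfDual (Pᴮ-ranked n)
Pᴮ-selfDual n = complement , record
  { isOrderMonomorphism = record
    { isOrderHomomorphism = record
      { cong = λ {b} {b′} → complement-cong {b} {b′}
      ; mono = λ {b} {b′} → complement-mono {b} {b′}
      }
    ; injective = λ {b} {b′} → injective {b} {b′}
    ; cancel    = λ {b} {b′} c≤ →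
        [ (λ c< → inj₁ (Sub.∁p⊂∁q⇒p⊃q (subst₂ _⊂_ (Des-complement b′) (Des-complement b) c<)))
        , (λ c≈ → inj₂ (injective {b} {b′} (sym c≈))) ]′ c≤
    }
  ; surjective = λ b → complement b , λ {b′} eq → trans (complement-cong {b′} {complement b} eq) (complement-involutive b)
  }
  where
  open RankedPoset (Pᴮ-ranked n) using (_≈_; _≼_)
  complement-cong : ∀ {b b′} → b ≈ b′ → complement b ≈ complement b′
  complement-cong eq = cong (Vec.map swap) eq
  complement-mono : ∀ {b b′} → b ≼ b′ → complement b′ ≼ complement b
  complement-mono {b} {b′} (inj₁ b<b′) =
    inj₁ (subst₂ _⊂_ (sym (Des-complement b′)) (sym (Des-complement b)) (Sub.p⊂q⇒∁p⊃∁q b<b′))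
  complement-mono {b} {b′} (inj₂ b≈b′) = inj₂ (sym (complement-cong {b} {b′} b≈b′))
  injective : ∀ {b b′} → complement b ≈ complement b′ → b ≈ b′
  injective {b} {b′} eq = trans (sym (complement-involutive b))
    (trans (complement-cong {complement b} {complement b′} eq) (complement-involutive b′))

-- Rank sizes

Sized : ℕ → ℕ → Set
Sized n k = Σ (Subset n) λ S → ∣ S ∣ ≡ k

-- Comparing first components makes the proof of the size irrelevant to membership and distinctness.
sized-setoid : ℕ → ℕ → Setoid 0ℓ 0ℓ
sized-setoid n k = On.setoid {B = Sized n k} (setoid (Subset n)) proj₁

addOut : ∀ {n k} → Sized n k → Sized (suc n) k
addOut (S , p) = outside ∷ S , p

addIn : ∀ {n k} → Sized n k → Sized (suc n) (suc k)
addIn (S , p) = inside ∷ S , cong suc p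

sized : ∀ n k → List (Sized n k)
sized zero    zero    = ([] , refl) ∷ []
sized zero    (suc k) = []
sized (suc n) zero    = map addOut (sized n zero)
sized (suc n) (suc k) = map addIn (sized n k) ++ map addOut (sized n (suc k))

length-sized : ∀ n k → length (sized n k) ≡ n C k
length-sized zero    zero    = refl
length-sized zero    (suc k) = refl
length-sized (suc n) zero    = trans (List.length-map addOut (sized n zero)) (length-sized n zero)
length-sized (suc n) (suc k) = begin
  length (map addIn (sized n k) ++ map addOut (sized n (suc k)))
    ≡⟨ List.length-++ (map addIn (sized n k)) ⟩
  length (map addIn (sized n k)) + length (map addOut (sized n (suc k)))
    ≡⟨ cong₂ _+_ (List.length-map addIn (sized n k)) (List.length-map addOut (sized n (suc k))) ⟩
  length (sized n k) + length (sized n (suc k))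
    ≡⟨ cong₂ _+_ (length-sized n k) (length-sized n (suc k)) ⟩
  n C k + n C suc k
    ≡⟨ nCk+nC[k+1]≡[n+1]C[k+1] n k ⟩
  suc n C suc k ∎
  where open ≡-Reasoning

sized-unique : ∀ n k → Unique.Unique (sized-setoid n k) (sized n k)
sized-unique zero    zero    = [] ∷ []
sized-unique zero    (suc k) = []
sized-unique (suc n) zero    = Unique.map⁺ (sized-setoid n zero) (sized-setoid (suc n) zero) {f = addOut}
  (λ {x} {y} → Vec.∷-injectiveʳ) (sized-unique n zero)
sized-unique (suc n) (suc k) = Unique.++⁺ T
  (Unique.map⁺ (sized-setoid n k) T {f = addIn} (λ {x} {y} → Vec.∷-injectiveʳ) (sized-unique n k))
  (Unique.map⁺ (sized-setoid n (suc k)) T {f = addOut} (λ {x} {y} → Vec.∷-injectiveʳ) (sized-unique n (suc k)))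
  λ {v} (x∈in , x∈out) →
    let _ , _ , x≡in  = Mem.∈-map⁻ (sized-setoid n k) T {v = v} x∈in
        _ , _ , x≡out = Mem.∈-map⁻ (sized-setoid n (suc k)) T {v = v} x∈out
    in case trans (sym x≡in) x≡out of λ ()
  where
  T = sized-setoid (suc n) (suc k)

∈-sized : ∀ n k (x : Sized n k) → Membership._∈_ (sized-setoid n k) x (sized n k)
∈-sized zero    zero    ([] , _) = here refl
∈-sized zero    (suc k) ([] , ())
∈-sized (suc n) zero    (outside ∷ S , p) =
  Mem.∈-map⁺ (sized-setoid n zero) (sized-setoid (suc n) zero) {f = addOut}
    (λ {x} {y} → cong (outside ∷_)) {v = S , p} (∈-sized n zero (S , p))
∈-sized (suc n) (suc k) (outside ∷ S , p) =
  Mem.∈-++⁺ʳ (sized-setoid (suc n) (suc k)) {v = outside ∷ S , p} (map addIn (sized n k))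
    (Mem.∈-map⁺ (sized-setoid n (suc k)) (sized-setoid (suc n) (suc k)) {f = addOut}
      (λ {x} {y} → cong (outside ∷_)) {v = S , p} (∈-sized n (suc k) (S , p)))
∈-sized (suc n) (suc k) (inside ∷ S , p) =
  Mem.∈-++⁺ˡ (sized-setoid (suc n) (suc k)) {v = inside ∷ S , p}
    (Mem.∈-map⁺ (sized-setoid n k) (sized-setoid (suc n) (suc k)) {f = addIn}
      (λ {x} {y} → cong (inside ∷_)) {v = S , ℕ.suc-injective p} (∈-sized n k (S , ℕ.suc-injective p)))

length-cartesianProductWith : ∀ {A B C : Set} (f : A → B → C) xs ys →
  length (cartesianProductWith f xs ys) ≡ length xs * length ys
length-cartesianProductWith f []       ys = refl
length-cartesianProductWith f (x ∷ xs) ys = trans (List.length-++ (map (f x) ys))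
  (cong₂ _+_ (List.length-map (f x) ys) (length-cartesianProductWith f xs ys))

rankSize : ℕ → ℕ → ℕ
rankSize n k = (n C k) * (n C k)

Pᴮ-rankSizes : ∀ n → IsRankSizes (Pᴮ-ranked n) (rankSize n)
Pᴮ-rankSizes n k =
  cartesianProductWith build (sized n k) (sized n k)
  , Unique.cartesianProductWith⁺ T T P build
      (λ {w} {x} {y} {z} eq → build-injective w y x z eq) (sized-unique n k) (sized-unique n k)
  , (λ b → mk⇔
      (λ b∈ → case Mem.∈-cartesianProductWith⁻ T T P build (sized n k) (sized n k) {b} b∈ of λ where
        ((S , p) , (V , q) , _ , _ , b≡) →
          trans (cong (∣_∣ ∘ descents) b≡) (trans (cong ∣_∣ (Des-fromSubsets S V (trans q (sym p)))) p))
      (λ p → Mem.∈-resp-≈ P {x = rebuild b p} {b} (rebuild-≈ b p)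
        (Mem.∈-cartesianProductWith⁺ T T P
          (λ {w} {x} {y} {z} → build-cong w x y z)
          {a = Des (perm b) , p} {b = barredValues (perm b) , V-size b p}
          (∈-sized n k (Des (perm b) , p)) (∈-sized n k (barredValues (perm b) , V-size b p)))))
  , trans (length-cartesianProductWith build (sized n k) (sized n k)) (cong (λ c → c * c) (length-sized n k))
  where
  open Pᴮ
  T = sized-setoid n k
  P = RankedPoset.Eq.setoid (Pᴮ-ranked n)
  build : Sized n k → Sized n k → Pᴮ n
  build (S , p) (V , q) = fromSubsets S V (trans q (sym p))
  build-injective : ∀ w x y z → word (perm (build w x)) ≡ word (perm (build y z)) →
                    proj₁ w ≡ proj₁ y × proj₁ x ≡ proj₁ z
  build-injective (S , p) (V , q) (S′ , p′) (V′ , q′) eq =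
    trans (sym (Des-fromSubsets S V _)) (trans (cong descents eq) (Des-fromSubsets S′ V′ _))
    , trans (sym (barredValues-fromSubsets S V _))
        (trans (barredValues-cong (build (S , p) (V , q)) (build (S′ , p′) (V′ , q′)) eq)
               (barredValues-fromSubsets S′ V′ _))
  build-cong : ∀ w x y z → proj₁ w ≡ proj₁ x → proj₁ y ≡ proj₁ z →
               word (perm (build w y)) ≡ word (perm (build x z))
  build-cong (S , p) (S , p′) (V , q) (V , q′) refl refl =
    Pᴮ-unique (build (S , p) (V , q)) (build (S , p′) (V , q′))
      (trans (Des-fromSubsets S V _) (sym (Des-fromSubsets S V _)))
      (trans (barredValues-fromSubsets S V _) (sym (barredValues-fromSubsets S V _)))
  V-size : ∀ b → ∣ Des (perm b) ∣ ≡ k → ∣ barredValues (perm b) ∣ ≡ k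
  V-size b p = trans (sym (∣barredPositions∣≡∣barredValues∣ (perm b)))
    (trans (cong ∣_∣ (sym (Des-barred b))) p)
  rebuild : ∀ b → ∣ Des (perm b) ∣ ≡ k → Pᴮ n
  rebuild b p = build (Des (perm b) , p) (barredValues (perm b) , V-size b p)
  rebuild-≈ : ∀ b p → word (perm (rebuild b p)) ≡ word (perm b)
  rebuild-≈ b p = Pᴮ-unique (rebuild b p) b
    (Des-fromSubsets (Des (perm b)) (barredValues (perm b)) (trans (V-size b p) (sym p)))
    (barredValues-fromSubsets (Des (perm b)) (barredValues (perm b)) (trans (V-size b p) (sym p)))

Pᴮ-rankSymmetric : ∀ n → RankSymmetric (Pᴮ-ranked n)
Pᴮ-rankSymmetric n = rankSize n , Pᴮ-rankSizes n , λ k k≤n →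
  cong (λ c → c * c) (nCk≡nC[n∸k] k≤n)

Pᴮ-rankUnimodal : ∀ n → RankUnimodal (Pᴮ-ranked n)
Pᴮ-rankUnimodal n = rankSize n , Pᴮ-rankSizes n , ⌊ n /2⌋ , ℕ.⌊n/2⌋≤n n
  , (λ k k<j → square (nCk≤nC[k+1] n k (ascending k k<j)))
  , (λ k j≤k k<n → square (nC-antitone-step n k k<n (descending k j≤k)))
  where
  square : ∀ {a b} → a ≤ b → a * a ≤ b * b
  square a≤b = ℕ.*-mono-≤ a≤b a≤b
  halves : ⌊ n /2⌋ + ⌈ n /2⌉ ≡ n
  halves = ℕ.⌊n/2⌋+⌈n/2⌉≡n n
  ascending : ∀ k → k < ⌊ n /2⌋ → suc (k + k) ≤ n
  ascending k k<j = subst (suc (k + k) ≤_) halves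
    (ℕ.+-mono-≤ k<j (ℕ.≤-trans (ℕ.<⇒≤ k<j) (ℕ.⌊n/2⌋≤⌈n/2⌉ n)))
  descending : ∀ k → ⌊ n /2⌋ ≤ k → n ≤ suc (k + k)
  descending k j≤k = subst (_≤ suc (k + k)) halves (subst (⌊ n /2⌋ + ⌈ n /2⌉ ≤_) (ℕ.+-suc k k)
    (ℕ.+-mono-≤ j≤k (ℕ.≤-trans (ceil n) (s≤s j≤k))))
    where
    ceil : ∀ n → ⌈ n /2⌉ ≤ suc ⌊ n /2⌋
    -- By definition `⌈ n /2⌉` is `⌊ suc n /2⌋`, and `suc ⌊ n /2⌋` is `⌊ suc (suc n) /2⌋`.
    ceil n = ℕ.⌊n/2⌋-mono {suc n} {suc (suc n)} (ℕ.n≤1+n _)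

-- The Sperner property

-- The ranks r, …, r + m − 1, ordered so that binomial coefficients increase.
outsideIn : ℕ → ℕ → List ℕ
outsideIn r zero          = []
outsideIn r (suc zero)    = r ∷ []
outsideIn r (suc (suc m)) = r ∷ r + suc m ∷ outsideIn (suc r) m

insideOut : ℕ → ℕ → List ℕ
insideOut r m = reverse (outsideIn r m)

outsideIn-range : ∀ r m → All (λ x → r ≤ x × x < r + m) (outsideIn r m)
outsideIn-range r zero          = []
outsideIn-range r (suc zero)    = (ℕ.≤-refl , ℕ.m<m+n r z<s) ∷ []
outsideIn-range r (suc (suc m)) =
  (ℕ.≤-refl , ℕ.m<m+n r z<s)
  ∷ (ℕ.m≤m+n r (suc m) , ℕ.+-monoʳ-< r (ℕ.n<1+n (suc m)))
  ∷ All.map (λ (r<x , x<) → ℕ.<⇒≤ r<x ,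
      ℕ.<-≤-trans x< (ℕ.≤-trans (ℕ.≤-reflexive (sym (ℕ.+-suc r m))) (ℕ.+-monoʳ-≤ r (ℕ.n≤1+n (suc m)))))
      (outsideIn-range (suc r) m)

outsideIn-↭ : ∀ r m → outsideIn r m ↭ applyUpTo (r +_) m
outsideIn-↭ r zero          = Perm.refl
outsideIn-↭ r (suc zero)    = Perm.↭-reflexive (cong (_∷ []) (sym (ℕ.+-identityʳ r)))
outsideIn-↭ r (suc (suc m)) = begin
  r ∷ r + suc m ∷ outsideIn (suc r) m             ↭⟨ Perm.prep r (Perm.prep (r + suc m) (outsideIn-↭ (suc r) m)) ⟩
  r ∷ r + suc m ∷ applyUpTo (suc r +_) m          ≡⟨ cong₂ (λ x xs → x ∷ r + suc m ∷ xs) (sym (ℕ.+-identityʳ r)) shift ⟩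
  r + 0 ∷ r + suc m ∷ applyUpTo (λ t → r + suc t) m ↭⟨ Perm.prep (r + 0) (Perm.∷↭∷ʳ (r + suc m) _) ⟩
  r + 0 ∷ (applyUpTo (λ t → r + suc t) m List.∷ʳ (r + suc m)) ≡⟨ cong (r + 0 ∷_) (List.applyUpTo-∷ʳ (λ t → r + suc t) m) ⟩
  applyUpTo (r +_) (suc (suc m))                  ∎
  where
  open Perm.PermutationReasoning
  shift : applyUpTo (suc r +_) m ≡ applyUpTo (λ t → r + suc t) m
  shift = trans (sym (List.map-upTo (suc r +_) m))
    (trans (List.map-cong (λ t → sym (ℕ.+-suc r t)) _) (List.map-upTo (λ t → r + suc t) m))

module _ {A : Set} {R : A → A → Set} where

  allPairs-reverse : ∀ {xs} → AllPairs R xs → AllPairs (flip R) (reverse xs)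
  allPairs-reverse []             = []
  allPairs-reverse {x ∷ xs} (x∼ ∷ xs∼) = subst (AllPairs (flip R)) (sym (List.unfold-reverse x xs))
    (AllPairs.++⁺ (allPairs-reverse xs∼) ([] ∷ [])
      (All.map (_∷ []) (Perm.All-resp-↭ (↭-sym (Perm.↭-reverse xs)) x∼)))

outsideIn-unique : ∀ r m → AllPairs _≢_ (outsideIn r m)
outsideIn-unique r zero          = []
outsideIn-unique r (suc zero)    = [] ∷ []
outsideIn-unique r (suc (suc m)) =
  (ℕ.<⇒≢ (ℕ.m<m+n r z<s) ∷ All.map (λ (r<x , _) → ℕ.<⇒≢ r<x) (outsideIn-range (suc r) m))
  ∷ All.map (λ (_ , x<) x≡ → ℕ.<-irrefl (trans (sym x≡) (ℕ.+-suc r m)) x<) (outsideIn-range (suc r) m)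
  ∷ outsideIn-unique (suc r) m

-- The equation makes the range symmetric, running from `r` to `n ∸ r`. Its two extreme ranks have
-- equal binomial coefficients, and by `nC-window` everything inside is at least as large.
outsideIn-sorted : ∀ n r m → r + r + m ≡ suc n → AllPairs (λ x y → n C x ≤ n C y) (outsideIn r m)
outsideIn-sorted n r zero          _  = []
outsideIn-sorted n r (suc zero)    _  = [] ∷ []
outsideIn-sorted n r (suc (suc m)) eq =
  All.map lowest (All.tail (outsideIn-range r (suc (suc m))))
  ∷ All.map (λ (r<x , x<) → ℕ.≤-trans (ℕ.≤-reflexive mirror)
      (lowest (ℕ.<⇒≤ r<x , ℕ.<-≤-trans x<
        (ℕ.≤-trans (ℕ.≤-reflexive (sym (ℕ.+-suc r m))) (ℕ.+-monoʳ-≤ r (ℕ.n≤1+n _))))))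
      (outsideIn-range (suc r) m)
  ∷ outsideIn-sorted n (suc r) m (trans (cong (_+ m) (cong suc (ℕ.+-suc r r)))
      (trans (sym (trans (ℕ.+-suc (r + r) (suc m)) (cong suc (ℕ.+-suc (r + r) m)))) eq))
  where
  n≡ : n ≡ r + (r + suc m)
  n≡ = trans (ℕ.suc-injective (trans (sym eq) (ℕ.+-suc (r + r) (suc m)))) (ℕ.+-assoc r r (suc m))
  lowest : ∀ {x} → r ≤ x × x < r + suc (suc m) → n C r ≤ n C x
  lowest {x} (r≤x , x<) = nC-window n r≤x (subst (r + x ≤_) (sym n≡)
    (ℕ.+-monoʳ-≤ r (s≤s⁻¹ (subst (x <_) (ℕ.+-suc r (suc m)) x<))))
  mirror : n C (r + suc m) ≡ n C r
  mirror = trans (nCk≡nC[n∸k] (subst (r + suc m ≤_) (sym n≡) (ℕ.m≤n+m (r + suc m) r)))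
    (cong (n C_) (trans (cong (_∸ (r + suc m)) n≡) (ℕ.m+n∸n≡m r (r + suc m))))

-- A list has only one sorted permutation, so the sorting inside `sumOfLargest` can be traded for an
-- explicit order of the ranks.
sort-rankSizes : ∀ n → sort (applyUpTo (rankSize n) (suc n)) ≡ map (rankSize n) (outsideIn 0 (suc n))
sort-rankSizes n = Pointwise.Pointwise-≡⇒≡
  (Sorted.↗↭↗⇒≋ ℕ.≤-totalOrder (sort-↗ _) sorted (Perm.↭⇒↭ₛ perm))
  where
  sorted = Sorted.AllPairs⇒Sorted ℕ.≤-totalOrder
    (AllPairs.map⁺ (AllPairs.map (λ le → ℕ.*-mono-≤ le le) (outsideIn-sorted n 0 (suc n) refl)))
  perm : sort (applyUpTo (rankSize n) (suc n)) ↭ map (rankSize n) (outsideIn 0 (suc n))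
  perm = ↭-trans (sort-↭ _) (↭-trans
    (Perm.↭-reflexive (sym (List.map-applyUpTo id (rankSize n) (suc n))))
    (Perm.map⁺ (rankSize n) (↭-sym (outsideIn-↭ 0 (suc n)))))

-- The ranks that carry the `k` largest sizes, or all ranks if `k` exceeds their number. The tie
-- between the mirror images `r` and `n ∸ r` is always broken in the same way, so that the choice is
-- compatible with every symmetric chain.
middleRanks : ℕ → ℕ → List ℕ
middleRanks n k = take k (insideOut 0 (suc n))

sumOfLargest-rankSizes : ∀ n k →
  sumOfLargest (Pᴮ-ranked n) k (rankSize n) ≡ sum (map (rankSize n) (middleRanks n k))
sumOfLargest-rankSizes n k = cong sum (begin
  take k (reverse (sort (applyUpTo (rankSize n) (suc n))))
    ≡⟨ cong (take k ∘ reverse) (sort-rankSizes n) ⟩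
  take k (reverse (map (rankSize n) (outsideIn 0 (suc n))))
    ≡⟨ cong (take k) (List.reverse-map (rankSize n) (outsideIn 0 (suc n))) ⟨
  take k (map (rankSize n) (insideOut 0 (suc n)))
    ≡⟨ List.take-map k (insideOut 0 (suc n)) ⟩
  map (rankSize n) (middleRanks n k) ∎)
  where open ≡-Reasoning

take-++ : ∀ {A : Set} k (xs ys : List A) → ∃[ zs ] take k (xs ++ ys) ≡ take k xs ++ zs
take-++ zero    xs       ys = [] , refl
take-++ (suc k) []       ys = take (suc k) ys , refl
take-++ (suc k) (x ∷ xs) ys = let zs , eq = take-++ k xs ys in zs , cong (x ∷_) eq

-- A range centred at `n / 2` arises from `0, …, n` by peeling off pairs of extreme ranks, which the
-- inside-out order puts last. This is why one list of middle ranks can serve chains of all heights.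
insideOut-prefix : ∀ n r m → r + r + suc m ≡ suc n →
                   ∃[ zs ] insideOut 0 (suc n) ≡ insideOut r (suc m) ++ zs
insideOut-prefix n zero    m refl = [] , sym (List.++-identityʳ _)
insideOut-prefix n (suc r) m eq =
  let zs , eq′ = insideOut-prefix n r (suc (suc m)) (trans (ℕ.+-suc (r + r) (suc (suc m)))
                   (trans (cong suc (trans (ℕ.+-suc (r + r) (suc m)) (cong (_+ suc m) (sym (ℕ.+-suc r r))))) eq))
      inner = outsideIn (suc r) (suc m)
  in r + suc (suc m) ∷ r ∷ zs , (begin
    insideOut 0 (suc n)
      ≡⟨ eq′ ⟩
    insideOut r (suc (suc (suc m))) ++ zs
      ≡⟨ cong (_++ zs) (trans (List.unfold-reverse r (r + suc (suc m) ∷ inner))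
           (cong (List._∷ʳ r) (List.unfold-reverse (r + suc (suc m)) inner))) ⟩
    ((reverse inner ++ r + suc (suc m) ∷ []) ++ r ∷ []) ++ zs
      ≡⟨ trans (List.++-assoc (reverse inner ++ r + suc (suc m) ∷ []) (r ∷ []) zs)
           (List.++-assoc (reverse inner) (r + suc (suc m) ∷ []) (r ∷ zs)) ⟩
    reverse inner ++ r + suc (suc m) ∷ r ∷ zs ∎)
  where open ≡-Reasoning

middleRanks-prefix : ∀ n k r m → r + r + suc m ≡ suc n →
                     ∃[ zs ] middleRanks n k ≡ take k (insideOut r (suc m)) ++ zs
middleRanks-prefix n k r m eq =
  let zs , eq₁ = insideOut-prefix n r m eq
      zs′ , eq₂ = take-++ k (insideOut r (suc m)) zs
  in zs′ , trans (cong (take k) eq₁) eq₂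

middleRanks-unique : ∀ n k → AllPairs _≢_ (middleRanks n k)
middleRanks-unique n k = AllPairs.take⁺ k
  (AllPairs.map (λ x≢y y≡x → x≢y (sym y≡x)) (allPairs-reverse (outsideIn-unique 0 (suc n))))

module _ (P : RankedPoset) where
  open RankedPoset P

  rank∈-cardinality : ∀ {w} → IsRankSizes P w → ∀ {M} → AllPairs _≢_ M →
                      HasCardinality Eq.setoid (λ x → Any (rank x ≡_) M) (sum (map w M))
  rank∈-cardinality isw []          = [] , [] , (λ x → mk⇔ (λ ()) (λ ())) , refl
  rank∈-cardinality isw {j ∷ M} (j∉M ∷ M!) = hasCardinality-⇔ {S = Eq.setoid}
    (λ x → mk⇔ (λ { (inj₁ eq) → here eq ; (inj₂ x∈) → there x∈ })
               (λ { (here eq) → inj₁ eq ; (there x∈) → inj₂ x∈ }))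
    (hasCardinality-⊎ {S = Eq.setoid} (λ x eq x∈ → All.All¬⇒¬Any (All.map (λ j≢ eq′ → j≢ (trans (sym eq) eq′)) j∉M) x∈)
      (isw j) (rank∈-cardinality isw M!))

  -- The antichains are the rank levels listed in `M`, numbered by their position in it. Those
  -- numbered beyond the end of `M` are empty, which covers a `k` larger than the number of ranks.
  levels-union : (∀ {x y} → x ≺ y → rank x < rank y) → ∀ {w} → IsRankSizes P w →
    ∀ {M} → AllPairs _≢_ M → ∀ k → length M ≤ k → UnionOfAntichainsOfSize P k (sum (map w M))
  levels-union ≺⇒< isw {M} M! k len =
    (λ i x → Σ (Any (rank x ≡_) M) λ x∈ → toℕ (Any.index x∈) ≡ toℕ i)
    , (λ i x y (x∈ , x≡i) (y∈ , y≡i) x≺y → ℕ.<-irrefl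
        (trans (Any.lookup-index x∈)
          (trans (cong (List.lookup M) (Fin.toℕ-injective (trans x≡i (sym y≡i)))) (sym (Any.lookup-index y∈))))
        (≺⇒< x≺y))
    , hasCardinality-⇔ {S = Eq.setoid} (λ x → mk⇔
        (λ x∈ → fromℕ< (ℕ.<-≤-trans (Fin.toℕ<n (Any.index x∈)) len) , x∈ , sym (Fin.toℕ-fromℕ< _))
        (λ (i , x∈ , _) → x∈))
        (rank∈-cardinality isw M!)

Pᴮ-≺⇒< : ∀ n {x y} → RankedPoset._≺_ (Pᴮ-ranked n) x y →
         RankedPoset.rank (Pᴮ-ranked n) x < RankedPoset.rank (Pᴮ-ranked n) y
Pᴮ-≺⇒< n (inj₁ x<y , _)   = Sub.p⊂q⇒∣p∣<∣q∣ x<y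
Pᴮ-≺⇒< n (inj₂ x≈y , x≉y) = contradiction x≈y x≉y

-- Sums over subsets and along symmetric chains

ΣSub : ∀ n → (Subset n → ℕ) → ℕ
ΣSub zero    h = h []
ΣSub (suc n) h = ΣSub n (h ∘ (outside ∷_)) + ΣSub n (h ∘ (inside ∷_))

ΣSub-cong : ∀ n {g h : Subset n → ℕ} → (∀ S → g S ≡ h S) → ΣSub n g ≡ ΣSub n h
ΣSub-cong zero    g≡h = g≡h []
ΣSub-cong (suc n) g≡h = cong₂ _+_ (ΣSub-cong n (g≡h ∘ (outside ∷_))) (ΣSub-cong n (g≡h ∘ (inside ∷_)))

+-interchange : ∀ a b c d → (a + b) + (c + d) ≡ (a + c) + (b + d)
+-interchange a b c d = begin
  (a + b) + (c + d)  ≡⟨ ℕ.+-assoc a b (c + d) ⟩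
  a + (b + (c + d))  ≡⟨ cong (a +_) (sym (ℕ.+-assoc b c d)) ⟩
  a + ((b + c) + d)  ≡⟨ cong (λ e → a + (e + d)) (ℕ.+-comm b c) ⟩
  a + ((c + b) + d)  ≡⟨ cong (a +_) (ℕ.+-assoc c b d) ⟩
  a + (c + (b + d))  ≡⟨ ℕ.+-assoc a c (b + d) ⟨
  (a + c) + (b + d)  ∎
  where open ≡-Reasoning

ΣSub-+ : ∀ n (g h : Subset n → ℕ) → ΣSub n (λ S → g S + h S) ≡ ΣSub n g + ΣSub n h
ΣSub-+ zero    g h = refl
ΣSub-+ (suc n) g h = trans
  (cong₂ _+_ (ΣSub-+ n (g ∘ (outside ∷_)) (h ∘ (outside ∷_))) (ΣSub-+ n (g ∘ (inside ∷_)) (h ∘ (inside ∷_))))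
  (+-interchange (ΣSub n (g ∘ (outside ∷_))) _ _ _)

ΣSub-0 : ∀ n → ΣSub n (λ _ → 0) ≡ 0
ΣSub-0 zero    = refl
ΣSub-0 (suc n) = cong₂ _+_ (ΣSub-0 n) (ΣSub-0 n)

δ : ℕ → ℕ → ℕ
δ zero    zero    = 1
δ zero    (suc _) = 0
δ (suc _) zero    = 0
δ (suc p) (suc q) = δ p q

δ-refl : ∀ p → δ p p ≡ 1
δ-refl zero    = refl
δ-refl (suc p) = δ-refl p

ΣSub-size : ∀ n p c → ΣSub n (λ S → δ p ∣ S ∣ * c) ≡ (n C p) * c
ΣSub-size zero    zero    c = refl
ΣSub-size zero    (suc p) c = refl
ΣSub-size (suc n) zero    c = trans (cong₂ _+_ (ΣSub-size n zero c) (ΣSub-0 n)) (ℕ.+-identityʳ _)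
ΣSub-size (suc n) (suc p) c = begin
  ΣSub n (λ S → δ (suc p) ∣ S ∣ * c) + ΣSub n (λ S → δ p ∣ S ∣ * c)
    ≡⟨ cong₂ _+_ (ΣSub-size n (suc p) c) (ΣSub-size n p c) ⟩
  (n C suc p) * c + (n C p) * c
    ≡⟨ ℕ.+-comm ((n C suc p) * c) _ ⟩
  (n C p) * c + (n C suc p) * c
    ≡⟨ ℕ.*-distribʳ-+ c (n C p) (n C suc p) ⟨
  (n C p + n C suc p) * c
    ≡⟨ cong (_* c) (nCk+nC[k+1]≡[n+1]C[k+1] n p) ⟩
  (suc n C suc p) * c ∎
  where open ≡-Reasoning

_≟ᵇ_ : ∀ {n} (S T : Subset n) → Dec (S ≡ T)
_≟ᵇ_ = Vec.≡-dec Bool._≟_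

δˢ : ∀ {n} → Subset n → Subset n → ℕ
δˢ T S = if does (T ≟ᵇ S) then 1 else 0

ΣSub-δˢ : ∀ n (T : Subset n) → ΣSub n (δˢ T) ≡ 1
ΣSub-δˢ zero    []            = refl
ΣSub-δˢ (suc n) (outside ∷ T) = cong₂ _+_ (ΣSub-δˢ n T) (ΣSub-0 n)
ΣSub-δˢ (suc n) (inside  ∷ T) = cong₂ _+_ (ΣSub-0 n) (ΣSub-δˢ n T)

module _ {A : Set} {n : ℕ} (f : A → Subset n) where

  fibre : List A → Subset n → List A
  fibre xs S = filter (λ x → f x ≟ᵇ S) xs

  Σ-fibres : ∀ xs → ΣSub n (length ∘ fibre xs) ≡ length xs
  Σ-fibres []       = ΣSub-0 n
  Σ-fibres (x ∷ xs) = begin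
    ΣSub n (length ∘ fibre (x ∷ xs))                       ≡⟨ ΣSub-cong n split ⟩
    ΣSub n (λ S → δˢ (f x) S + length (fibre xs S))        ≡⟨ ΣSub-+ n (δˢ (f x)) _ ⟩
    ΣSub n (δˢ (f x)) + ΣSub n (length ∘ fibre xs)         ≡⟨ cong₂ _+_ (ΣSub-δˢ n (f x)) (Σ-fibres xs) ⟩
    suc (length xs)                                        ∎
    where
    open ≡-Reasoning
    split : ∀ S → length (fibre (x ∷ xs) S) ≡ δˢ (f x) S + length (fibre xs S)
    split S with does (f x ≟ᵇ S)
    ... | true  = refl
    ... | false = refl

Σ≤ : ℕ → (ℕ → ℕ) → ℕ
Σ≤ zero    g = g 0
Σ≤ (suc l) g = Σ≤ l g + g (suc l)

Σ≤-cong : ∀ l {g h} → (∀ {t} → t ≤ l → g t ≡ h t) → Σ≤ l g ≡ Σ≤ l h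
Σ≤-cong zero    g≡h = g≡h z≤n
Σ≤-cong (suc l) g≡h = cong₂ _+_ (Σ≤-cong l (λ t≤l → g≡h (ℕ.m≤n⇒m≤1+n t≤l))) (g≡h ℕ.≤-refl)

Σ≤-mono : ∀ l {g h} → (∀ t → g t ≤ h t) → Σ≤ l g ≤ Σ≤ l h
Σ≤-mono zero    g≤h = g≤h 0
Σ≤-mono (suc l) g≤h = ℕ.+-mono-≤ (Σ≤-mono l g≤h) (g≤h (suc l))

Σ≤-+ : ∀ l g h → Σ≤ l (λ t → g t + h t) ≡ Σ≤ l g + Σ≤ l h
Σ≤-+ zero    g h = refl
Σ≤-+ (suc l) g h = trans (cong (_+ (g (suc l) + h (suc l))) (Σ≤-+ l g h)) (+-interchange (Σ≤ l g) _ _ _)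

term≤Σ≤ : ∀ l g {t} → t ≤ l → g t ≤ Σ≤ l g
term≤Σ≤ zero    g z≤n = ℕ.≤-refl
term≤Σ≤ (suc l) g t≤1+l with ℕ.m≤n⇒m<n∨m≡n t≤1+l
... | inj₁ (s≤s t≤l) = ℕ.≤-trans (term≤Σ≤ l g t≤l) (ℕ.m≤m+n _ _)
... | inj₂ refl      = ℕ.m≤n+m _ _

Σ≤-applyUpTo : ∀ l g r → Σ≤ l (λ t → g (r + t)) ≡ sum (map g (applyUpTo (r +_) (suc l)))
Σ≤-applyUpTo zero    g r = sym (ℕ.+-identityʳ _)
Σ≤-applyUpTo (suc l) g r = begin
  Σ≤ l (λ t → g (r + t)) + g (r + suc l)
    ≡⟨ cong₂ _+_ (Σ≤-applyUpTo l g r) (sym (ℕ.+-identityʳ _)) ⟩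
  sum (map g (applyUpTo (r +_) (suc l))) + sum (map g (r + suc l ∷ []))
    ≡⟨ ℕ.sum-++ (map g (applyUpTo (r +_) (suc l))) _ ⟨
  sum (map g (applyUpTo (r +_) (suc l)) ++ map g (r + suc l ∷ []))
    ≡⟨ cong sum (List.map-++ g (applyUpTo (r +_) (suc l)) _) ⟨
  sum (map g (applyUpTo (r +_) (suc l) List.∷ʳ (r + suc l)))
    ≡⟨ cong (sum ∘ map g) (List.applyUpTo-∷ʳ (r +_) (suc l)) ⟩
  sum (map g (applyUpTo (r +_) (suc (suc l)))) ∎
  where open ≡-Reasoning

-- A chain of subsets of consecutive sizes, symmetric about n / 2; its members are
-- at 0, …, at height, and the later values of at are irrelevant.
record Chain (n : ℕ) : Set where
  field
    bottom height : ℕ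
    centred : bottom + bottom + height ≡ n
    at      : ℕ → Subset n
    size    : ∀ {t} → t ≤ height → ∣ at t ∣ ≡ bottom + t
    nested  : ∀ {t u} → t ≤ u → u ≤ height → at t ⊆ at u

open Chain

chainSum : ∀ {n} → (Subset n → ℕ) → Chain n → ℕ
chainSum h c = Σ≤ (height c) (h ∘ at c)

-- The first of two chains that replace `c`: its members without the new element, then its top with
-- the new element. The least size stays and the greatest grows by one, so the centre moves to half
-- of `suc n`.
extendTop : ∀ {n} → Chain n → Chain (suc n)
extendTop {n} c = record
  { bottom = bottom c ; height = suc (height c)
  ; centred = trans (ℕ.+-suc (bottom c + bottom c) (height c)) (cong suc (centred c))
  ; at      = f
  ; size    = size′
  ; nested  = nested′
  }
  where
  f : ℕ → Subset (suc n)
  f t with t ℕ.≤? height c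
  ... | yes _ = outside ∷ at c t
  ... | no  _ = inside ∷ at c (height c)
  size′ : ∀ {t} → t ≤ suc (height c) → ∣ f t ∣ ≡ bottom c + t
  size′ {t} t≤ with t ℕ.≤? height c
  ... | yes t≤l = size c t≤l
  ... | no  t≰l = trans (cong suc (size c ℕ.≤-refl))
    (trans (sym (ℕ.+-suc (bottom c) (height c))) (cong (bottom c +_) (ℕ.≤-antisym (ℕ.≰⇒> t≰l) t≤)))
  nested′ : ∀ {t u} → t ≤ u → u ≤ suc (height c) → f t ⊆ f u
  nested′ {t} {u} t≤u u≤ with t ℕ.≤? height c | u ℕ.≤? height c
  ... | yes _   | yes u≤l = Sub.s⊆s (nested c t≤u u≤l)
  ... | yes t≤l | no  _   = Sub.out⊆ (nested c t≤l ℕ.≤-refl)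
  ... | no  t≰l | yes u≤l = contradiction (ℕ.≤-trans t≤u u≤l) t≰l
  ... | no  _   | no  _   = id

-- The second chain: the members with the new element, except the top, which `extendTop` has already
-- taken. Nothing is left of a chain with one member, whence the hypothesis on the height.
lift : ∀ {n} (c : Chain n) {l′} → height c ≡ suc l′ → Chain (suc n)
lift c {l′} eq = record
  { bottom = suc (bottom c) ; height = l′
  ; centred = cong suc (trans (cong (_+ l′) (ℕ.+-suc (bottom c) (bottom c)))
      (trans (sym (ℕ.+-suc (bottom c + bottom c) l′)) (trans (cong (bottom c + bottom c +_) (sym eq)) (centred c))))
  ; at      = λ t → inside ∷ at c t
  ; size    = λ t≤l′ → cong suc (size c (weaken t≤l′))
  ; nested  = λ t≤u u≤l′ → Sub.s⊆s (nested c t≤u (weaken u≤l′))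
  }
  where
  weaken : ∀ {t} → t ≤ l′ → t ≤ height c
  weaken t≤l′ = subst (_ ≤_) (sym eq) (ℕ.m≤n⇒m≤1+n t≤l′)

-- The height is a separate argument so that it can be matched on while `c` stays a variable.
extendBy : ∀ {n} (c : Chain n) m → height c ≡ m → List (Chain (suc n))
extendBy c zero    _  = extendTop c ∷ []
extendBy c (suc m) eq = extendTop c ∷ lift c eq ∷ []

extend : ∀ {n} → Chain n → List (Chain (suc n))
extend c = extendBy c (height c) refl

-- The symmetric chain decomposition of de Bruijn, Tengbergen and Kruyswijk.
symmetricChains : ∀ n → List (Chain n)
symmetricChains zero    = record
  { bottom = 0 ; height = 0 ; centred = refl ; at = λ _ → [] ; size = λ { z≤n → refl } ; nested = λ _ _ → id } ∷ []
symmetricChains (suc n) = List.concatMap extend (symmetricChains n)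

extendTop-sum : ∀ {n} h (c : Chain n) →
  chainSum h (extendTop c) ≡ chainSum (h ∘ (outside ∷_)) c + h (inside ∷ at c (height c))
extendTop-sum h c = cong₂ _+_ (Σ≤-cong (height c) below) top
  where
  below : ∀ {t} → t ≤ height c → h (at (extendTop c) t) ≡ h (outside ∷ at c t)
  below {t} t≤l with t ℕ.≤? height c
  ... | yes _   = refl
  ... | no  t≰l = contradiction t≤l t≰l
  top : h (at (extendTop c) (suc (height c))) ≡ h (inside ∷ at c (height c))
  top with suc (height c) ℕ.≤? height c
  ... | yes 1+l≤l = contradiction 1+l≤l ℕ.1+n≰n
  ... | no  _     = refl

extendBy-sum : ∀ {n} h (c : Chain n) m eq → sum (map (chainSum h) (extendBy c m eq))
               ≡ chainSum (h ∘ (outside ∷_)) c + chainSum (h ∘ (inside ∷_)) c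
extendBy-sum h c zero eq = trans (ℕ.+-identityʳ _) (trans (extendTop-sum h c)
  (cong (chainSum (h ∘ (outside ∷_)) c +_) (trans (cong (λ m → h (inside ∷ at c m)) eq)
    (cong (λ m → Σ≤ m (h ∘ (inside ∷_) ∘ at c)) (sym eq)))))
extendBy-sum h c (suc m) eq = begin
  chainSum h (extendTop c) + (I m + 0)
    ≡⟨ cong₂ _+_ (extendTop-sum h c) (ℕ.+-identityʳ _) ⟩
  (O + h (inside ∷ at c (height c))) + I m
    ≡⟨ ℕ.+-assoc O _ _ ⟩
  O + (h (inside ∷ at c (height c)) + I m)
    ≡⟨ cong (O +_) (ℕ.+-comm _ (I m)) ⟩
  O + (I m + h (inside ∷ at c (height c)))
    ≡⟨ cong (λ t → O + (I m + h (inside ∷ at c t))) eq ⟩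
  O + I (suc m)
    ≡⟨ cong (λ t → O + I t) eq ⟨
  O + I (height c) ∎
  where
  open ≡-Reasoning
  O : ℕ
  O = chainSum (h ∘ (outside ∷_)) c
  I : ℕ → ℕ
  I m = Σ≤ m (h ∘ (inside ∷_) ∘ at c)

-- That every subset lies on exactly one chain, expressed for an arbitrary weight `h`; in this form
-- it turns inequalities along chains into one over all subsets.
symmetricChains-sum : ∀ n h → sum (map (chainSum h) (symmetricChains n)) ≡ ΣSub n h
symmetricChains-sum zero    h = ℕ.+-identityʳ _
symmetricChains-sum (suc n) h = trans (go (symmetricChains n))
  (cong₂ _+_ (symmetricChains-sum n (h ∘ (outside ∷_))) (symmetricChains-sum n (h ∘ (inside ∷_))))
  where
  go : ∀ cs → sum (map (chainSum h) (List.concatMap extend cs))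
            ≡ sum (map (chainSum (h ∘ (outside ∷_))) cs) + sum (map (chainSum (h ∘ (inside ∷_))) cs)
  go []       = refl
  go (c ∷ cs) = begin
    sum (map (chainSum h) (extend c ++ List.concatMap extend cs))
      ≡⟨ cong sum (List.map-++ (chainSum h) (extend c) _) ⟩
    sum (map (chainSum h) (extend c) ++ map (chainSum h) (List.concatMap extend cs))
      ≡⟨ ℕ.sum-++ (map (chainSum h) (extend c)) _ ⟩
    sum (map (chainSum h) (extend c)) + sum (map (chainSum h) (List.concatMap extend cs))
      ≡⟨ cong₂ _+_ (extendBy-sum h c (height c) refl) (go cs) ⟩
    (chainSum (h ∘ (outside ∷_)) c + chainSum (h ∘ (inside ∷_)) c)
      + (sum (map (chainSum (h ∘ (outside ∷_))) cs) + sum (map (chainSum (h ∘ (inside ∷_))) cs))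
      ≡⟨ +-interchange (chainSum (h ∘ (outside ∷_)) c) _ _ _ ⟩
    _ ∎
    where open ≡-Reasoning

-- Optimal weights along a chain

module _ (v : ℕ → ℕ) where

  weight : List ℕ → ℕ
  weight = sum ∘ map v

  weight-take-suc : ∀ k {L b} → All (λ x → v x ≤ b) L → weight (take (suc k) L) ≤ b + weight (take k L)
  weight-take-suc k             []         = z≤n
  weight-take-suc zero          (vx≤b ∷ _) = ℕ.+-monoˡ-≤ 0 vx≤b
  weight-take-suc (suc k) {x ∷ L} {b} (_ ∷ L≤b)  = begin
    v x + weight (take (suc k) L)  ≤⟨ ℕ.+-monoʳ-≤ (v x) (weight-take-suc k L≤b) ⟩
    v x + (b + weight (take k L))  ≡⟨ sym (ℕ.+-assoc (v x) b _) ⟩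
    (v x + b) + weight (take k L)  ≡⟨ cong (_+ weight (take k L)) (ℕ.+-comm (v x) b) ⟩
    (b + v x) + weight (take k L)  ≡⟨ ℕ.+-assoc b (v x) _ ⟩
    b + (v x + weight (take k L))  ∎
    where open ℕ.≤-Reasoning

  support : (ℕ → ℕ) → List ℕ → List ℕ
  support g = filter (λ j → ¬? (g j ℕ.≟ 0))

  -- A zero of `g` spends nothing of the budget `k`, and putting its entry back in front can only
  -- raise the bound because the list is descending. A nonzero value spends one unit and is paid for
  -- by its own entry.
  weight≤largest : ∀ g {L} → AllPairs (λ x y → v y ≤ v x) L → All (λ x → g x ≤ v x) L →
    ∀ k → length (support g L) ≤ k → sum (map g L) ≤ weight (take k L)
  weight≤largest g []           []           k       _ = z≤n
  weight≤largest g {x ∷ L} (x≥ ∷ desc) (gx≤ ∷ g≤) k       len with g x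
  ... | zero = ℕ.≤-trans (weight≤largest g desc g≤ k len) (shift k x≥)
    where
    shift : ∀ k → All (λ y → v y ≤ v x) L → weight (take k L) ≤ weight (take k (x ∷ L))
    shift zero    _  = z≤n
    shift (suc k) x≥ = weight-take-suc k x≥
  weight≤largest g {x ∷ L} (x≥ ∷ desc) (gx≤ ∷ g≤) (suc k) (s≤s len) | suc _ =
    ℕ.+-mono-≤ gx≤ (weight≤largest g desc g≤ k len)

  -- `mass M i` is `v i` once for every occurrence of `i` in `M`. Being a function of the rank
  -- alone, it can be summed along each chain as well as over all subsets, which joins the bounds
  -- for single chains to the global one.
  mass : List ℕ → ℕ → ℕ
  mass []      i = 0
  mass (p ∷ M) i = δ p i * v p + mass M i

  mass-++ : ∀ xs ys i → mass xs i ≤ mass (xs ++ ys) i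
  mass-++ []       ys i = z≤n
  mass-++ (x ∷ xs) ys i = ℕ.+-monoʳ-≤ (δ x i * v x) (mass-++ xs ys i)

  weight≤Σmass : ∀ r l {P} → All (λ x → r ≤ x × x < r + suc l) P → weight P ≤ Σ≤ l (λ t → mass P (r + t))
  weight≤Σmass r l []                      = z≤n
  weight≤Σmass r l {p ∷ P} ((r≤p , p<) ∷ in-range) = begin
    v p + weight P
      ≤⟨ ℕ.+-mono-≤ (ℕ.≤-trans (ℕ.≤-reflexive at-p) (term≤Σ≤ l (λ t → δ p (r + t) * v p) p∸r≤l))
           (weight≤Σmass r l in-range) ⟩
    Σ≤ l (λ t → δ p (r + t) * v p) + Σ≤ l (λ t → mass P (r + t))
      ≡⟨ Σ≤-+ l _ _ ⟨
    Σ≤ l (λ t → mass (p ∷ P) (r + t)) ∎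
    where
    open ℕ.≤-Reasoning
    p∸r≤l : p ∸ r ≤ l
    p∸r≤l = ℕ.m≤n+o⇒m∸n≤o p r (s≤s⁻¹ (subst (p <_) (ℕ.+-suc r l) p<))
    at-p : v p ≡ δ p (r + (p ∸ r)) * v p
    at-p = sym (trans (cong (_* v p) (trans (cong (δ p) (ℕ.m+[n∸m]≡n r≤p)) (δ-refl p))) (ℕ.*-identityˡ (v p)))

  ΣSub-mass : ∀ n M → ΣSub n (mass M ∘ ∣_∣) ≡ sum (map (λ p → (n C p) * v p) M)
  ΣSub-mass n []      = ΣSub-0 n
  ΣSub-mass n (p ∷ M) = trans (ΣSub-+ n (λ S → δ p ∣ S ∣ * v p) _)
    (cong₂ _+_ (ΣSub-size n p (v p)) (ΣSub-mass n M))

insideOut-range : ∀ r m → All (λ x → r ≤ x × x < r + m) (insideOut r m)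
insideOut-range r m = Perm.All-resp-↭ (↭-sym (Perm.↭-reverse _)) (outsideIn-range r m)

module _ (n k : ℕ) (a : Subset n → ℕ) (a≤ : ∀ S → a S ≤ n C ∣ S ∣) where

  private
    onRanks : Chain n → ℕ → ℕ
    onRanks c j = a (at c (j ∸ bottom c))

    ranks : Chain n → List ℕ
    ranks c = insideOut (bottom c) (suc (height c))

  module _ (few : ∀ c → length (support (n C_) (onRanks c) (ranks c)) ≤ k) where

    chainSum≤ : ∀ c → chainSum a c ≤ chainSum (mass (n C_) (middleRanks n k) ∘ ∣_∣) c
    chainSum≤ c = begin
      Σ≤ (height c) (a ∘ at c)
        ≡⟨ Σ≤-cong (height c) (λ {t} _ → cong (a ∘ at c) (sym (ℕ.m+n∸m≡n (bottom c) t))) ⟩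
      Σ≤ (height c) (λ t → onRanks c (bottom c + t))
        ≡⟨ Σ≤-applyUpTo (height c) (onRanks c) (bottom c) ⟩
      sum (map (onRanks c) (applyUpTo (bottom c +_) (suc (height c))))
        ≡⟨ ℕ.sum-↭ (Perm.map⁺ (onRanks c) (↭-trans (Perm.↭-reverse _) (outsideIn-↭ (bottom c) (suc (height c))))) ⟨
      sum (map (onRanks c) (ranks c))
        ≤⟨ weight≤largest (n C_) (onRanks c)
             (allPairs-reverse (outsideIn-sorted n (bottom c) (suc (height c)) centred′))
             (All.map (λ {x} (r≤x , x<) → subst (λ i → onRanks c x ≤ n C i) (size-at r≤x x<) (a≤ (at c (x ∸ bottom c))))
               (insideOut-range (bottom c) (suc (height c))))
             k (few c) ⟩
      weight (n C_) (take k (ranks c))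
        ≤⟨ weight≤Σmass (n C_) (bottom c) (height c) (All.take⁺ k (insideOut-range (bottom c) (suc (height c)))) ⟩
      Σ≤ (height c) (λ t → mass (n C_) (take k (ranks c)) (bottom c + t))
        -- The ranks chosen for this chain are a prefix of the global choice, and a longer list can
        -- only add mass.
        ≤⟨ Σ≤-mono (height c) (λ t → let zs , eq = middleRanks-prefix n k (bottom c) (height c) centred′ in
             ℕ.≤-trans (mass-++ (n C_) (take k (ranks c)) zs (bottom c + t))
               (ℕ.≤-reflexive (cong (λ M → mass (n C_) M (bottom c + t)) (sym eq)))) ⟩
      Σ≤ (height c) (λ t → mass (n C_) (middleRanks n k) (bottom c + t))
        ≡⟨ Σ≤-cong (height c) (λ t≤l → cong (mass (n C_) (middleRanks n k)) (sym (size c t≤l))) ⟩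
      Σ≤ (height c) (λ t → mass (n C_) (middleRanks n k) ∣ at c t ∣) ∎
      where
      open ℕ.≤-Reasoning
      centred′ : bottom c + bottom c + suc (height c) ≡ suc n
      centred′ = trans (ℕ.+-suc (bottom c + bottom c) (height c)) (cong suc (centred c))
      size-at : ∀ {x} → bottom c ≤ x → x < bottom c + suc (height c) → ∣ at c (x ∸ bottom c) ∣ ≡ x
      size-at {x} r≤x x< = trans
        (size c (ℕ.m≤n+o⇒m∸n≤o x (bottom c) (s≤s⁻¹ (subst (x <_) (ℕ.+-suc (bottom c) (height c)) x<))))
        (ℕ.m+[n∸m]≡n r≤x)

    ΣSub≤middle : ΣSub n a ≤ sum (map (rankSize n) (middleRanks n k))
    ΣSub≤middle = begin
      ΣSub n a                                         ≡⟨ symmetricChains-sum n a ⟨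
      sum (map (chainSum a) (symmetricChains n))       ≤⟨ go (symmetricChains n) ⟩
      sum (map (chainSum m) (symmetricChains n))       ≡⟨ symmetricChains-sum n m ⟩
      -- A chosen rank `p` puts mass `n C p` on each of the `n C p` subsets of that size, which is
      -- exactly its rank size.
      ΣSub n m                                         ≡⟨ ΣSub-mass (n C_) n (middleRanks n k) ⟩
      sum (map (rankSize n) (middleRanks n k))         ∎
      where
      open ℕ.≤-Reasoning
      m = mass (n C_) (middleRanks n k) ∘ ∣_∣
      go : ∀ cs → sum (map (chainSum a) cs) ≤ sum (map (chainSum m) cs)
      go []       = z≤n
      go (c ∷ cs) = ℕ.+-mono-≤ (chainSum≤ c) (go cs)

-- Unions of antichains against chains

-- Pigeonhole for labels given only by a relation. One label is chosen per entry, and the last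
-- component of `choose` remembers that it came from an entry of the list, so that a repeated label
-- would identify two distinct entries.
labelled⇒length≤ : ∀ {A : Set} {k} (R : A → Fin k → Set) {J : List A} → AllPairs _≢_ J →
  All (λ j → ∃[ i ] R j i) J → (∀ {j j′ i} → R j i → R j′ i → j ≡ j′) → length J ≤ k
labelled⇒length≤ {A} {k} R J! labels inj =
  let is , is! , len , _ = choose J! labels
  in subst₂ _≤_ len (List.length-tabulate {n = k} id)
       (unique⊆⇒length≤ (setoid (Fin k)) is! (λ {i} _ → Mem.∈-tabulate⁺ (setoid (Fin k)) i))
  where
  choose : ∀ {J} → AllPairs _≢_ J → All (λ j → ∃[ i ] R j i) J →
    ∃[ is ] AllPairs _≢_ is × length is ≡ length J × All (λ i → Any (λ j → R j i) J) is
  choose []          []               = [] , [] , refl , []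
  choose (j∉J ∷ J!) ((i , rji) ∷ labels) =
    let is , is! , len , from = choose J! labels
    in i ∷ is
       , All.map (λ i′∈ i≡i′ → All.All¬⇒¬Any
           (All.map (λ j≢j′ rj′i′ → j≢j′ (inj rji (subst (R _) (sym i≡i′) rj′i′))) j∉J) i′∈) from ∷ is!
       , cong suc len
       , here rji ∷ All.map there from

⊆∧∣∣<⇒⊂ : ∀ {n} {p q : Subset n} → p ⊆ q → ∣ p ∣ < ∣ q ∣ → p ⊂ q
⊆∧∣∣<⇒⊂ {p = p} {q} p⊆q p<q
  with Fin.any? (λ x → (x Sub.∈? q) ×-dec ¬? (x Sub.∈? p))
... | yes (x , x∈q , x∉p) = p⊆q , x , x∈q , x∉p
... | no  none = contradiction (Sub.p⊆q⇒∣p∣≤∣q∣ q⊆p) (ℕ.<⇒≱ p<q)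
  where
  q⊆p : q ⊆ p
  q⊆p {x} x∈q with x Sub.∈? p
  ... | yes x∈p = x∈p
  ... | no  x∉p = contradiction (x , x∈q , x∉p) none

module _ (n k : ℕ) (xs : List (Pᴮ n)) where
  open Pᴮ
  private
    P = RankedPoset.Eq.setoid (Pᴮ-ranked n)
    des : Pᴮ n → Subset n
    des b = Des (perm b)

  fibre-size : Unique.Unique P xs → ∀ S → length (fibre des xs S) ≤ n C ∣ S ∣
  fibre-size xs! S = subst₂ _≤_
    (List.length-map values (fibre des xs S))
    (trans (List.length-map proj₁ (sized n ∣ S ∣)) (length-sized n ∣ S ∣))
    (unique⊆⇒length≤ (setoid (Subset n)) values! λ v∈ →
      case Mem.∈-map⁻ (setoid (Pᴮ n)) (setoid (Subset n)) v∈ of λ where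
        (b , b∈ , refl) →
          let _ , des≡ = Mem.∈-filter⁻ (setoid (Pᴮ n)) (λ x → des x ≟ᵇ S) (λ { refl → id }) {xs = xs} b∈
          in Mem.∈-map⁺ (sized-setoid n ∣ S ∣) (setoid (Subset n)) id {v = values b , card b des≡}
               (∈-sized n ∣ S ∣ (values b , card b des≡)))
    where
    values : Pᴮ n → Subset n
    values b = barredValues (perm b)
    card : ∀ b → des b ≡ S → ∣ values b ∣ ≡ ∣ S ∣
    card b des≡ = trans (sym (∣barredPositions∣≡∣barredValues∣ (perm b))) (cong ∣_∣ (trans (sym (Des-barred b)) des≡))
    values! : AllPairs _≢_ (map values (fibre des xs S))
    values! = AllPairs.map⁺ (go (All.all-filter (λ x → des x ≟ᵇ S) xs) (AllPairs.filter⁺ (λ x → des x ≟ᵇ S) xs!))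
      where
      go : ∀ {bs} → All (λ b → des b ≡ S) bs → AllPairs (λ b b′ → ¬ word (perm b) ≡ word (perm b′)) bs →
           AllPairs (λ b b′ → values b ≢ values b′) bs
      go []           []             = []
      go {b ∷ _} (b∈ ∷ bs∈) (b≉ ∷ bs!) =
        All.zipWith (λ {b′} (b′∈ , b≉b′) v≡ → b≉b′ (Pᴮ-unique b b′ (trans b∈ (sym b′∈)) v≡)) (bs∈ , b≉) ∷ go bs∈ bs!

  module _ (A : Fin k → Pred (Pᴮ n) 0ℓ) (antichain : ∀ i → IsAntichain (Pᴮ-ranked n) (A i))
           (covered : ∀ {x} → Membership._∈_ P x xs → ∃[ i ] A i x) where

    -- Words over two different members of the chain are comparable, so each antichain meets at most
    -- one fibre along it. The number of an antichain therefore labels the occupied ranks without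
    -- repetition.
    chain-support : ∀ (c : Chain n) → length (support (n C_)
      (λ j → length (fibre des xs (at c (j ∸ bottom c)))) (insideOut (bottom c) (suc (height c)))) ≤ k
    chain-support c = labelled⇒length≤ R
      (AllPairs.filter⁺ _ (AllPairs.map (λ x≢y y≡x → x≢y (sym y≡x))
        (allPairs-reverse (outsideIn-unique (bottom c) (suc (height c))))))
      (All.zipWith label (All.all-filter _ (insideOut (bottom c) (suc (height c)))
                         , All.filter⁺ _ (insideOut-range (bottom c) (suc (height c)))))
      shared
      where
      R : ℕ → Fin k → Set
      R j i = (bottom c ≤ j × j < bottom c + suc (height c)) × ∃[ b ] des b ≡ at c (j ∸ bottom c) × A i b
      within : ∀ {j} → bottom c ≤ j → j < bottom c + suc (height c) → j ∸ bottom c ≤ height c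
      within {j} _ j< = ℕ.m≤n+o⇒m∸n≤o j (bottom c) (s≤s⁻¹ (subst (j <_) (ℕ.+-suc (bottom c) (height c)) j<))
      label : ∀ {j} → length (fibre des xs (at c (j ∸ bottom c))) ≢ 0 × (bottom c ≤ j × j < bottom c + suc (height c)) →
              ∃[ i ] R j i
      label {j} (nonempty , range)
        with fibre des xs (at c (j ∸ bottom c)) in eq
      ... | []    = contradiction refl nonempty
      ... | b ∷ _ =
        let b∈ , des≡ = Mem.∈-filter⁻ (setoid (Pᴮ n)) (λ x → des x ≟ᵇ at c (j ∸ bottom c))
                         (λ { refl → id }) {v = b} {xs = xs}
                         (subst (Membership._∈_ (setoid (Pᴮ n)) b) (sym eq) (here refl))
            i , aib = covered (Any.map (λ { refl → refl }) b∈)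
        in i , range , b , des≡ , aib
      comparable : ∀ {j j′ i} → R j i → R j′ i → ¬ (j < j′)
      comparable {j} {j′} {i} ((r≤j , j<) , b , b≡ , aib) ((r≤j′ , j′<) , b′ , b′≡ , aib′) j<j′ =
        antichain i b b′ aib aib′ (inj₁ b⊂b′ , λ eq → Sub.⊂-irref (cong descents eq) b⊂b′)
        where
        b⊂b′ : des b ⊂ des b′
        b⊂b′ = subst₂ _⊂_ (sym b≡) (sym b′≡) (⊆∧∣∣<⇒⊂
          (nested c (ℕ.∸-monoˡ-≤ (bottom c) (ℕ.<⇒≤ j<j′)) (within r≤j′ j′<))
          (subst₂ _<_ (sym (trans (size c (within r≤j j<)) (ℕ.m+[n∸m]≡n r≤j)))
                      (sym (trans (size c (within r≤j′ j′<)) (ℕ.m+[n∸m]≡n r≤j′))) j<j′))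
      shared : ∀ {j j′ i} → R j i → R j′ i → j ≡ j′
      shared {j} {j′} p q with ℕ.<-cmp j j′
      ... | tri< lt _ _ = contradiction lt (comparable p q)
      ... | tri≈ _ eq _ = eq
      ... | tri> _ _ gt = contradiction gt (comparable q p)

    length≤middle : Unique.Unique P xs → length xs ≤ sum (map (rankSize n) (middleRanks n k))
    length≤middle xs! = subst (_≤ sum (map (rankSize n) (middleRanks n k))) (Σ-fibres des xs)
      (ΣSub≤middle n k (length ∘ fibre des xs) (fibre-size xs!) chain-support)

Pᴮ-stronglySperner : ∀ n → StronglySperner (Pᴮ-ranked n)
Pᴮ-stronglySperner n = rankSize n , Pᴮ-rankSizes n , λ k _ →
  subst (UnionOfAntichainsOfSize (Pᴮ-ranked n) k) (sym (sumOfLargest-rankSizes n k))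
    (levels-union (Pᴮ-ranked n) (λ {x} {y} → Pᴮ-≺⇒< n {x} {y}) (Pᴮ-rankSizes n) (middleRanks-unique n k) k
      (ℕ.≤-trans (ℕ.≤-reflexive (List.length-take k (insideOut 0 (suc n)))) (ℕ.m⊓n≤m k _)))
  , λ c′ (A , antichain , xs , xs! , ∈xs⇔ , len) →
      subst₂ _≤_ len (sym (sumOfLargest-rankSizes n k))
        (length≤middle n k xs A antichain (λ {x} → Equivalence.to (∈xs⇔ x)) xs!)

-- Noncrossing partitions unrolled to the line

module _ {P : Pred ℕ 0ℓ} (P? : ∀ x → Dec (P x)) where

  least : ∀ d lo → P (lo + d) →
          ∃[ y ] lo ≤ y × y ≤ lo + d × P y × (∀ z → lo ≤ z → z < y → ¬ P z)
  least zero    lo p = lo , ℕ.≤-refl , ℕ.m≤m+n lo 0 , subst P (ℕ.+-identityʳ lo) p ,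
    λ z lo≤z z<lo _ → ℕ.<⇒≱ z<lo lo≤z
  least (suc d) lo p with P? lo
  ... | yes plo = lo , ℕ.≤-refl , ℕ.m≤m+n lo _ , plo , λ z lo≤z z<lo _ → ℕ.<⇒≱ z<lo lo≤z
  ... | no ¬plo =
    let y , lo<y , y≤ , py , min = least d (suc lo) (subst P (ℕ.+-suc lo d) p)
    in y , ℕ.<⇒≤ lo<y , subst (y ≤_) (sym (ℕ.+-suc lo d)) y≤ , py , λ z lo≤z z<y pz →
         case ℕ.m≤n⇒m<n∨m≡n lo≤z of λ where
           (inj₁ lo<z) → min z lo<z z<y pz
           (inj₂ refl) → ¬plo pz

  greatest : ∀ d y → P y → ∃[ m ] y ≤ m × m ≤ y + d × P m × (∀ z → m < z → z ≤ y + d → ¬ P z)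
  greatest zero    y p = y , ℕ.≤-refl , ℕ.m≤m+n y 0 , p , λ z y<z z≤ _ →
    ℕ.<⇒≱ y<z (subst (z ≤_) (ℕ.+-identityʳ y) z≤)
  greatest (suc d) y p with P? (y + suc d)
  ... | yes p′ = y + suc d , ℕ.m≤m+n y _ , ℕ.≤-refl , p′ , λ z <z z≤ _ → ℕ.<⇒≱ <z z≤
  ... | no ¬p′ =
    let m , y≤m , m≤ , pm , max = greatest d y p
    in m , y≤m , ℕ.≤-trans m≤ (ℕ.+-monoʳ-≤ y (ℕ.n≤1+n d)) , pm , λ z m<z z≤ pz →
         case ℕ.m≤n⇒m<n∨m≡n z≤ of λ where
           (inj₁ z<) → max z m<z (s≤s⁻¹ (subst (z <_) (ℕ.+-suc y d) z<)) pz
           (inj₂ refl) → ¬p′ pz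

-- A type-B noncrossing partition of the circle, unrolled to the line: point x
-- of the line lies over point x mod 2n, so that bar becomes x ↦ x + n.
record Unrolled (n : ℕ) : Set₁ where
  infix 4 _~_ _~?_
  field
    _~_      : ℕ → ℕ → Set
    _~?_     : ∀ x y → Dec (x ~ y)
    ~-refl   : ∀ {x} → x ~ x
    ~-sym    : ∀ {x y} → x ~ y → y ~ x
    ~-trans  : ∀ {x y z} → x ~ y → y ~ z → x ~ z
    shift    : ∀ {x y} → x ~ y → x + n ~ y + n
    period   : ∀ {x} → x ~ x + n + n
    zeroes   : ∀ {x y} → x ~ x + n → y ~ y + n → x ~ y
    uncross  : ∀ {x y z w} → x < y → y < z → z < w → w < x + n + n → x ~ z → y ~ w → x ~ y

  unshift : ∀ {x y} → x + n ~ y + n → x ~ y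
  unshift x~y = ~-trans period (~-trans (shift x~y) (~-sym period))

  -- `HasPrev` looks back from `x + n` so that positions stay natural numbers. The interval for
  -- `HasNext` includes `x + n`, and that for `HasPrev` includes `x`: a point equivalent to its
  -- opposite always has both.
  HasNext HasPrev : ℕ → Set
  HasNext x = ∃[ y ] x < y × y ≤ x + n × x ~ y
  HasPrev x = ∃[ y ] x ≤ y × y < x + n × y ~ x + n

  hasNext? : ∀ x → Dec (HasNext x)
  hasNext? x = map′ (λ (y , _ , p) → y , p) (λ (y , x<y , y≤ , p) → y , s≤s y≤ , x<y , y≤ , p)
    (ℕ.anyUpTo? (λ y → (x ℕ.<? y) ×-dec (y ℕ.≤? x + n) ×-dec (x ~? y)) (suc (x + n)))

  hasPrev? : ∀ x → Dec (HasPrev x)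
  hasPrev? x = map′ (λ (y , _ , p) → y , p) (λ (y , x≤y , y< , p) → y , y< , x≤y , y< , p)
    (ℕ.anyUpTo? (λ y → (x ℕ.≤? y) ×-dec (y ℕ.<? x + n) ×-dec (y ~? x + n)) (x + n))

  split-n : ∀ {x} → n ≤ x → ∃[ x′ ] x ≡ x′ + n
  split-n {x} n≤x = x ∸ n , sym (ℕ.m∸n+n≡m n≤x)

  hasNext-shift : ∀ {x} → HasNext x → HasNext (x + n)
  hasNext-shift (y , x<y , y≤ , x~y) = y + n , ℕ.+-monoˡ-< n x<y , ℕ.+-monoˡ-≤ n y≤ , shift x~y

  hasPrev-shift : ∀ {x} → HasPrev x → HasPrev (x + n)
  hasPrev-shift (y , x≤y , y< , y~x) = y + n , ℕ.+-monoˡ-≤ n x≤y , ℕ.+-monoˡ-< n y< , shift y~x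

  hasNext-unshift : ∀ {x} → HasNext (x + n) → HasNext x
  hasNext-unshift {x} (y , x<y , y≤ , x~y) with split-n (ℕ.≤-trans (ℕ.m≤n+m n x) (ℕ.<⇒≤ x<y))
  ... | y′ , refl = y′ , ℕ.+-cancelʳ-< n x y′ x<y , ℕ.+-cancelʳ-≤ n y′ (x + n) y≤ , unshift x~y

  hasPrev-unshift : ∀ {x} → HasPrev (x + n) → HasPrev x
  hasPrev-unshift {x} (y , x≤y , y< , y~x) with split-n (ℕ.≤-trans (ℕ.m≤n+m n x) x≤y)
  ... | y′ , refl = y′ , ℕ.+-cancelʳ-≤ n x y′ x≤y , ℕ.+-cancelʳ-< n y′ (x + n) y< , unshift y~x

  -- Take the last element `y` of the block before `x + n`. A next element beyond `x + n` would lie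
  -- opposite to some `z′` after `x` and not after `y`; then the block and its bar would meet or
  -- cross, and so coincide, making the block invariant.
  last-exists : 1 ≤ n → ∀ x → ¬ (x ~ x + n) → ∃[ y ] x ~ y × ¬ HasNext y
  last-exists (s≤s {n = n′} z≤n) x nonzero
    with y , x≤y , y≤ , x~y , max ← greatest (x ~?_) n′ x ~-refl = y , x~y , none
    where
    y<x+n : y < x + n
    y<x+n = subst (suc y ≤_) (sym (ℕ.+-suc x n′)) (s≤s y≤)
    none : ¬ HasNext y
    none (z , y<z , z≤ , y~z) with ℕ.<-cmp z (x + n)
    ... | tri< z< _ _   = max z y<z (s≤s⁻¹ (subst (z <_) (ℕ.+-suc x n′) z<)) (~-trans x~y y~z)
    ... | tri≈ _ refl _ = nonzero (~-trans x~y y~z)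
    ... | tri> _ _ x+n<z with split-n (ℕ.≤-trans (ℕ.m≤n+m n x) (ℕ.<⇒≤ x+n<z))
    ...   | z′ , refl = nonzero (~-trans x~z′ z′~x+n)
      where
      z′~x+n : z′ ~ x + n
      z′~x+n = unshift (~-trans (~-sym (~-trans x~y y~z)) period)
      z′≤y : z′ ≤ y
      z′≤y = ℕ.+-cancelʳ-≤ n z′ y z≤
      x~z′ : x ~ z′
      x~z′ with ℕ.m≤n⇒m<n∨m≡n z′≤y
      ... | inj₂ refl = x~y
      ... | inj₁ z′<y = uncross (ℕ.+-cancelʳ-< n x z′ x+n<z) z′<y y<x+n
        (ℕ.m<m+n (x + n) z<s) x~y z′~x+n

  -- After a last element the block pauses for more than half a turn, so the element that ends the
  -- pause has no predecessor within half a turn. It appears as `y + n`, the place from which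
  -- `HasPrev` looks back.
  first-exists : 1 ≤ n → ∀ x → ¬ (x ~ x + n) → ∃[ y ] x ~ y + n × ¬ HasPrev y
  first-exists 1≤n x nonzero
    with y , x~y , none ← last-exists 1≤n x nonzero
    with n′ , n≡ ← (n ∸ 1 , sym (ℕ.m+[n∸m]≡n 1≤n))
    -- The search stops at the latest at `y + n + n`, the copy of `y` one turn later.
    with z , y<z , z≤ , y~z , min ← least (y ~?_) (n′ + n) (suc y)
      (subst (y ~_) (trans (ℕ.+-assoc y n n) (trans (cong (λ m → y + (m + n)) n≡) (ℕ.+-suc y (n′ + n)))) period)
    with z ℕ.≤? y + n
  ... | yes z≤y+n = contradiction (z , y<z , z≤y+n , y~z) none
  ... | no  z≰y+n with split-n (ℕ.≤-trans (ℕ.m≤n+m n y) (ℕ.<⇒≤ (ℕ.≰⇒> z≰y+n)))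
  ...   | z′ , refl = z′ , ~-trans x~y y~z , λ (w , z′≤w , w< , w~z) →
    min w (ℕ.≤-trans (ℕ.+-cancelʳ-< n y z′ (ℕ.≰⇒> z≰y+n)) z′≤w) w< (~-trans y~z (~-sym w~z))

  -- Among `0, …, n − 1` and the opposite points, one of the two always follows the other at
  -- distance at most `n`, and would be a next element of it.
  last-unique : ∀ {i j} → i < n → j < n → ¬ HasNext i → ¬ HasNext j → i ~ j ⊎ i ~ j + n → i ≡ j
  last-unique {i} {j} i<n j<n i-last j-last (inj₁ i~j) with ℕ.<-cmp i j
  ... | tri< i<j _ _ = contradiction (j , i<j , ℕ.≤-trans (ℕ.<⇒≤ j<n) (ℕ.m≤n+m n i) , i~j) i-last
  ... | tri≈ _ i≡j _ = i≡j
  ... | tri> _ _ j<i = contradiction (i , j<i , ℕ.≤-trans (ℕ.<⇒≤ i<n) (ℕ.m≤n+m n j) , ~-sym i~j) j-last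
  last-unique {i} {j} i<n j<n i-last j-last (inj₂ i~j+n) with j ℕ.≤? i
  ... | yes j≤i = contradiction (j + n , ℕ.<-≤-trans i<n (ℕ.m≤n+m n j) , ℕ.+-monoˡ-≤ n j≤i , i~j+n) i-last
  ... | no  j≰i = contradiction (i + n , ℕ.<-≤-trans j<n (ℕ.m≤n+m n i) , ℕ.+-monoˡ-≤ n (ℕ.<⇒≤ (ℕ.≰⇒> j≰i))
                               , ~-trans period (~-sym (shift i~j+n))) j-last

  first-unique : ∀ {i j} → i < n → j < n → ¬ HasPrev i → ¬ HasPrev j → i ~ j ⊎ i ~ j + n → i ≡ j
  first-unique {i} {j} i<n j<n i-first j-first (inj₁ i~j) with ℕ.<-cmp i j
  ... | tri< i<j _ _ = contradiction (i + n , ℕ.≤-trans (ℕ.<⇒≤ j<n) (ℕ.m≤n+m n i) , ℕ.+-monoˡ-< n i<j , shift i~j) j-first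
  ... | tri≈ _ i≡j _ = i≡j
  ... | tri> _ _ j<i = contradiction (j + n , ℕ.≤-trans (ℕ.<⇒≤ i<n) (ℕ.m≤n+m n j) , ℕ.+-monoˡ-< n j<i , shift (~-sym i~j)) i-first
  first-unique {i} {j} i<n j<n i-first j-first (inj₂ i~j+n) with j ℕ.≤? i
  ... | yes j≤i = contradiction (i , j≤i , ℕ.<-≤-trans i<n (ℕ.m≤n+m n j) , i~j+n) j-first
  ... | no  j≰i = contradiction (j , ℕ.<⇒≤ (ℕ.≰⇒> j≰i) , ℕ.<-≤-trans j<n (ℕ.m≤n+m n i)
                               , ~-trans period (~-sym (shift i~j+n))) i-first

  reduce : 1 ≤ n → ∀ x → ∃[ i ] i < n × (x ~ i ⊎ x ~ i + n)
           × (HasNext i → HasNext x) × (HasPrev i → HasPrev x)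
  reduce 1≤n x = go x (<-wellFounded x)
    where
    go : ∀ x → Acc _<_ x → ∃[ i ] i < n × (x ~ i ⊎ x ~ i + n)
         × (HasNext i → HasNext x) × (HasPrev i → HasPrev x)
    go x (acc rs) with x ℕ.<? n
    ... | yes x<n = x , x<n , inj₁ ~-refl , id , id
    ... | no  x≮n with split-n (ℕ.≮⇒≥ x≮n)
    ...   | x′ , refl =
      let i , i<n , rel , next , prev = go x′ (rs (ℕ.m<m+n x′ 1≤n))
      in i , i<n , [ inj₂ ∘ shift , (λ r → inj₁ (~-trans (shift r) (~-sym period))) ]′ rel
         , hasNext-shift ∘ next , hasPrev-shift ∘ prev

module _ {n : ℕ} (1≤n : 1 ≤ n) where

  extend-shift : ∀ {P Q : Pred ℕ 0ℓ} → (∀ {x} → P (x + n) → P x) → (∀ {x} → Q x → Q (x + n)) →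
                 (∀ {i} → i < n → P i → Q i) → ∀ {x} → P x → Q x
  extend-shift {P} {Q} unshiftᴾ shiftᑫ base {x} = go x (<-wellFounded x)
    where
    go : ∀ x → Acc _<_ x → P x → Q x
    go x (acc rs) px with x ℕ.<? n
    ... | yes x<n = base x<n px
    ... | no  x≮n with x ∸ n | ℕ.m∸n+n≡m (ℕ.≮⇒≥ x≮n)
    ...   | x′ | refl = shiftᑫ (go x′ (rs (ℕ.m<m+n x′ 1≤n)) (unshiftᴾ px))

-- Recovering a partition from its opening and closing points

module _ {n : ℕ} (1≤n : 1 ≤ n) (𝓤 𝓥 : Unrolled n) where
  open Unrolled 𝓤
  private
    module V = Unrolled 𝓥
    open V using () renaming (_~_ to _≃_)

  module _ (next⇒ : ∀ {x} → HasNext x → V.HasNext x) (next⇐ : ∀ {x} → V.HasNext x → HasNext x)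
           (prev⇒ : ∀ {x} → HasPrev x → V.HasPrev x) (prev⇐ : ∀ {x} → V.HasPrev x → HasPrev x) where

    private
      -- The next element after a and the previous element before b in the
      -- other partition; if they are not b and a themselves, then one of them
      -- starts or ends a block nested strictly between a and b.
      arc : ∀ d a b → a < b → b ≤ a + n → b ≤ a + d → a ~ b → a ≃ b
      arc zero a b a<b _ b≤ _ = contradiction (subst (b ≤_) (ℕ.+-identityʳ a) b≤) (ℕ.<⇒≱ a<b)
      arc (suc d) a b a<b b≤a+n b≤ a~b
        -- An element of the block between the ends splits the arc into two shorter ones, so `a` and
        -- `b` may be taken consecutive in it.
        with ℕ.anyUpTo? (λ c → (a ℕ.<? c) ×-dec (a ~? c)) b
      ... | yes (c , c<b , a<c , a~c) = V.~-trans
        (arc d a c a<c (ℕ.≤-trans (ℕ.<⇒≤ c<b) b≤a+n) (s≤s⁻¹ (ℕ.≤-trans c<b (subst (b ≤_) (ℕ.+-suc a d) b≤))) a~c)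
        (arc d c b c<b (ℕ.≤-trans b≤a+n (ℕ.+-monoˡ-≤ n (ℕ.<⇒≤ a<c)))
          (ℕ.≤-trans (subst (b ≤_) (ℕ.+-suc a d) b≤) (ℕ.+-monoˡ-≤ d a<c)) (~-trans (~-sym a~c) a~b))
      ... | no consecutive = next-case
        where
        inner : ∀ {c e} → a ≤ c → c < e → e ≤ b → (a < c ⊎ e < b) → c ~ e → c ≃ e
        inner {c} {e} a≤c c<e e≤b strict = arc d c e c<e
          (ℕ.≤-trans e≤b (ℕ.≤-trans b≤a+n (ℕ.+-monoˡ-≤ n a≤c))) (smaller strict)
          where
          smaller : a < c ⊎ e < b → e ≤ c + d
          smaller (inj₁ a<c) = ℕ.≤-trans e≤b (ℕ.≤-trans (subst (b ≤_) (ℕ.+-suc a d) b≤) (ℕ.+-monoˡ-≤ d a<c))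
          smaller (inj₂ e<b) = ℕ.≤-trans (s≤s⁻¹ (ℕ.≤-trans e<b (subst (b ≤_) (ℕ.+-suc a d) b≤))) (ℕ.+-monoˡ-≤ d a≤c)

        not-between : ∀ {c} → a < c → c < b → ¬ (a ~ c)
        not-between a<c c<b a~c = consecutive (_ , c<b , a<c , a~c)

        minimalNext : ∃[ b′ ] a < b′ × b′ ≤ a + n × a ≃ b′ × (∀ c → a < c → c < b′ → ¬ (a ≃ c))
        minimalNext with b₀ , a<b₀ , b₀≤ , a≃b₀ ← next⇒ (b , a<b , b≤a+n , a~b) =
          let b′ , a<b′ , b′≤ , a≃b′ , min = least (a V.~?_) (b₀ ∸ suc a) (suc a)
                (subst (a ≃_) (sym (ℕ.m+[n∸m]≡n a<b₀)) a≃b₀)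
          in b′ , a<b′ , ℕ.≤-trans (subst (b′ ≤_) (ℕ.m+[n∸m]≡n a<b₀) b′≤) b₀≤ , a≃b′ , min

        maximalPrev : ∃[ a′ ] b ≤ a′ × a′ < b + n × a′ ≃ b + n × (∀ c → a′ < c → c < b + n → ¬ (c ≃ b + n))
        maximalPrev with a₀ , b≤a₀ , a₀< , a₀≃ ← prev⇒ (a + n , b≤a+n , ℕ.+-monoˡ-< n a<b , shift a~b)
          with a′ , a₀≤a′ , a′≤ , a′≃ , max ← greatest (V._~? b + n) (b + n ∸ suc a₀) a₀ a₀≃ =
          a′ , ℕ.≤-trans b≤a₀ a₀≤a′ , subst (a′ <_) top (s≤s a′≤) , a′≃
          , λ c a′<c c< → max c a′<c (s≤s⁻¹ (subst (c <_) (sym top) c<))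
          where
          top : suc a₀ + (b + n ∸ suc a₀) ≡ b + n
          top = ℕ.m+[n∸m]≡n a₀<

        prev-case : ∀ {b′} → b < b′ → b′ ≤ a + n → a ≃ b′ → a ≃ b
        prev-case {b′} b<b′ b′≤a+n a≃b′ with a′ , b≤a′ , a′<b+n , a′≃b+n , max ← maximalPrev with ℕ.<-cmp a′ (a + n)
        ... | tri≈ _ refl _ = V.unshift a′≃b+n
        -- The arcs from `a′` to `b + n` and from `a + n` to `b′ + n` cross, so `𝓥` joins them.
        ... | tri< a′<a+n _ _ = V.unshift (V.~-trans
          (V.~-sym (V.uncross a′<a+n (ℕ.+-monoˡ-< n a<b) (ℕ.+-monoˡ-< n b<b′)
            (ℕ.≤-<-trans (ℕ.+-monoˡ-≤ n b′≤a+n) (ℕ.+-monoˡ-< n (ℕ.+-monoˡ-< n (ℕ.<-≤-trans a<b b≤a′))))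
            a′≃b+n (V.shift a≃b′))) a′≃b+n)
        ... | tri> _ _ a+n<a′ with split-n (ℕ.≤-trans (ℕ.m≤n+m n a) (ℕ.<⇒≤ a+n<a′))
        -- Now `b` follows `c` in `𝓥`, so `c` has a next element in `𝓤` too. It cannot be `b`, since
        -- `a` and `b` are consecutive, nor lie beyond `b` without crossing their arc. Before `b`,
        -- induction carries it over to `𝓥`, against the maximality of `a′`.
        ...   | c , refl = contradiction (next⇐ (b , c<b , b≤c+n , V.unshift a′≃b+n)) no-next
          where
          a<c : a < c
          a<c = ℕ.+-cancelʳ-< n a c a+n<a′
          c<b : c < b
          c<b = ℕ.+-cancelʳ-< n c b a′<b+n
          b≤c+n : b ≤ c + n
          b≤c+n = ℕ.≤-trans b≤a+n (ℕ.+-monoˡ-≤ n (ℕ.<⇒≤ a<c))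
          no-next : ¬ HasNext c
          no-next (z , c<z , z≤c+n , c~z) with ℕ.<-cmp z b
          ... | tri< z<b _ _ = max (z + n) (ℕ.+-monoˡ-< n c<z) (ℕ.+-monoˡ-< n z<b)
            (V.~-trans (V.shift (V.~-sym (inner (ℕ.<⇒≤ a<c) c<z (ℕ.<⇒≤ z<b) (inj₁ a<c) c~z))) a′≃b+n)
          ... | tri≈ _ refl _ = not-between a<c c<b (~-trans a~b (~-sym c~z))
          ... | tri> _ _ b<z = not-between a<c c<b (uncross a<c c<b b<z
            (ℕ.≤-<-trans z≤c+n (ℕ.+-monoˡ-< n (ℕ.<-≤-trans c<b b≤a+n))) a~b c~z)

        next-case : a ≃ b
        next-case with b′ , a<b′ , b′≤a+n , a≃b′ , min ← minimalNext with ℕ.<-cmp b′ b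
        ... | tri≈ _ refl _ = a≃b′
        ... | tri> _ _ b<b′ = prev-case b<b′ b′≤a+n a≃b′
        -- As `a` precedes `b′` in `𝓥`, something precedes `b′` in `𝓤`. It is not `a`, and before
        -- `a` it would cross the arc to `b`. After `a`, induction carries it over to `𝓥`, against
        -- the minimality of `b′`.
        ... | tri< b′<b _ _ = contradiction
          (prev⇐ (a + n , b′≤a+n , ℕ.+-monoˡ-< n a<b′ , V.shift a≃b′)) no-prev
          where
          no-prev : ¬ HasPrev b′
          no-prev (y , b′≤y , y< , y~b′+n) with ℕ.<-cmp y (a + n)
          ... | tri< y<a+n _ _ = not-between a<b′ b′<b (unshift (~-trans
            (~-sym (uncross y<a+n (ℕ.+-monoˡ-< n a<b′) (ℕ.+-monoˡ-< n b′<b)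
              (ℕ.≤-<-trans (ℕ.+-monoˡ-≤ n b≤a+n) (ℕ.+-monoˡ-< n (ℕ.+-monoˡ-< n (ℕ.<-≤-trans a<b′ b′≤y))))
              y~b′+n (shift a~b))) y~b′+n))
          ... | tri≈ _ refl _ = not-between a<b′ b′<b (unshift y~b′+n)
          ... | tri> _ _ a+n<y with split-n (ℕ.≤-trans (ℕ.m≤n+m n a) (ℕ.<⇒≤ a+n<y))
          ...   | c , refl = min c a<c c<b′
            (V.~-trans a≃b′ (V.~-sym (inner (ℕ.<⇒≤ a<c) c<b′ (ℕ.<⇒≤ b′<b) (inj₁ a<c) (unshift y~b′+n))))
            where
            a<c : a < c
            a<c = ℕ.+-cancelʳ-< n a c a+n<y
            c<b′ : c < b′
            c<b′ = ℕ.+-cancelʳ-< n c b′ y<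

    private
      -- `arc` reaches only half a turn. If `y` is farther from `x` than that, the way on from `y`
      -- to the next copy of `x`, at `x + n + n`, is short enough.
      half : ∀ {x y} → x < y → y < n + n → x ~ y → x ≃ y
      half {x} {y} x<y y< x~y with y ℕ.≤? x + n
      ... | yes y≤x+n = arc n x y x<y y≤x+n y≤x+n x~y
      ... | no  y≰x+n = V.~-trans V.period (V.~-sym (arc n y (x + n + n)
            (ℕ.<-≤-trans y< (subst (n + n ≤_) (sym (ℕ.+-assoc x n n)) (ℕ.m≤n+m (n + n) x))) bound bound
            (~-trans (~-sym x~y) period)))
        where
        bound : x + n + n ≤ y + n
        bound = ℕ.+-monoˡ-≤ n (ℕ.<⇒≤ (ℕ.≰⇒> y≰x+n))

    ends-determine : ∀ {x y} → x < n + n → y < n + n → x ~ y → x ≃ y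
    ends-determine {x} {y} x< y< x~y with ℕ.<-cmp x y
    ... | tri< x<y _ _  = half x<y y< x~y
    ... | tri≈ _ refl _ = V.~-refl
    ... | tri> _ _ y<x  = V.~-sym (half y<x x< (~-sym x~y))

-- Opening and closing points of a partition

module _ (n : ℕ) where

  bar-involutive : ∀ a → bar n (bar n a) ≡ a
  bar-involutive a = trans (cong (join n n ∘ swap) (Fin.splitAt-join n n (swap (splitAt n a))))
    (trans (cong (join n n) (Sum.swap-involutive (splitAt n a))) (Fin.join-splitAt n n a))

  toℕ-bar : ∀ a → (toℕ a < n × toℕ (bar n a) ≡ toℕ a + n) ⊎ toℕ a ≡ toℕ (bar n a) + n
  toℕ-bar a with splitAt n a in eq
  ... | inj₁ i with refl ← Fin.splitAt⁻¹-↑ˡ {m = n} {i = a} eq =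
    inj₁ (subst (_< n) (sym (Fin.toℕ-↑ˡ i n)) (Fin.toℕ<n i)
         , trans (Fin.toℕ-↑ʳ n i) (trans (ℕ.+-comm n (toℕ i)) (cong (_+ n) (sym (Fin.toℕ-↑ˡ i n)))))
  ... | inj₂ i with refl ← Fin.splitAt⁻¹-↑ʳ {m = n} {i = a} eq =
    inj₂ (trans (Fin.toℕ-↑ʳ n i) (trans (ℕ.+-comm n (toℕ i)) (cong (_+ n) (sym (Fin.toℕ-↑ˡ i n)))))

  lookup-barBlock : ∀ β a → lookup (barBlock n β) a ≡ lookup β (bar n a)
  lookup-barBlock β a = Vec.lookup∘tabulate (lookup β ∘ bar n) a

  barBlock-involutive : ∀ β → barBlock n (barBlock n β) ≡ β
  barBlock-involutive β = trans
    (Vec.tabulate-cong λ a → trans (lookup-barBlock β (bar n a)) (cong (lookup β) (bar-involutive a)))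
    (Vec.tabulate∘lookup β)

  samePair-decSetoid : DecSetoid 0ℓ 0ℓ
  samePair-decSetoid = record
    { Carrier = Subset (n + n)
    ; _≈_     = SamePair n
    ; isDecEquivalence = record
      { isEquivalence = record
        { refl  = inj₁ refl
        ; sym   = λ where
            (inj₁ eq)   → inj₁ (sym eq)
            (inj₂ refl) → inj₂ (sym (barBlock-involutive _))
        ; trans = λ where
            (inj₁ refl) q           → q
            (inj₂ refl) (inj₁ refl) → inj₂ refl
            (inj₂ refl) (inj₂ refl) → inj₁ (barBlock-involutive _)
        }
      ; _≟_ = samePair? n
      }
    }

module Circle (m : ℕ) where

  private
    n = suc m

  point : ℕ → Fin (n + n)
  point x = x mod (n + n)

  toℕ-point : ∀ {x} → x < n + n → toℕ (point x) ≡ x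
  toℕ-point x< = trans (Fin.toℕ-fromℕ< _) (ℕ.m<n⇒m%n≡m x<)

  point-toℕ : ∀ a → point (toℕ a) ≡ a
  point-toℕ a = Fin.toℕ-injective (toℕ-point (Fin.toℕ<n a))

  point-period : ∀ x → point (x + n + n) ≡ point x
  point-period x = Fin.toℕ-injective (trans (Fin.toℕ-fromℕ< _)
    (trans (trans (cong (_% (n + n)) (ℕ.+-assoc x n n)) (ℕ.[m+n]%n≡m%n x (n + n))) (sym (Fin.toℕ-fromℕ< _))))

  bar-point : ∀ x → bar n (point x) ≡ point (x + n)
  bar-point x = trans at-residue residue
    where
    y = toℕ (point x)
    at-residue : bar n (point x) ≡ point (y + n)
    at-residue with toℕ-bar n (point x)
    ... | inj₁ (_ , eq) = trans (sym (point-toℕ _)) (cong point eq)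
    ... | inj₂ eq       = sym (trans (cong (λ z → point (z + n)) eq)
      (trans (point-period (toℕ (bar n (point x)))) (point-toℕ (bar n (point x)))))
    residue : point (y + n) ≡ point (x + n)
    residue = Fin.toℕ-injective (trans (Fin.toℕ-fromℕ< (ℕ.m%n<n (y + n) (n + n))) (trans
      (trans (cong (λ z → (z + n) % (n + n)) (Fin.toℕ-fromℕ< (ℕ.m%n<n x (n + n))))
        (trans (ℕ.%-distribˡ-+ (x % (n + n)) n (n + n))
          (trans (cong (λ z → (z + n % (n + n)) % (n + n)) (ℕ.m%n%n≡m%n x (n + n)))
            (sym (ℕ.%-distribˡ-+ x n (n + n))))))
      (sym (Fin.toℕ-fromℕ< (ℕ.m%n<n (x + n) (n + n))))))

  -- Once `x` is reduced below a full turn, the other points wrap around at most once. How many of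
  -- `y`, `z`, `w` have passed `n + n` decides which of the four rotations applies.
  clockwise : ∀ x y z w → x < y → y < z → z < w → w < x + n + n →
              Clockwise n (point x) (point y) (point z) (point w)
  clockwise x = go x (<-wellFounded x)
    where
    N = n + n
    unwrap : ∀ {y} → N ≤ y → ∃[ y′ ] y ≡ y′ + n + n
    unwrap {y} N≤y = y ∸ N , sym (trans (ℕ.+-assoc (y ∸ N) n n) (ℕ.m∸n+n≡m N≤y))
    rewrap : ∀ {y z} → y + n + n < z + n + n → y < z
    rewrap {y} {z} lt = ℕ.+-cancelʳ-< n y z (ℕ.+-cancelʳ-< n (y + n) (z + n) lt)
    small : ∀ {y z} → y + n + n < z + n + n → z < N → y < N
    small lt z<N = ℕ.<-trans (rewrap lt) z<N
    less : ∀ {y z} → y < N → z < N → y < z → point y Fin.< point z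
    less y<N z<N = subst₂ _<_ (sym (toℕ-point y<N)) (sym (toℕ-point z<N))
    less′ : ∀ {y z} → y < N → z < N → y < z → point (y + n + n) Fin.< point z
    less′ {y} y<N z<N y<z = subst (Fin._< _) (sym (point-period y)) (less y<N z<N y<z)
    less″ : ∀ {y z} → y < N → z < N → y < z → point (y + n + n) Fin.< point (z + n + n)
    less″ {y} {z} y<N z<N y<z = subst₂ Fin._<_ (sym (point-period y)) (sym (point-period z)) (less y<N z<N y<z)
    go : ∀ x → Acc _<_ x → ∀ y z w → x < y → y < z → z < w → w < x + n + n →
         Clockwise n (point x) (point y) (point z) (point w)
    go x (acc rs) y z w x<y y<z z<w w<x with x ℕ.<? N
    ... | no x≮N
      with x′ , refl ← unwrap (ℕ.≮⇒≥ x≮N)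
      with y′ , refl ← unwrap (ℕ.≤-trans (ℕ.≮⇒≥ x≮N) (ℕ.<⇒≤ x<y))
      with z′ , refl ← unwrap (ℕ.≤-trans (ℕ.≮⇒≥ x≮N) (ℕ.<⇒≤ (ℕ.<-trans x<y y<z)))
      with w′ , refl ← unwrap (ℕ.≤-trans (ℕ.≮⇒≥ x≮N) (ℕ.<⇒≤ (ℕ.<-trans x<y (ℕ.<-trans y<z z<w))))
      with r ← go x′ (rs (subst (x′ <_) (sym (ℕ.+-assoc x′ n n)) (ℕ.m<m+n x′ z<s)))
                 y′ z′ w′ (rewrap x<y) (rewrap y<z) (rewrap z<w) (rewrap w<x)
      rewrite point-period x′ | point-period y′ | point-period z′ | point-period w′ = r
    ... | yes x<N with w ℕ.<? N
    ...   | yes w<N = let z<N = ℕ.<-trans z<w w<N ; y<N = ℕ.<-trans y<z z<N in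
      inj₁ (less x<N y<N x<y , less y<N z<N y<z , less z<N w<N z<w)
    ...   | no w≮N with w′ , refl ← unwrap (ℕ.≮⇒≥ w≮N) with z ℕ.<? N
    ...     | yes z<N = let y<N = ℕ.<-trans y<z z<N in
      inj₂ (inj₂ (inj₂ (less′ (small w<x x<N) x<N (rewrap w<x) , less x<N y<N x<y , less y<N z<N y<z)))
    ...     | no z≮N with z′ , refl ← unwrap (ℕ.≮⇒≥ z≮N) with y ℕ.<? N
    ...       | yes y<N = let w′<N = small w<x x<N in
      inj₂ (inj₂ (inj₁ (less″ (small z<w w′<N) w′<N (rewrap z<w) , less′ w′<N x<N (rewrap w<x) , less x<N y<N x<y)))
    ...       | no y≮N with y′ , refl ← unwrap (ℕ.≮⇒≥ y≮N) =
      let w′<N = small w<x x<N ; z′<N = small z<w w′<N in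
      inj₂ (inj₁ (less″ (small y<z z′<N) z′<N (rewrap y<z) , less″ z′<N w′<N (rewrap z<w) , less′ w′<N x<N (rewrap w<x)))

  module _ (ν : NCᴮ n) where
    open NCᴮ ν
    open IsTypeB typeB

    block : Fin (n + n) → Subset (n + n)
    block = lookup (blockOf partition)

    block-bar : ∀ a → block (bar n a) ≡ barBlock n (block a)
    block-bar a with c , block-c ← bar-closed (block a) (a , refl) =
      trans (blocks-agree partition (subst (bar n a ∈_) (sym block-c) bar-a∈)) block-c
      where
      bar-a∈ : bar n a ∈ barBlock n (block a)
      bar-a∈ = Vec.lookup⇒[]= (bar n a) _ (trans (lookup-barBlock n (block a) (bar n a))
        (trans (cong (lookup (block a)) (bar-involutive n a)) (Vec.[]=⇒lookup (a∈blockOf[a] partition a))))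

    block-shift : ∀ x → block (point (x + n)) ≡ barBlock n (block (point x))
    block-shift x = trans (cong block (sym (bar-point x))) (block-bar (point x))

    unroll : Unrolled n
    unroll = record
      { _~_     = λ x y → block (point x) ≡ block (point y)
      ; _~?_    = λ x y → _≟ˢ_ n (block (point x)) (block (point y))
      ; ~-refl  = refl
      ; ~-sym   = sym
      ; ~-trans = trans
      ; shift   = λ {x} {y} x~y → trans (block-shift x) (trans (cong (barBlock n) x~y) (sym (block-shift y)))
      ; period  = λ {x} → cong block (sym (point-period x))
      ; zeroes  = λ {x} {y} x~ y~ → zeroBlock-unique _ _ (point x , refl) (point y , refl)
          (sym (trans x~ (block-shift x))) (sym (trans y~ (block-shift y)))
      ; uncross = λ {x} {y} {z} {w} x<y y<z z<w w< x~z y~w →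
          noncrossing _ _ (point x , refl) (point y , refl) (point x) (point y) (point z) (point w)
            (clockwise x y z w x<y y<z z<w w<) (member (point x))
            (subst (point z ∈_) (sym x~z) (member (point z))) (member (point y))
            (subst (point w ∈_) (sym y~w) (member (point w)))
      }
      where
      member : ∀ a → a ∈ block a
      member = a∈blockOf[a] partition

    private
      open module U = Unrolled unroll

    nextSet prevSet : Subset n
    nextSet = setOf {n} (λ i → hasNext? (toℕ i))
    prevSet = setOf {n} (λ i → hasPrev? (toℕ i))

    module _ (E : Subset n) (nonzero : ∀ {i} → i ∈ E → ¬ (toℕ i ~ toℕ i + n))
             (unique : ∀ {i j} → i ∈ E → j ∈ E → toℕ i ~ toℕ j ⊎ toℕ i ~ toℕ j + n → i ≡ j)
             (exists : ∀ x → ¬ (x ~ x + n) → ∃[ i ] i ∈ E × (x ~ toℕ i ⊎ x ~ toℕ i + n)) where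

      private
        S = DecSetoid.setoid (samePair-decSetoid n)
        open Membership S using () renaming (_∈_ to _∈ₛ_)

        NonZeroBlock : Pred (Subset (n + n)) 0ℓ
        NonZeroBlock β = ¬ (barBlock n β ≡ β)

        nonZeroBlock? : ∀ β → Dec (NonZeroBlock β)
        nonZeroBlock? β = ¬? (_≟ˢ_ n (barBlock n β) β)

        nonZeroBlock-resp : ∀ {β γ} → SamePair n β γ → NonZeroBlock β → NonZeroBlock γ
        nonZeroBlock-resp (inj₁ refl) nz     = nz
        nonZeroBlock-resp (inj₂ refl) nz eq = nz (trans (sym eq) (barBlock-involutive n _))

        blocks pairs representatives : List (Subset (n + n))
        blocks          = blockList partition
        pairs           = deduplicate (samePair? n) (filter nonZeroBlock? blocks)
        representatives = map (λ i → block (point (toℕ i))) (elements E)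

        samePair : ∀ {x y} → SamePair n (block (point x)) (block (point y)) → y ~ x ⊎ y ~ x + n
        samePair         (inj₁ eq) = inj₁ eq
        samePair {x} {y} (inj₂ eq) = inj₂ (trans eq (sym (block-shift x)))

        samePair⁻ : ∀ {x y} → y ~ x ⊎ y ~ x + n → SamePair n (block (point x)) (block (point y))
        samePair⁻         (inj₁ y~x) = inj₁ y~x
        samePair⁻ {x} {y} (inj₂ y~x) = inj₂ (trans y~x (block-shift x))

        block∈blocks : ∀ a → block a ∈ₛ blocks
        block∈blocks a = Any.map inj₁′ (VecMem.∈-toList⁺ (VecMem.∈-lookup a (blockOf partition)))
          where
          inj₁′ : ∀ {β} → block a ≡ β → SamePair n (block a) β
          inj₁′ eq = inj₁ (sym eq)

        blocks⇒block : ∀ {β} → β ∈ₛ blocks → ∃[ a ] SamePair n β (block a)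
        blocks⇒block {β} β∈ = go (blockOf partition) β∈
          where
          go : ∀ {k} (v : Vec (Subset (n + n)) k) → β ∈ₛ toList v → ∃[ a ] SamePair n β (lookup v a)
          go (γ ∷ v) (here p)  = zero , p
          go (γ ∷ v) (there p) = let a , q = go v p in suc a , q

        pairs⊆ : ∀ {β} → β ∈ₛ pairs → β ∈ₛ representatives
        pairs⊆ {β} β∈
          with β∈blocks , nz ← Mem.∈-filter⁻ S nonZeroBlock? nonZeroBlock-resp {v = β} {xs = blocks}
                 (Mem.∈-deduplicate⁻ S (samePair? n) (filter nonZeroBlock? blocks) β∈)
          with a , β≈ ← blocks⇒block β∈blocks
          with i , i∈E , rel ← exists (toℕ a) (λ a~bar → nonZeroBlock-resp β≈ nz
                 (subst (λ c → barBlock n (block c) ≡ block c) (point-toℕ a)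
                   (sym (trans a~bar (block-shift (toℕ a)))))) =
          Mem.∈-resp-≈ S
            (Setoid.trans S {block (point (toℕ i))} {block a} {β}
              (subst (λ c → SamePair n (block (point (toℕ i))) (block c)) (point-toℕ a) (samePair⁻ {toℕ i} {toℕ a} rel))
              (Setoid.sym S {β} {block a} β≈))
            (Mem.∈-map⁺ (setoid (Fin n)) S (λ { refl → inj₁ refl }) (∈-elements⁺ i∈E))

        ⊆pairs : ∀ {β} → β ∈ₛ representatives → β ∈ₛ pairs
        ⊆pairs {β} β∈ with i , i∈ , β≈ ← Mem.∈-map⁻ (setoid (Fin n)) S β∈ =
          Mem.∈-resp-≈ S {pairs} {block (point (toℕ i))} {β} (Setoid.sym S {β} β≈)
            (Mem.∈-deduplicate⁺ S (samePair? n)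
              (λ {γ} {β₁} {β₂} p q → Setoid.trans S {γ} {β₁} {β₂} q (Setoid.sym S {β₂} {β₁} p))
              (Mem.∈-filter⁺ S nonZeroBlock? nonZeroBlock-resp (block∈blocks (point (toℕ i)))
                λ eq → nonzero (All.lookup (elements-∈ E) i∈) (trans (sym eq) (sym (block-shift (toℕ i))))))

        representatives-unique : Unique.Unique S representatives
        representatives-unique = AllPairs.map⁺ (go (elements-∈ E) (elements-unique E))
          where
          go : ∀ {is} → All (_∈ E) is → AllPairs _≢_ is →
               AllPairs (λ i j → ¬ SamePair n (block (point (toℕ i))) (block (point (toℕ j)))) is
          go []           []             = []
          go {i ∷ _} (i∈ ∷ is∈) (i≢ ∷ is!) =
            All.zipWith (λ {j} (j∈ , i≢j) p → i≢j (sym (unique j∈ i∈ (samePair {toℕ i} {toℕ j} p)))) (is∈ , i≢) ∷ go is∈ is!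

      -- The hypotheses make `E` a transversal of the pairs of non-zero blocks. Closing points and
      -- opening points are two such transversals, and that is why they are equally many.
      nonzeroPairs-count : nonzeroPairs n (blockList partition) ≡ ∣ E ∣
      nonzeroPairs-count = trans
        (ℕ.≤-antisym
          (unique⊆⇒length≤ S (UniqueDec.deduplicate-! (samePair-decSetoid n) (filter nonZeroBlock? blocks)) (λ {β} → pairs⊆ {β}))
          (unique⊆⇒length≤ S representatives-unique (λ {β} → ⊆pairs {β})))
        (trans (List.length-map _ (elements E)) (length-elements E))

    private
      represent : (P : Pred ℕ 0ℓ) (P? : ∀ x → Dec (P x)) →
        (∀ x → ¬ (x ~ x + n) → ∃[ y ] (x ~ y ⊎ x ~ y + n) × ¬ P y) →
        (∀ x → ∃[ i ] i < n × (x ~ i ⊎ x ~ i + n) × (P i → P x)) →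
        ∀ x → ¬ (x ~ x + n) → ∃[ i ] i ∈ ∁ (setOf {n} (λ i → P? (toℕ i))) × (x ~ toℕ i ⊎ x ~ toℕ i + n)
      represent P P? end red x nz
        with y , x~y , ¬py ← end x nz
        with i , i<n , y~i , pi⇒py ← red y =
        fromℕ< i<n
        , Sub.x∉p⇒x∈∁p (λ i∈ → ¬py (pi⇒py (subst P (Fin.toℕ-fromℕ< i<n) (∈-setOf⁻ (λ i → P? (toℕ i)) i∈))))
        , subst (λ j → x ~ j ⊎ x ~ j + n) (sym (Fin.toℕ-fromℕ< i<n)) (compose {x} {y} {i} x~y y~i)
        where
        compose : ∀ {x y i} → x ~ y ⊎ x ~ y + n → y ~ i ⊎ y ~ i + n → x ~ i ⊎ x ~ i + n
        compose         (inj₁ p) (inj₁ q) = inj₁ (trans p q)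
        compose         (inj₁ p) (inj₂ q) = inj₂ (trans p q)
        compose {x} {y} {i} (inj₂ p) (inj₁ q) = inj₂ (trans p (shift {y} {i} q))
        compose {x} {y} {i} (inj₂ p) (inj₂ q) = inj₁ (trans p (trans (shift {y} {i + n} q) (sym (period {i}))))

    nonzeroPairs-next : nonzeroPairs n (blockList partition) ≡ ∣ ∁ nextSet ∣
    nonzeroPairs-next = nonzeroPairs-count (∁ nextSet)
      (λ {i} i∈ i~ → no-next i∈ (toℕ i + n , ℕ.m<m+n (toℕ i) z<s , ℕ.≤-refl , i~))
      (λ {i} {j} i∈ j∈ rel → Fin.toℕ-injective
        (last-unique (Fin.toℕ<n i) (Fin.toℕ<n j) (no-next i∈) (no-next j∈) rel))
      (represent HasNext hasNext?
        (λ x nz → let y , x~y , none = last-exists (s≤s z≤n) x nz in y , inj₁ x~y , none)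
        (λ x → let i , i<n , rel , next , _ = reduce (s≤s z≤n) x in i , i<n , rel , next))
      where
      no-next : ∀ {i} → i ∈ ∁ nextSet → ¬ HasNext (toℕ i)
      no-next i∈ next = Sub.x∈∁p⇒x∉p i∈ (∈-setOf⁺ (λ i → hasNext? (toℕ i)) next)

    nonzeroPairs-prev : nonzeroPairs n (blockList partition) ≡ ∣ ∁ prevSet ∣
    nonzeroPairs-prev = nonzeroPairs-count (∁ prevSet)
      (λ {i} i∈ i~ → no-prev i∈ (toℕ i , ℕ.≤-refl , ℕ.m<m+n (toℕ i) z<s , i~))
      (λ {i} {j} i∈ j∈ rel → Fin.toℕ-injective
        (first-unique (Fin.toℕ<n i) (Fin.toℕ<n j) (no-prev i∈) (no-prev j∈) rel))
      (represent HasPrev hasPrev?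
        (λ x nz → let y , x~y , none = first-exists (s≤s z≤n) x nz in y , inj₂ x~y , none)
        (λ x → let i , i<n , rel , _ , prev = reduce (s≤s z≤n) x in i , i<n , rel , prev))
      where
      no-prev : ∀ {i} → i ∈ ∁ prevSet → ¬ HasPrev (toℕ i)
      no-prev i∈ prev = Sub.x∈∁p⇒x∉p i∈ (∈-setOf⁺ (λ i → hasPrev? (toℕ i)) prev)

    ∣nextSet∣≡∣prevSet∣ : ∣ nextSet ∣ ≡ ∣ prevSet ∣
    ∣nextSet∣≡∣prevSet∣ = ℕ.∸-cancelˡ-≡ (Sub.∣p∣≤n nextSet) (Sub.∣p∣≤n prevSet)
      (trans (sym (Sub.∣∁p∣≡n∸∣p∣ nextSet))
        (trans (sym nonzeroPairs-next) (trans nonzeroPairs-prev (Sub.∣∁p∣≡n∸∣p∣ prevSet))))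

    rank≡∣prevSet∣ : RankedPoset.rank (NCᴮ-ranked n) ν ≡ ∣ prevSet ∣
    rank≡∣prevSet∣ = trans (cong (n ∸_) (trans nonzeroPairs-prev (Sub.∣∁p∣≡n∸∣p∣ prevSet)))
      (ℕ.m∸[m∸n]≡n (Sub.∣p∣≤n prevSet))

  module _ (ν ν′ : NCᴮ n) where

    private
      module U  = Unrolled (unroll ν)
      module U′ = Unrolled (unroll ν′)

    next-transfer : nextSet ν ⊆ nextSet ν′ → ∀ {x} → U.HasNext x → U′.HasNext x
    next-transfer sub = extend-shift (s≤s z≤n) {U.HasNext} {U′.HasNext} U.hasNext-unshift U′.hasNext-shift
      λ {i} i<n next → subst U′.HasNext (Fin.toℕ-fromℕ< i<n) (∈-setOf⁻ (λ i → U′.hasNext? (toℕ i))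
        (sub (∈-setOf⁺ (λ i → U.hasNext? (toℕ i)) (subst U.HasNext (sym (Fin.toℕ-fromℕ< i<n)) next))))

    prev-transfer : prevSet ν ⊆ prevSet ν′ → ∀ {x} → U.HasPrev x → U′.HasPrev x
    prev-transfer sub = extend-shift (s≤s z≤n) {U.HasPrev} {U′.HasPrev} U.hasPrev-unshift U′.hasPrev-shift
      λ {i} i<n prev → subst U′.HasPrev (Fin.toℕ-fromℕ< i<n) (∈-setOf⁻ (λ i → U′.hasPrev? (toℕ i))
        (sub (∈-setOf⁺ (λ i → U.hasPrev? (toℕ i)) (subst U.HasPrev (sym (Fin.toℕ-fromℕ< i<n)) prev))))

    coarser-ends : (∀ a → block ν a ⊆ block ν′ a) → nextSet ν ⊆ nextSet ν′ × prevSet ν ⊆ prevSet ν′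
    coarser-ends coarser =
      (λ i∈ → let y , x<y , y≤ , x~y = ∈-setOf⁻ (λ i → U.hasNext? (toℕ i)) i∈
              in ∈-setOf⁺ (λ i → U′.hasNext? (toℕ i)) (y , x<y , y≤ , coarsen x~y))
      , (λ i∈ → let y , x≤y , y< , y~x = ∈-setOf⁻ (λ i → U.hasPrev? (toℕ i)) i∈
              in ∈-setOf⁺ (λ i → U′.hasPrev? (toℕ i)) (y , x≤y , y< , coarsen y~x))
      where
      coarsen : ∀ {a b} → block ν a ≡ block ν b → block ν′ a ≡ block ν′ b
      coarsen {a} {b} eq = sym (blocks-agree (NCᴮ.partition ν′)
        (coarser a (subst (b ∈_) (sym eq) (a∈blockOf[a] (NCᴮ.partition ν) b))))

  ends⇒⊆ : ∀ ν ν′ → nextSet ν ≡ nextSet ν′ → prevSet ν ≡ prevSet ν′ → ∀ a → block ν a ⊆ block ν′ a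
  ends⇒⊆ ν ν′ next≡ prev≡ a {b} b∈ = subst (b ∈_) (sym a~b) (a∈blockOf[a] (NCᴮ.partition ν′) b)
    where
    a~b : block ν′ a ≡ block ν′ b
    a~b = subst₂ (λ c d → block ν′ c ≡ block ν′ d) (point-toℕ a) (point-toℕ b)
      (ends-determine (s≤s z≤n) (unroll ν) (unroll ν′)
        (next-transfer ν ν′ (Sub.⊆-reflexive next≡)) (next-transfer ν′ ν (Sub.⊆-reflexive (sym next≡)))
        (prev-transfer ν ν′ (Sub.⊆-reflexive prev≡)) (prev-transfer ν′ ν (Sub.⊆-reflexive (sym prev≡)))
        (Fin.toℕ<n a) (Fin.toℕ<n b)
        (subst₂ (λ c d → block ν c ≡ block ν d) (sym (point-toℕ a)) (sym (point-toℕ b))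
          (sym (blocks-agree (NCᴮ.partition ν) b∈))))

  ends-injective : ∀ ν ν′ → nextSet ν ≡ nextSet ν′ → prevSet ν ≡ prevSet ν′ →
                   NCᴮ.partition ν ≈ₚ NCᴮ.partition ν′
  ends-injective ν ν′ next≡ prev≡ =
    trans (sym (Vec.tabulate∘lookup _)) (trans
      (Vec.tabulate-cong (λ a → Sub.⊆-antisym (ends⇒⊆ ν ν′ next≡ prev≡ a) (ends⇒⊆ ν′ ν (sym next≡) (sym prev≡) a)))
      (Vec.tabulate∘lookup _))

-- Partitions from nesting depths

module _ {m : ℕ} {_~_ : Fin m → Fin m → Set} (_~?_ : ∀ a b → Dec (a ~ b)) (~-refl : ∀ {a} → a ~ a)
         (~-sym : ∀ {a b} → a ~ b → b ~ a) (~-trans : ∀ {a b c} → a ~ b → b ~ c → a ~ c) where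

  private
    classOf : Fin m → Subset m
    classOf a = setOf (λ b → a ~? b)

    lookup-class : ∀ a → lookup (tabulate classOf) a ≡ classOf a
    lookup-class = Vec.lookup∘tabulate classOf

    class⁺ : ∀ {a b} → a ~ b → b ∈ lookup (tabulate classOf) a
    class⁺ {a} {b} a~b = subst (b ∈_) (sym (lookup-class a)) (∈-setOf⁺ (λ b → a ~? b) a~b)

    class⁻ : ∀ {a b} → b ∈ lookup (tabulate classOf) a → a ~ b
    class⁻ {a} {b} b∈ = ∈-setOf⁻ (λ b → a ~? b) (subst (b ∈_) (lookup-class a) b∈)

  classes : SetPartition m
  classes = record
    { blockOf      = tabulate classOf
    ; a∈blockOf[a] = λ a → class⁺ ~-refl
    ; blocks-agree = λ b∈ → Sub.⊆-antisym (λ c∈ → class⁺ (~-trans (class⁻ b∈) (class⁻ c∈)))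
                                          (λ c∈ → class⁺ (~-trans (~-sym (class⁻ b∈)) (class⁻ c∈)))
    }

  ∈-classes⁺ : ∀ {a b} → a ~ b → b ∈ lookup (blockOf classes) a
  ∈-classes⁺ = class⁺

  ∈-classes⁻ : ∀ {a b} → b ∈ lookup (blockOf classes) a → a ~ b
  ∈-classes⁻ = class⁻

-- The nesting depth along the line: e x is the number of arcs covering the gap
-- before x, up to an additive constant, and d x the one at x itself.
record Profile (n : ℕ) : Set where
  field
    e d       : ℕ → ℤ
    e-period  : ∀ x → e (x + n) ≡ e x
    d-period  : ∀ x → d (x + n) ≡ d x
    e≤d       : ∀ x → e x ℤ.≤ d x
    e-suc≤d   : ∀ x → e (suc x) ℤ.≤ d x
    -- Over the integers this and the next field say that a point exceeds either adjacent gap by at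
    -- most one, in the form in which the scans for neighbours use it.
    d-drop    : ∀ {h} x → h ℤ.< d x → h ℤ.≤ e x
    d-drop-suc : ∀ {h} x → h ℤ.< d x → h ℤ.≤ e (suc x)

side : ℕ → ℕ → Bool
side x g = does (x ℕ.<? g)

side-true : ∀ {x g} → x < g → side x g ≡ true
side-true {x} {g} = dec-true (x ℕ.<? g)

side-false : ∀ {x g} → g ≤ x → side x g ≡ false
side-false {x} {g} g≤x = dec-false (x ℕ.<? g) (ℕ.≤⇒≯ g≤x)

side-true⁻ : ∀ {x g} → side x g ≡ true → x < g
side-true⁻ {x} {g} eq with x ℕ.<? g
... | yes x<g = x<g
... | no  x≮g = contradiction (trans (sym eq) (side-false (ℕ.≮⇒≥ x≮g))) λ ()

side-+ : ∀ x g n → side (x + n) (g + n) ≡ side x g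
side-+ x g n with x ℕ.<? g
... | yes x<g = trans (side-true (ℕ.+-monoˡ-< n x<g)) (sym (side-true x<g))
... | no  x≮g = trans (side-false (ℕ.+-monoˡ-≤ n (ℕ.≮⇒≥ x≮g))) (sym (side-false (ℕ.≮⇒≥ x≮g)))

-- Whether the chord between the gaps g and g′ leaves x on its inner side.
inner : ℕ → ℕ → ℕ → Bool
inner x g g′ = side x g xor side x g′

module FromProfile {m : ℕ} (prof : Profile (suc m)) where
  open Profile prof
  private
    n = suc m

  Low : ℕ → ℕ → Set
  Low x g = e g ℤ.< d x

  -- Two points of equal depth are in the same block unless a chord between two
  -- lower gaps separates them.
  infix 4 _≃_
  _≃_ : ℕ → ℕ → Set
  x ≃ y = d x ≡ d y × (∀ {g} → g < suc (n + n) → Low x g → ∀ {g′} → g′ < suc (n + n) → Low x g′ →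
                       inner x g g′ ≡ inner y g g′)

  _≃?_ : ∀ x y → Dec (x ≃ y)
  x ≃? y = (d x ℤ.≟ d y) ×-dec ℕ.allUpTo? (λ g → low? g →-dec
    ℕ.allUpTo? (λ g′ → low? g′ →-dec (inner x g g′ Bool.≟ inner y g g′)) (suc (n + n))) (suc (n + n))
    where
    low? : ∀ g → Dec (Low x g)
    low? g = e g ℤ.<? d x

  ≃-refl : ∀ {x} → x ≃ x
  ≃-refl = refl , λ _ _ _ _ → refl

  ≃-sym : ∀ {x y} → x ≃ y → y ≃ x
  ≃-sym (dx≡dy , same) = sym dx≡dy , λ g< low g′< low′ →
    sym (same g< (subst (_ ℤ.<_) (sym dx≡dy) low) g′< (subst (_ ℤ.<_) (sym dx≡dy) low′))

  ≃-trans : ∀ {x y z} → x ≃ y → y ≃ z → x ≃ z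
  ≃-trans (dx≡dy , same) (dy≡dz , same′) = trans dx≡dy dy≡dz , λ g< low g′< low′ →
    trans (same g< low g′< low′) (same′ g< (subst (_ ℤ.<_) dx≡dy low) g′< (subst (_ ℤ.<_) dx≡dy low′))

  -- If `a` has smaller depth than `b`, the gaps just after `a` and `c` are low for `b` and separate
  -- it from `f`. If it has greater depth, the gaps just before `b` and `f` separate `a` from `c`.
  -- At equal depth, a low chord between `a` and `b` would also have to separate one of these pairs.
  uncross : ∀ {a b c f} → a < b → b < c → c < f → f < n + n → a ≃ c → b ≃ f → a ≃ b
  uncross {a} {b} {c} {f} a<b b<c c<f f<N (da≡dc , same) (db≡df , same′) with ℤ.<-cmp (d a) (d b)
  ... | tri< da<db _ _ = contradiction
    (same′ (s≤s (ℕ.≤-trans a<b (ℕ.<⇒≤ b<N))) (ℤ.≤-<-trans (e-suc≤d a) da<db)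
           (s≤s (ℕ.≤-trans c<f (ℕ.<⇒≤ f<N))) (ℤ.≤-<-trans (e-suc≤d c) (subst (ℤ._< d b) da≡dc da<db)))
    (subst₂ _≢_ (sym (cong₂ _xor_ (side-false a<b) (side-true (s≤s (ℕ.<⇒≤ b<c)))))
                (sym (cong₂ _xor_ (side-false (ℕ.≤-trans a<b (ℕ.<⇒≤ (ℕ.<-trans b<c c<f)))) (side-false c<f))) λ ())
    where
    b<N = ℕ.<-trans b<c (ℕ.<-trans c<f f<N)
  ... | tri> _ _ db<da = contradiction
    (same (s≤s (ℕ.<⇒≤ (ℕ.<-trans b<c (ℕ.<-trans c<f f<N)))) (ℤ.≤-<-trans (e≤d b) db<da)
          (s≤s (ℕ.<⇒≤ f<N)) (ℤ.≤-<-trans (e≤d f) (subst (ℤ._< d a) db≡df db<da)))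
    (subst₂ _≢_ (sym (cong₂ _xor_ (side-true a<b) (side-true (ℕ.<-trans a<b (ℕ.<-trans b<c c<f)))))
                (sym (cong₂ _xor_ (side-false (ℕ.<⇒≤ b<c)) (side-true c<f))) λ ())
  ... | tri≈ _ da≡db _ = da≡db , λ {g} g< low {g′} g′< low′ →
    unseparated {g} {g′} (same g< low g′< low′)
      (same′ g< (subst (e g ℤ.<_) da≡db low) g′< (subst (e g′ ℤ.<_) da≡db low′))
    where
    place : ∀ g → side a g ≡ side b g ⊎ (a < g × g ≤ b)
    place g with a ℕ.<? g | b ℕ.<? g
    ... | yes a<g | yes b<g = inj₁ (trans (side-true a<g) (sym (side-true b<g)))
    ... | yes a<g | no  b≮g = inj₂ (a<g , ℕ.≮⇒≥ b≮g)
    ... | no  a≮g | yes b<g = contradiction (ℕ.<-trans a<b b<g) a≮g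
    ... | no  a≮g | no  b≮g = inj₁ (trans (side-false (ℕ.≮⇒≥ a≮g)) (sym (side-false (ℕ.≮⇒≥ b≮g))))

    -- A gap between a and b, hence before c and f, forces the other gap to
    -- lie both between b and c and not between c and f.
    impossible : ∀ {g g′} → a < g → g ≤ b → side a g′ ≡ side b g′ →
      inner a g g′ ≡ inner c g g′ → inner b g g′ ≡ inner f g g′ → ⊥
    impossible {g} {g′} a<g g≤b a≡b ac bf = absurd (side b g′) refl
      where
      not-b≡c : not (side b g′) ≡ side c g′
      not-b≡c = trans (cong not (sym a≡b)) (trans (cong (_xor side a g′) (sym (side-true a<g)))
        (trans ac (cong (_xor side c g′) (side-false (ℕ.≤-trans g≤b (ℕ.<⇒≤ b<c))))))
      b≡f : side b g′ ≡ side f g′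
      b≡f = trans (cong (_xor side b g′) (sym (side-false g≤b)))
        (trans bf (cong (_xor side f g′) (side-false (ℕ.≤-trans g≤b (ℕ.<⇒≤ (ℕ.<-trans b<c c<f))))))
      absurd : ∀ s → side b g′ ≡ s → ⊥
      absurd true  eq = contradiction
        (trans (sym (side-true (ℕ.<-trans c<f (side-true⁻ {f} {g′} (trans (sym b≡f) eq)))))
          (trans (sym not-b≡c) (cong not eq)))
        λ ()
      absurd false eq = contradiction
        (trans (sym (side-true (ℕ.<-trans b<c (side-true⁻ {c} {g′} (trans (sym not-b≡c) (cong not eq)))))) eq)
        λ ()

    unseparated : ∀ {g g′} → inner a g g′ ≡ inner c g g′ → inner b g g′ ≡ inner f g g′ → inner a g g′ ≡ inner b g g′
    unseparated {g} {g′} ac bf with place g | place g′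
    ... | inj₁ eq        | inj₁ eq′         = cong₂ _xor_ eq eq′
    ... | inj₂ (a<g , g≤b) | inj₂ (a<g′ , g′≤b) = trans (cong₂ _xor_ (side-true a<g) (side-true a<g′))
                                                (sym (cong₂ _xor_ (side-false g≤b) (side-false g′≤b)))
    ... | inj₂ (a<g , g≤b) | inj₁ eq′         = ⊥-elim (impossible {g} {g′} a<g g≤b eq′ ac bf)
    ... | inj₁ eq        | inj₂ (a<g′ , g′≤b) = ⊥-elim (impossible {g′} {g} a<g′ g′≤b eq
      (trans (Bool.xor-comm (side a g′) _) (trans ac (Bool.xor-comm (side c g) _)))
      (trans (Bool.xor-comm (side b g′) _) (trans bf (Bool.xor-comm (side f g) _))))

  private
    -- ĝ is the gap opposite to g.
    opposite-gap : ∀ {g} → g < suc (n + n) → ∃[ ĝ ] ĝ < suc (n + n) × e ĝ ≡ e g ×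
      (∀ x → x < n → side (x + n) g ≡ side x ĝ xor does (g ℕ.≤? n)
                   × side x g ≡ not (side (x + n) ĝ xor does (g ℕ.≤? n)))
    opposite-gap {g} (s≤s g≤N) with g ℕ.≤? n
    ... | yes g≤n = g + n , s≤s (ℕ.+-monoˡ-≤ n g≤n) , e-period g , λ x x<n →
      trans (side-false (ℕ.≤-trans g≤n (ℕ.m≤n+m n x)))
        (sym (cong₂ _xor_ (side-true (ℕ.<-≤-trans x<n (ℕ.m≤n+m n g))) (dec-true (g ℕ.≤? n) g≤n)))
      , trans (sym (Bool.not-involutive _)) (cong not (trans (Bool.xor-comm true (side x g))
          (cong₂ _xor_ (sym (side-+ x g n)) (sym (dec-true (g ℕ.≤? n) g≤n)))))
    ... | no g≰n with g ∸ n | ℕ.m∸n+n≡m (ℕ.<⇒≤ (ℕ.≰⇒> g≰n))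
    ...   | ĝ | refl = ĝ , s≤s (ℕ.≤-trans (ℕ.m≤m+n ĝ n) g≤N) , sym (e-period ĝ) , λ x x<n →
      trans (side-+ x ĝ n) (trans (sym (Bool.xor-identityʳ _)) (cong (side x ĝ xor_) (sym (dec-false (ĝ + n ℕ.≤? n) g≰n))))
      , trans (side-true (ℕ.<-trans x<n (ℕ.≰⇒> g≰n))) (sym (cong not (cong₂ _xor_
          (side-false (ℕ.≤-trans (ℕ.+-cancelʳ-≤ n ĝ n g≤N) (ℕ.m≤n+m n x))) (dec-false (ĝ + n ℕ.≤? n) g≰n))))

  Opposite : ℕ → ℕ → Set
  Opposite x x̂ = (x < n × x̂ ≡ x + n) ⊎ (x̂ < n × x ≡ x̂ + n)

  private
    d-opposite : ∀ {x x̂} → Opposite x x̂ → d x̂ ≡ d x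
    d-opposite (inj₁ (_ , refl)) = d-period _
    d-opposite (inj₂ (_ , refl)) = sym (d-period _)

    xor-cancel : ∀ s s′ t t′ u c c′ → s ≡ u xor (t xor c) → s′ ≡ u xor (t′ xor c′) →
                 s xor s′ ≡ (t xor t′) xor (c xor c′)
    xor-cancel s s′ t t′ u c c′ refl refl = solve 5
      (λ t t′ u c c′ → (u :+ (t :+ c)) :+ (u :+ (t′ :+ c′)) := (t :+ t′) :+ (c :+ c′)) refl t t′ u c c′
      where open BoolSolver.xor-∧-Solver

  -- Moving point and gap by half a turn changes `side` by one term depending on the half in which
  -- the point lies and one depending on the gap. The former cancels within `inner`; the latter
  -- contributes `c xor c′`, the same for `x` and `y`.
  ≃-opposite : ∀ {x y x̂ ŷ} → Opposite x x̂ → Opposite y ŷ → x ≃ y → x̂ ≃ ŷ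
  ≃-opposite {x} {y} {x̂} {ŷ} opx opy (dx≡dy , same) =
    trans (d-opposite opx) (trans dx≡dy (sym (d-opposite opy))) , separate
    where
    separate : ∀ {g} → g < suc (n + n) → Low x̂ g → ∀ {g′} → g′ < suc (n + n) → Low x̂ g′ → inner x̂ g g′ ≡ inner ŷ g g′
    separate {g} g< low {g′} g′< low′
      with ĝ , ĝ< , eĝ , flip ← opposite-gap g<
      with ĝ′ , ĝ′< , eĝ′ , flip′ ← opposite-gap g′< =
      trans (flipped opx) (trans (cong (_xor (c xor c′))
        (same ĝ< (subst₂ ℤ._<_ (sym eĝ) (d-opposite opx) low) ĝ′< (subst₂ ℤ._<_ (sym eĝ′) (d-opposite opx) low′)))
        (sym (flipped opy)))
      where
      c  = does (g ℕ.≤? n)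
      c′ = does (g′ ℕ.≤? n)
      flipped : ∀ {z ẑ} → Opposite z ẑ → inner ẑ g g′ ≡ inner z ĝ ĝ′ xor (c xor c′)
      flipped {z} (inj₁ (z<n , refl)) =
        xor-cancel _ _ (side z ĝ) (side z ĝ′) false c c′ (proj₁ (flip z z<n)) (proj₁ (flip′ z z<n))
      flipped {_} {ẑ} (inj₂ (ẑ<n , refl)) =
        xor-cancel _ _ (side (ẑ + n) ĝ) (side (ẑ + n) ĝ′) true c c′ (proj₂ (flip ẑ ẑ<n)) (proj₂ (flip′ ẑ ẑ<n))

  private
    -- With `g` the gap `g + n` is equally low, and the diameter between them separates `x` from
    -- `x + n`.
    no-low-gap-half : ∀ {x} → x < n → x ≃ x + n → ∀ {g} → g ≤ n → ¬ Low x g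
    no-low-gap-half {x} x<n (_ , same) {g} g≤n low = Bool.not-¬ {side x g} refl
      (sym (trans (Bool.xor-comm true (side x g)) (trans
        (cong (side x g xor_) (sym (side-true (ℕ.<-≤-trans x<n (ℕ.m≤n+m n g)))))
        (trans (same (s≤s (ℕ.≤-trans g≤n (ℕ.m≤m+n n n))) low
                     (s≤s (ℕ.+-monoˡ-≤ n g≤n)) (subst (ℤ._< d x) (sym (e-period g)) low))
          (cong₂ _xor_ (side-false (ℕ.≤-trans g≤n (ℕ.m≤n+m n x))) (side-+ x g n))))))

  no-low-gap : ∀ {x} → x < n → x ≃ x + n → ∀ {g} → g < suc (n + n) → ¬ Low x g
  no-low-gap {x} x<n x≃x+n {g} (s≤s g≤N) low with g ℕ.≤? n
  ... | yes g≤n = no-low-gap-half x<n x≃x+n g≤n low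
  ... | no g≰n with g ∸ n | ℕ.m∸n+n≡m (ℕ.<⇒≤ (ℕ.≰⇒> g≰n))
  ...   | g′ | refl = no-low-gap-half x<n x≃x+n (ℕ.+-cancelʳ-≤ n g′ n g≤N) (subst (ℤ._< d x) (e-period g′) low)

  -- Every gap lies at least as high as x, and so does every point y.
  zeroes : ∀ {x y} → x < n → y < n → x ≃ x + n → y ≃ y + n → x ≃ y
  zeroes {x} {y} x<n y<n zx zy =
    ℤ.≤-antisym (bound x<n zx y<n) (bound y<n zy x<n) , λ g< low _ _ → contradiction low (no-low-gap x<n zx g<)
    where
    bound : ∀ {x y} → x < n → x ≃ x + n → y < n → d x ℤ.≤ d y
    bound {x} {y} x<n zx y<n = ℤ.≤-trans
      (ℤ.≮⇒≥ (no-low-gap x<n zx (s≤s (ℕ.≤-trans (ℕ.<⇒≤ y<n) (ℕ.m≤m+n n n))))) (e≤d y)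

  adjacent : ∀ {x y} → x ≤ y → d x ≡ d y → (∀ g → x < g → g ≤ y → ¬ Low x g) → x ≃ y
  adjacent {x} {y} x≤y dx≡dy none = dx≡dy , λ {g} _ low {g′} _ low′ → cong₂ _xor_ (same g low) (same g′ low′)
    where
    same : ∀ g → Low x g → side x g ≡ side y g
    same g low with x ℕ.<? g | y ℕ.<? g
    ... | yes x<g | yes y<g = trans (side-true x<g) (sym (side-true y<g))
    ... | yes x<g | no  y≮g = contradiction low (none g x<g (ℕ.≮⇒≥ y≮g))
    ... | no  x≮g | yes y<g = contradiction (ℕ.≤-<-trans x≤y y<g) x≮g
    ... | no  x≮g | no  y≮g = trans (side-false (ℕ.≮⇒≥ x≮g)) (sym (side-false (ℕ.≮⇒≥ y≮g)))

  -- The gaps just before `i` and just before `i + n` are both low, and they enclose `y` but not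
  -- `i + n`. For closing points the gaps just after play the same part.
  opens⇒no-prev : ∀ {i} → i < n → e i ℤ.< d i → ∀ {y} → i ≤ y → y < i + n → ¬ (y ≃ i + n)
  opens⇒no-prev {i} i<n opens {y} i≤y y<i+n y≃ = contradiction
    (proj₂ (≃-sym y≃) (s≤s (ℕ.≤-trans (ℕ.<⇒≤ i<n) (ℕ.m≤m+n n n))) (subst (e i ℤ.<_) (sym (d-period i)) opens)
                      (s≤s (ℕ.+-monoˡ-≤ n (ℕ.<⇒≤ i<n))) (subst₂ ℤ._<_ (sym (e-period i)) (sym (d-period i)) opens))
    (subst₂ _≢_ (sym (cong₂ _xor_ (side-false (ℕ.m≤m+n i n)) (side-false (ℕ.≤-refl {i + n}))))
                (sym (cong₂ _xor_ (side-false i≤y) (side-true y<i+n))) λ ())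

  closes⇒no-next : ∀ {i} → i < n → e (suc i) ℤ.< d i → ∀ {y} → i < y → y ≤ i + n → ¬ (i ≃ y)
  closes⇒no-next {i} i<n closes {y} i<y y≤i+n i≃y = contradiction
    (proj₂ i≃y (s≤s (ℕ.≤-trans i<n (ℕ.m≤m+n n n))) closes
               (s≤s (ℕ.+-monoˡ-≤ n i<n)) (subst (ℤ._< d i) (sym (e-period (suc i))) closes))
    (subst₂ _≢_ (sym (cong₂ _xor_ (side-true (ℕ.≤-refl {suc i})) (side-true (s≤s (ℕ.m≤m+n i n)))))
                (sym (cong₂ _xor_ (side-false i<y) (side-true (s≤s y≤i+n)))) λ ())

  -- Scan back from `i + n` for a point `y` not deeper than `i`; the scan ends at `i` if not before.
  -- All points passed are deeper, so by `d-drop` no gap after `y` is low, and this also forces `y`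
  -- itself up to the depth of `i`.
  ¬opens⇒prev : ∀ i → e i ≡ d i → ∃[ y ] i ≤ y × y < i + n × y ≃ i + n
  ¬opens⇒prev i e≡d
    with y , i≤y , y≤ , dy≤ , above ← greatest (λ y → d y ℤ.≤? d i) m i ℤ.≤-refl =
    y , i≤y , y<i+n , adjacent (ℕ.<⇒≤ y<i+n) (trans dy≡di (sym (d-period i)))
      λ g y<g g≤ low → ℤ.<⇒≱ low (subst (ℤ._≤ e g) (sym dy≡di) (high g y<g g≤))
    where
    y<i+n : y < i + n
    y<i+n = subst (y <_) (sym (ℕ.+-suc i m)) (s≤s y≤)
    high : ∀ g → y < g → g ≤ i + n → d i ℤ.≤ e g
    high g y<g g≤ with ℕ.m≤n⇒m<n∨m≡n g≤
    ... | inj₂ refl = ℤ.≤-reflexive (trans (sym e≡d) (sym (e-period i)))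
    ... | inj₁ g<   = d-drop g (ℤ.≰⇒> (above g y<g (s≤s⁻¹ (subst (g <_) (ℕ.+-suc i m) g<))))
    dy≡di : d y ≡ d i
    dy≡di = ℤ.≤-antisym dy≤ (ℤ.≤-trans (high (suc y) ℕ.≤-refl y<i+n) (e-suc≤d y))

  ¬closes⇒next : ∀ i → e (suc i) ≡ d i → ∃[ y ] i < y × y ≤ i + n × i ≃ y
  ¬closes⇒next i e≡d
    with y , i<y , y≤ , dy≤ , above ← least (λ y → d y ℤ.≤? d i) m (suc i)
      (ℤ.≤-reflexive (trans (cong d (sym (ℕ.+-suc i m))) (d-period i))) =
    y , i<y , subst (y ≤_) (sym (ℕ.+-suc i m)) y≤ , adjacent (ℕ.<⇒≤ i<y) di≡dy
      λ g i<g g≤y low → ℤ.<⇒≱ low (high g i<g g≤y)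
    where
    high : ∀ g → i < g → g ≤ y → d i ℤ.≤ e g
    high (suc z) i<g g≤y with ℕ.m≤n⇒m<n∨m≡n i<g
    ... | inj₂ refl      = ℤ.≤-reflexive (sym e≡d)
    ... | inj₁ (s≤s i<z) = d-drop-suc z (ℤ.≰⇒> (above z i<z g≤y))
    di≡dy : d i ≡ d y
    di≡dy = ℤ.≤-antisym (ℤ.≤-trans (high y i<y ℕ.≤-refl) (e≤d y)) dy≤

module Build {m : ℕ} (prof : Profile (suc m)) where
  open Profile prof
  open FromProfile prof
  open Circle m
  private
    n = suc m

    _≈_ : Fin (n + n) → Fin (n + n) → Set
    a ≈ b = toℕ a ≃ toℕ b

    _≈?_ : ∀ a b → Dec (a ≈ b)
    a ≈? b = toℕ a ≃? toℕ b

    opposite : ∀ a → Opposite (toℕ a) (toℕ (bar n a))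
    opposite a with toℕ-bar n a
    ... | inj₁ p  = inj₁ p
    ... | inj₂ eq = inj₂ (ℕ.+-cancelʳ-< n _ n (subst (_< n + n) eq (Fin.toℕ<n a)) , eq)

    π : SetPartition (n + n)
    π = classes _≈?_ ≃-refl ≃-sym ≃-trans

    member : ∀ a b → a ≈ b → b ∈ lookup (blockOf π) a
    member a b = ∈-classes⁺ _≈?_ ≃-refl ≃-sym ≃-trans {a} {b}

    member⁻ : ∀ a b → b ∈ lookup (blockOf π) a → a ≈ b
    member⁻ a b = ∈-classes⁻ _≈?_ ≃-refl ≃-sym ≃-trans {a} {b}

    ≈-bar : ∀ a b → a ≈ b → bar n a ≈ bar n b
    ≈-bar a b = ≃-opposite (opposite a) (opposite b)

    same-block : ∀ a b → a ≈ b → lookup (blockOf π) a ≡ lookup (blockOf π) b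
    same-block a b a≈b = sym (blocks-agree π {a} {b} (member a b a≈b))

    same-block⁻ : ∀ a b → lookup (blockOf π) a ≡ lookup (blockOf π) b → a ≈ b
    same-block⁻ a b eq = member⁻ a b (subst (b ∈_) (sym eq) (a∈blockOf[a] π b))

    ∈-bar⁺ : ∀ {β c} → bar n c ∈ β → c ∈ barBlock n β
    ∈-bar⁺ {β} {c} c∈ = Vec.lookup⇒[]= c _ (trans (lookup-barBlock n β c) (Vec.[]=⇒lookup c∈))

    ∈-bar⁻ : ∀ {β c} → c ∈ barBlock n β → bar n c ∈ β
    ∈-bar⁻ {β} {c} c∈ = Vec.lookup⇒[]= (bar n c) β (trans (sym (lookup-barBlock n β c)) (Vec.[]=⇒lookup c∈))

    block-bar≡ : ∀ a → lookup (blockOf π) (bar n a) ≡ barBlock n (lookup (blockOf π) a)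
    block-bar≡ a = Sub.⊆-antisym
      (λ {c} c∈ → ∈-bar⁺ (member a (bar n c)
        (subst (_≈ bar n c) (bar-involutive n a) (≈-bar (bar n a) c (member⁻ (bar n a) c c∈)))))
      (λ {c} c∈ → member (bar n a) c
        (subst (bar n a ≈_) (bar-involutive n c) (≈-bar a (bar n c) (member⁻ a (bar n c) (∈-bar⁻ c∈)))))

    -- `zeroes` speaks of the first half of the circle only; a point equivalent to its bar can be
    -- replaced by whichever of the two lies there.
    lower : ∀ a → a ≈ bar n a → ∃[ x ] x < n × x ≃ x + n × toℕ a ≃ x
    lower a a≈bar with opposite a
    ... | inj₁ (a<n , eq) = toℕ a , a<n , subst (toℕ a ≃_) eq a≈bar , ≃-refl
    ... | inj₂ (bar<n , eq) = toℕ (bar n a) , bar<n , ≃-sym (subst (_≃ toℕ (bar n a)) eq a≈bar) , a≈bar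

    zero-block : ∀ a → IsZeroBlock n (lookup (blockOf π) a) → a ≈ bar n a
    zero-block a z = member⁻ a (bar n a) (∈-bar⁻ (subst (a ∈_) (sym z) (a∈blockOf[a] π a)))

    -- In each rotation the argument starts from the least of the four points. Whichever two points
    -- `uncross` relates, they come from the two different pairs.
    uncrossed : ∀ a b c f → Clockwise n a b c f → a ≈ c → b ≈ f → a ≈ b
    uncrossed a b c f (inj₁ (a<b , b<c , c<f)) a≈c b≈f = uncross a<b b<c c<f (Fin.toℕ<n f) a≈c b≈f
    uncrossed a b c f (inj₂ (inj₁ (b<c , c<f , f<a))) a≈c b≈f =
      ≃-trans a≈c (≃-sym (uncross b<c c<f f<a (Fin.toℕ<n a) b≈f (≃-sym a≈c)))
    uncrossed a b c f (inj₂ (inj₂ (inj₁ (c<f , f<a , a<b)))) a≈c b≈f =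
      ≃-trans a≈c (≃-trans (uncross c<f f<a a<b (Fin.toℕ<n b) (≃-sym a≈c) (≃-sym b≈f)) (≃-sym b≈f))
    uncrossed a b c f (inj₂ (inj₂ (inj₂ (f<a , a<b , b<c)))) a≈c b≈f =
      ≃-trans (≃-sym (uncross f<a a<b b<c (Fin.toℕ<n c) (≃-sym b≈f) a≈c)) (≃-sym b≈f)

  build : NCᴮ n
  build = record
    { partition   = π
    ; typeB       = record
      { bar-closed       = λ where β (a , refl) → bar n a , block-bar≡ a
      ; zeroBlock-unique = λ where
          β γ (a , refl) (b , refl) zβ zγ →
            let x , x<n , zx , a≃x = lower a (zero-block a zβ)
                y , y<n , zy , b≃y = lower b (zero-block b zγ)
            in same-block a b (≃-trans a≃x (≃-trans (zeroes x<n y<n zx zy) (≃-sym b≃y)))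
      }
    ; noncrossing = λ where
        β γ (p , refl) (q , refl) a b c f cw a∈ c∈ b∈ f∈ →
          let p≈a = member⁻ p a a∈ ; q≈b = member⁻ q b b∈ in
          same-block p q (≃-trans p≈a (≃-trans
            (uncrossed a b c f cw (≃-trans (≃-sym p≈a) (member⁻ p c c∈)) (≃-trans (≃-sym q≈b) (member⁻ q f f∈)))
            (≃-sym q≈b)))
    }

  private
    module U = Unrolled (unroll build)

    ~⇒≃ : ∀ {x y} → x < n + n → y < n + n → x U.~ y → x ≃ y
    ~⇒≃ {x} {y} x< y< x~y = subst₂ _≃_ (toℕ-point x<) (toℕ-point y<) (same-block⁻ (point x) (point y) x~y)

    ≃⇒~ : ∀ {x y} → x < n + n → y < n + n → x ≃ y → x U.~ y
    ≃⇒~ {x} {y} x< y< x≃y = same-block (point x) (point y) (subst₂ _≃_ (sym (toℕ-point x<)) (sym (toℕ-point y<)) x≃y)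

  build-prevSet : ∀ S → (∀ i → i ∈ S → e (toℕ i) ≡ d (toℕ i)) → (∀ i → i ∉ S → e (toℕ i) ℤ.< d (toℕ i)) →
                  prevSet build ≡ S
  build-prevSet S level opens = Sub.⊆-antisym
    (λ {i} i∈ → case i Sub.∈? S of λ where
      (yes i∈S) → i∈S
      (no  i∉S) → let y , i≤y , y< , y~ = ∈-setOf⁻ (λ i → U.hasPrev? (toℕ i)) i∈ in
        contradiction (~⇒≃ (ℕ.<-trans y< (top i)) (top i) y~)
          (opens⇒no-prev (Fin.toℕ<n i) (opens i i∉S) i≤y y<))
    (λ {i} i∈S → let y , i≤y , y< , y≃ = ¬opens⇒prev (toℕ i) (level i i∈S) in
      ∈-setOf⁺ (λ i → U.hasPrev? (toℕ i)) (y , i≤y , y< , ≃⇒~ (ℕ.<-trans y< (top i)) (top i) y≃))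
    where
    top : ∀ (i : Fin n) → toℕ i + n < n + n
    top i = ℕ.+-monoˡ-< n (Fin.toℕ<n i)

  build-nextSet : ∀ V → (∀ i → i ∈ V → e (suc (toℕ i)) ≡ d (toℕ i)) →
                  (∀ i → i ∉ V → e (suc (toℕ i)) ℤ.< d (toℕ i)) → nextSet build ≡ V
  build-nextSet V level closes = Sub.⊆-antisym
    (λ {i} i∈ → case i Sub.∈? V of λ where
      (yes i∈V) → i∈V
      (no  i∉V) → let y , i<y , y≤ , i~y = ∈-setOf⁻ (λ i → U.hasNext? (toℕ i)) i∈ in
        contradiction (~⇒≃ (start i) (top i y≤) i~y)
          (closes⇒no-next (Fin.toℕ<n i) (closes i i∉V) i<y y≤))
    (λ {i} i∈V → let y , i<y , y≤ , i≃y = ¬closes⇒next (toℕ i) (level i i∈V) in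
      ∈-setOf⁺ (λ i → U.hasNext? (toℕ i)) (y , i<y , y≤ , ≃⇒~ (start i) (top i y≤) i≃y))
    where
    start : ∀ (i : Fin n) → toℕ i < n + n
    start i = ℕ.<-≤-trans (Fin.toℕ<n i) (ℕ.m≤m+n n n)
    top : ∀ (i : Fin n) {y} → y ≤ toℕ i + n → y < n + n
    top i y≤ = ℕ.≤-<-trans y≤ (ℕ.+-monoˡ-< n (Fin.toℕ<n i))

-- Depths from counting brackets

count : (ℕ → Bool) → ℕ → ℕ
count f zero    = 0
count f (suc k) = if f k then suc (count f k) else count f k

module _ {f : ℕ → Bool} where

  count-true : ∀ {k} → f k ≡ true → count f (suc k) ≡ suc (count f k)
  count-true {k} eq = cong (λ b → if b then suc (count f k) else count f k) eq

  count-false : ∀ {k} → f k ≡ false → count f (suc k) ≡ count f k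
  count-false {k} eq = cong (λ b → if b then suc (count f k) else count f k) eq

  count-≤ : ∀ k → count f k ≤ count f (suc k)
  count-≤ k with f k
  ... | true  = ℕ.n≤1+n _
  ... | false = ℕ.≤-refl

  count-≤-suc : ∀ k → count f (suc k) ≤ suc (count f k)
  count-≤-suc k with f k
  ... | true  = ℕ.≤-refl
  ... | false = ℕ.n≤1+n _

  count-period : ∀ {n} → (∀ x → f (x + n) ≡ f x) → ∀ x → count f (x + n) ≡ count f n + count f x
  count-period periodic zero    = sym (ℕ.+-identityʳ _)
  count-period {n} periodic (suc x) with f x in eq
  ... | true  = trans (count-true (trans (periodic x) eq))
    (trans (cong suc (count-period periodic x)) (sym (ℕ.+-suc _ _)))
  ... | false = trans (count-false (trans (periodic x) eq)) (count-period periodic x)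

-- `count` recurses on the last position, a subset on its first; this is the bridge.
count-suc : ∀ f k → count f (suc k) ≡ (if f 0 then suc (count (f ∘ suc) k) else count (f ∘ suc) k)
count-suc f zero    = refl
count-suc f (suc k) with f 0 | f (suc k) | count-suc f k
... | true  | true  | eq = cong suc eq
... | true  | false | eq = eq
... | false | true  | eq = cong suc eq
... | false | false | eq = eq

count-subset : ∀ {n} (S : Subset n) f → (∀ i → f (toℕ i) ≡ lookup S i) → count f n ≡ ∣ S ∣
count-subset []      f f≡S = refl
count-subset {suc n} (b ∷ S) f f≡S = trans (count-suc f n)
  (trans (cong₂ (λ b c → if b then suc c else c) (f≡S zero) (count-subset S (f ∘ suc) (f≡S ∘ suc))) (cardinality b))
  where
  cardinality : ∀ b → (if b then suc ∣ S ∣ else ∣ S ∣) ≡ ∣ b ∷ S ∣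
  cardinality true  = refl
  cardinality false = refl

module _ {n : ℕ} {opens closes : ℕ → Bool} (opens-period : ∀ x → opens (x + n) ≡ opens x)
         (closes-period : ∀ x → closes (x + n) ≡ closes x) (balanced : count opens n ≡ count closes n) where

  -- An opening bracket stands before its point and a closing one after it, so `d x` includes the
  -- opening at `x` but not the closing. Equal numbers of both in a period make the depths periodic;
  -- they may be negative, as a period can begin with closing brackets.
  balancedProfile : Profile n
  balancedProfile = record
    { e          = λ x → count opens x ℤ.⊖ count closes x
    ; d          = λ x → count opens (suc x) ℤ.⊖ count closes x
    ; e-period   = λ x → cancel (count-period opens-period x) (count-period closes-period x)
    ; d-period   = λ x → cancel (count-period opens-period (suc x)) (count-period closes-period x)
    ; e≤d        = λ x → ℤ.⊖-monoˡ-≤ (count closes x) (count-≤ x)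
    ; e-suc≤d    = λ x → ℤ.⊖-monoʳ-≥-≤ (count opens (suc x)) (count-≤ x)
    ; d-drop     = λ x h<d → below (ℤ.<-≤-trans h<d (ℤ.≤-trans
        (ℤ.⊖-monoˡ-≤ (count closes x) (count-≤-suc x))
        (ℤ.≤-reflexive (sym (ℤ.distribʳ-⊖-+-pos 1 (count opens x) (count closes x))))))
    ; d-drop-suc = λ x h<d → below (ℤ.<-≤-trans h<d (ℤ.≤-trans
        (ℤ.≤-reflexive (sym (ℤ.[1+m]⊖[1+n]≡m⊖n (count opens (suc x)) (count closes x))))
        (ℤ.≤-trans (ℤ.⊖-monoʳ-≥-≤ (suc (count opens (suc x))) (count-≤-suc x))
          (ℤ.≤-reflexive (sym (ℤ.distribʳ-⊖-+-pos 1 (count opens (suc x)) (count closes (suc x))))))))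
    }
    where
    cancel : ∀ {a a′ b b′} → a′ ≡ count opens n + a → b′ ≡ count closes n + b → a′ ℤ.⊖ b′ ≡ a ℤ.⊖ b
    cancel {a} {b = b} refl refl = trans
      (cong (λ c → (c + a) ℤ.⊖ (count closes n + b)) balanced) (ℤ.+-cancelˡ-⊖ (count closes n) a b)
    below : ∀ {h i} → h ℤ.< ℤ.1ℤ ℤ.+ i → h ℤ.≤ i
    below {h} {i} h<1+i = subst (h ℤ.≤_) (ℤ.pred-suc i) (ℤ.i<j⇒i≤pred[j] h<1+i)

module _ {m : ℕ} (S V : Subset (suc m)) (∣S∣≡∣V∣ : ∣ S ∣ ≡ ∣ V ∣) where
  open Circle m
  private
    n = suc m

    outsideOf : Subset n → ℕ → Bool
    outsideOf T x = lookup (∁ T) (x mod n)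

    outside-period : ∀ T x → outsideOf T (x + n) ≡ outsideOf T x
    outside-period T x = cong (lookup (∁ T)) (Fin.toℕ-injective
      (trans (Fin.toℕ-fromℕ< _) (trans (ℕ.[m+n]%n≡m%n x n) (sym (Fin.toℕ-fromℕ< _)))))

    outside-toℕ : ∀ T i → outsideOf T (toℕ i) ≡ lookup (∁ T) i
    outside-toℕ T i = cong (lookup (∁ T)) (Fin.toℕ-injective
      (trans (Fin.toℕ-fromℕ< _) (ℕ.m<n⇒m%n≡m (Fin.toℕ<n i))))

    inside-T : ∀ {T i} → i ∈ T → outsideOf T (toℕ i) ≡ false
    inside-T {T} {i} i∈ = trans (outside-toℕ T i) (trans (Vec.lookup-map i not T) (cong not (Vec.[]=⇒lookup i∈)))

    outside-T : ∀ {T i} → i ∉ T → outsideOf T (toℕ i) ≡ true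
    outside-T {T} {i} i∉ = trans (outside-toℕ T i) (Vec.[]=⇒lookup (Sub.x∉p⇒x∈∁p i∉))

    count-outside : ∀ T → count (outsideOf T) n ≡ n ∸ ∣ T ∣
    count-outside T = trans (count-subset (∁ T) (outsideOf T) (outside-toℕ T)) (Sub.∣∁p∣≡n∸∣p∣ T)

    prof : Profile n
    prof = balancedProfile {opens = outsideOf S} {outsideOf V} (outside-period S) (outside-period V)
      (trans (count-outside S) (trans (cong (n ∸_) ∣S∣≡∣V∣) (sym (count-outside V))))

    O C : ℕ → ℕ
    O = count (outsideOf S)
    C = count (outsideOf V)

  open Build prof using (build)

  ends-surjective : ∃[ ν ] prevSet ν ≡ S × nextSet ν ≡ V
  ends-surjective = build
    , Build.build-prevSet prof S
        (λ i i∈ → cong (ℤ._⊖ C (toℕ i)) (sym (count-false {outsideOf S} {toℕ i} (inside-T i∈))))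
        (λ i i∉ → ℤ.⊖-monoˡ-< (C (toℕ i)) (ℕ.≤-reflexive (sym (count-true {outsideOf S} {toℕ i} (outside-T i∉)))))
    , Build.build-nextSet prof V
        (λ i i∈ → cong (O (suc (toℕ i)) ℤ.⊖_) (count-false {outsideOf V} {toℕ i} (inside-T i∈)))
        (λ i i∉ → ℤ.⊖-monoʳ->-< (O (suc (toℕ i))) (ℕ.≤-reflexive (sym (count-true {outsideOf V} {toℕ i} (outside-T i∉)))))

⊆∧∣∣≥⇒≡ : ∀ {n} {p q : Subset n} → p ⊆ q → ∣ q ∣ ≤ ∣ p ∣ → p ≡ q
⊆∧∣∣≥⇒≡ {p = p} {q} p⊆q q≤p with q Sub.⊆? p
... | yes q⊆p = Sub.⊆-antisym p⊆q q⊆p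
... | no  q⊈p with Fin.any? (λ x → (x Sub.∈? q) ×-dec ¬? (x Sub.∈? p))
...   | yes (x , x∈q , x∉p) = contradiction q≤p (ℕ.<⇒≱ (Sub.p⊂q⇒∣p∣<∣q∣ (p⊆q , x , x∈q , x∉p)))
...   | no  none = contradiction (λ {x} x∈q → case x Sub.∈? p of λ where
          (yes x∈p) → x∈p
          (no  x∉p) → contradiction (x , x∈q , x∉p) none) q⊈p

-- The bijection between noncrossing partitions and words

module _ (m : ℕ) where
  open Circle m
  open Pᴮ using (perm)
  private
    n = suc m
    module NC = StrictPartialOrder (NCᴮ-strictPartialOrder n)
    module PB = StrictPartialOrder (Pᴮ-strictPartialOrder n)

    φ : NCᴮ n → Pᴮ n
    φ ν = fromSubsets (prevSet ν) (nextSet ν) (∣nextSet∣≡∣prevSet∣ ν)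

    Des-φ : ∀ ν → Des (perm (φ ν)) ≡ prevSet ν
    Des-φ ν = Des-fromSubsets (prevSet ν) (nextSet ν) (∣nextSet∣≡∣prevSet∣ ν)

    values-φ : ∀ ν → barredValues (perm (φ ν)) ≡ nextSet ν
    values-φ ν = barredValues-fromSubsets (prevSet ν) (nextSet ν) (∣nextSet∣≡∣prevSet∣ ν)

    ends-mono : ∀ ν ν′ → NCᴮ.partition ν ≤ₚ NCᴮ.partition ν′ → nextSet ν ⊆ nextSet ν′ × prevSet ν ⊆ prevSet ν′
    ends-mono ν ν′ ν≤ν′ = coarser-ends ν ν′ (≤ₚ⇒blockOf-⊆ {π = NCᴮ.partition ν} {NCᴮ.partition ν′} ν≤ν′)

    ends-cong : ∀ ν ν′ → NCᴮ.partition ν ≈ₚ NCᴮ.partition ν′ → prevSet ν ≡ prevSet ν′ × nextSet ν ≡ nextSet ν′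
    ends-cong ν ν′ ν≈ν′ =
      Sub.⊆-antisym (proj₂ (below ν ν′ ν≈ν′)) (proj₂ (below ν′ ν (sym ν≈ν′)))
      , Sub.⊆-antisym (proj₁ (below ν ν′ ν≈ν′)) (proj₁ (below ν′ ν (sym ν≈ν′)))
      where
      below : ∀ ν ν′ → NCᴮ.partition ν ≈ₚ NCᴮ.partition ν′ → nextSet ν ⊆ nextSet ν′ × prevSet ν ⊆ prevSet ν′
      below ν ν′ eq = ends-mono ν ν′ (≤ₚ-reflexive {π = NCᴮ.partition ν} {NCᴮ.partition ν′} eq)

    φ-injective : ∀ {ν ν′} → word (perm (φ ν)) ≡ word (perm (φ ν′)) → NCᴮ.partition ν ≈ₚ NCᴮ.partition ν′
    φ-injective {ν} {ν′} eq = ends-injective ν ν′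
      (trans (sym (values-φ ν)) (trans (barredValues-cong (φ ν) (φ ν′) eq) (values-φ ν′)))
      (trans (sym (Des-φ ν)) (trans (cong descents eq) (Des-φ ν′)))

    φ-cong : ∀ {ν ν′} → NCᴮ.partition ν ≈ₚ NCᴮ.partition ν′ → word (perm (φ ν)) ≡ word (perm (φ ν′))
    φ-cong {ν} {ν′} ν≈ν′ = let prev≡ , next≡ = ends-cong ν ν′ ν≈ν′ in
      Pᴮ-unique (φ ν) (φ ν′) (trans (Des-φ ν) (trans prev≡ (sym (Des-φ ν′))))
        (trans (values-φ ν) (trans next≡ (sym (values-φ ν′))))

    φ-surjective : ∀ b → ∃[ ν ] word (perm (φ ν)) ≡ word (perm b)
    φ-surjective b =
      let ν , prev≡ , next≡ = ends-surjective (barredPositions (perm b)) (barredValues (perm b))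
                                (∣barredPositions∣≡∣barredValues∣ (perm b))
      in ν , Pᴮ-unique (φ ν) b (trans (Des-φ ν) (trans prev≡ (sym (Des-barred b)))) (trans (values-φ ν) next≡)

    -- Only the strictness is at stake: a coarsening might enlarge `nextSet` and leave the descent
    -- set as it is. The equal sizes of the two sets exclude this, for if one does not grow, neither
    -- does the other, and by `ends-injective` the partitions agree.
    φ-mono : ∀ {ν ν′} → ν NC.< ν′ → φ ν PB.< φ ν′
    φ-mono {ν} {ν′} (ν≤ν′ , ν≉ν′) = subst₂ _⊂_ (sym (Des-φ ν)) (sym (Des-φ ν′)) (⊆∧∣∣<⇒⊂ prev⊆ smaller)
      where
      next⊆ = proj₁ (ends-mono ν ν′ ν≤ν′)
      prev⊆ = proj₂ (ends-mono ν ν′ ν≤ν′)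
      smaller : ∣ prevSet ν ∣ < ∣ prevSet ν′ ∣
      smaller = ℕ.≰⇒> λ ≥ → ν≉ν′ (ends-injective ν ν′
        (⊆∧∣∣≥⇒≡ next⊆ (subst₂ _≤_ (sym (∣nextSet∣≡∣prevSet∣ ν′)) (sym (∣nextSet∣≡∣prevSet∣ ν)) ≥))
        (⊆∧∣∣≥⇒≡ prev⊆ ≥))

  bijection : Bijection NC.Eq.setoid PB.Eq.setoid
  bijection = record
    { to        = φ
    ; cong      = λ {ν} {ν′} → φ-cong {ν} {ν′}
    ; bijective = (λ {ν} {ν′} → φ-injective {ν} {ν′})
      , λ b → let ν , eq = φ-surjective b in ν , λ {ν′} ν′≈ν → trans (φ-cong {ν′} {ν} ν′≈ν) eq
    }

  Pᴮ-isExtensionOf-NCᴮ : Pᴮ-strictPartialOrder n IsExtensionOf NCᴮ-strictPartialOrder n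
  Pᴮ-isExtensionOf-NCᴮ = bijection , λ {ν} {ν′} → φ-mono {ν} {ν′}

  NCᴮ-rankSizes : IsRankSizes (NCᴮ-ranked n) (rankSize n)
  NCᴮ-rankSizes k = hasCardinality-preimage bijection
    (λ ν → mk⇔ (trans (sym (rank-φ ν))) (trans (rank-φ ν))) (Pᴮ-rankSizes n k)
    where
    rank-φ : ∀ ν → RankedPoset.rank (NCᴮ-ranked n) ν ≡ ∣ Des (perm (φ ν)) ∣
    rank-φ ν = trans (rank≡∣prevSet∣ ν) (cong ∣_∣ (sym (Des-φ ν)))

  sameRankGeneratingFunction : SameRankGeneratingFunction (Pᴮ-ranked n) (NCᴮ-ranked n)
  sameRankGeneratingFunction = rankSizeList (Pᴮ-ranked n) (rankSize n)
    , (rankSize n , Pᴮ-rankSizes n , refl) , (rankSize n , NCᴮ-rankSizes , refl)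

theorem3 : (n : ℕ) → 1 ≤ n →
    (Pᴮ-strictPartialOrder n IsExtensionOf NCᴮ-strictPartialOrder n)
    × SameRankGeneratingFunction (Pᴮ-ranked n) (NCᴮ-ranked n)
    × RankSymmetric (Pᴮ-ranked n)
    × RankUnimodal (Pᴮ-ranked n)
    × SelfDual (Pᴮ-ranked n)
    × StronglySperner (Pᴮ-ranked n)
theorem3 (suc m) _ =
  Pᴮ-isExtensionOf-NCᴮ m , sameRankGeneratingFunction m
  , Pᴮ-rankSymmetric (suc m) , Pᴮ-rankUnimodal (suc m) , Pᴮ-selfDual (suc m) , Pᴮ-stronglySperner (suc m)
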